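{- The complexity of (1,2)Insertion is at most $n \lg n - 1.40118n$.
   Context: Complexity means the expected number of comparisons over all $n!$ orderings of $n$ distinct input elements (uniformly random input); $n$ is assumed even and $O(\log n)$ terms are ignored. Notation: $\lg=\log_2$, and for real $x>0$, $p_x = x/2^{\lceil \lg x\rceil}\in(1/2,1]$. RHBS$(A,T)$ (right-heavy binary search) inserts $A$ into a sorted $T=(t_1,\dots,t_i)$: if $i\le 3\cdot 2^{\lceil\lg(i+1)\rceil-2}-1$ let $d=2^{\lceil\lg(i+1)\rceil-2}$, otherwise $d=i-2^{\lceil\lg(i+1)\rceil-1}+1$; compare $A$ with $t_d$ and recurse into $(t_1,\dots,t_{d-1})$ or $(t_{d+1},\dots,t_i)$. 2Merge$(A,B,T)$ with $T=(t_1,\dots,t_{i-2})$ sorted, $i$ even, $i\ge4$: Step 1 compare $A,B$ and swap so that $A<B$. Step 2: with $\alpha(r)=1-2^{ -r/2}$, for $r=1,2,\dots$ up to $2\lg i$ compare $A$ with $t_{\lceil\alpha(r)i\rceil}$ and stop at the first $r$ with $A<t_{\lceil\alpha(r)i\rceil}$. Step 3: insert $A$ into $(t_{\lceil\alpha(r-1)i\rceil+1},\dots,t_{\lceil\alpha(r)i\rceil-1})$ by RHBS; say $A$ falls between $t_\ell$ and $t_{\ell+1}$. Step 4: insert $B$ into $(t_{\ell+1},\dots,t_{i-2})$ by RHBS. (1,2)Insertion$(S)$, $S=(s_1,\dots,s_n)$, $n$ even: if $n=2$ sort with one comparison; otherwise sort $(s_1,\dots,s_{n-2})$ recursively by (1,2)Insertion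 to get $T'$; if $p_n\in[0.5511,0.888]$ insert $s_{n-1},s_n$ into $T'$ by 2Merge$(s_{n-1},s_n,T')$, otherwise insert $s_{n-1}$ by RHBS and then $s_n$ by RHBS. -}

module Defs where

open import Data.Bool using (Bool; if_then_else_; _∧_)
open import Data.Fin using (toℕ)
open import Data.Integer using (+_; -[1+_])
open import Data.List using (List; []; _∷_; _++_; length; take; drop; head; map; concatMap; allFin)
open import Data.Maybe using (Maybe; just; nothing)
open import Data.Nat using (ℕ; zero; suc; _+_; _*_; _∸_; _^_; _≤_; _<_; _≤ᵇ_; _<ᵇ_; z≤n; s≤s; _!)
open import Data.Nat.Induction using (<-wellFounded)
open import Data.Nat.ListAction using (sum)
open import Data.Nat.Logarithm using (⌊log₂_⌋; ⌈log₂_⌉)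
open import Data.Nat.Properties using (m^n≢0; _!≢0; ≤-refl; m<n⇒m<1+n)
open import Data.Product using (_×_; _,_; proj₁; proj₂)
open import Data.Rational.Unnormalised as ℚᵘ using (ℚᵘ; mkℚᵘ; _/_)
open import Data.Unit using (⊤)
open import Data.Vec using (Vec; []; _∷_; init; last; insertAt; tabulate)
open import Induction.WellFounded using (Acc; acc)
open import Relation.Binary.PropositionalEquality using (_≡_; refl)

-- A computation paired with the number of comparisons of input elements it
-- makes.  Only `_≺_` has a non-zero cost.
Counted : Set → Set
Counted A = ℕ × A

comparisons : ∀ {A} → Counted A → ℕ
comparisons = proj₁

pure : ∀ {A} → A → Counted A
pure x = 0 , x

infixl 1 _>>=_

_>>=_ : ∀ {A B} → Counted A → (A → Counted B) → Counted B
m >>= f = proj₁ m + proj₁ (f (proj₂ m)) , proj₂ (f (proj₂ m))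

infix 4 _≺_

_≺_ : ℕ → ℕ → Counted Bool
a ≺ b = 1 , (a <ᵇ b)

-- The position d of the pivot in (t₁ , … , tᵢ), for i ≥ 1.  The test
-- i ≤ 3·2^(k-2) - 1 is multiplied out by 4, because k - 2 = -1 when i = 1.
pivot : ℕ → ℕ
pivot i = if 4 * (i + 1) ≤ᵇ 3 * 2 ^ k then 2 ^ (k ∸ 2) else i ∸ 2 ^ (k ∸ 1) + 1
  where
  k : ℕ
  k = ⌈log₂ (i + 1) ⌉

drop-∷-shorter : ∀ m (T : List ℕ) {t R} → drop m T ≡ t ∷ R →
                 length (take m T) < length T × length R < length T
drop-∷-shorter zero    (t ∷ R) refl = s≤s z≤n , ≤-refl
drop-∷-shorter (suc m) (t ∷ T) eq   =
  s≤s (proj₁ (drop-∷-shorter m T eq)) , m<n⇒m<1+n (proj₂ (drop-∷-shorter m T eq))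

-- RHBS returns the number of elements of the sorted list T that lie below A.
rhbsAcc : (A : ℕ) (T : List ℕ) → Acc _<_ (length T) → Counted ℕ
rhbsAcc A T (acc rs) with drop (pivot (length T) ∸ 1) T in eq
... | []    = pure 0
... | t ∷ R = A ≺ t >>= λ below →
  if below
  then rhbsAcc A (take (d ∸ 1) T) (rs (proj₁ (drop-∷-shorter (d ∸ 1) T eq)))
  else (rhbsAcc A R (rs (proj₂ (drop-∷-shorter (d ∸ 1) T eq))) >>= λ j → pure (d + j))
  where
  d : ℕ
  d = pivot (length T)

rhbs : ℕ → List ℕ → Counted ℕ
rhbs A T = rhbsAcc A T (<-wellFounded (length T))

placeAt : ℕ → ℕ → List ℕ → List ℕ
placeAt j A T = take j T ++ A ∷ drop j T

rhbsInsert : ℕ → List ℕ → Counted (List ℕ)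
rhbsInsert A T = rhbs A T >>= λ j → pure (placeAt j A T)

-- ⌊ i / 2^(r/2) ⌋, that is, the largest q ≤ i with q² · 2^r ≤ i².
⌊_/√2^_⌋ : ℕ → ℕ → ℕ
⌊ i /√2^ r ⌋ = search i
  where
  search : ℕ → ℕ
  search zero    = zero
  search (suc q) = if suc q ^ 2 * 2 ^ r ≤ᵇ i ^ 2 then suc q else search q

-- With α(r) = 1 - 2^(-r/2):  ⌈ α(r) i ⌉ = ⌈ i - i / 2^(r/2) ⌉ = i - ⌊ i / 2^(r/2) ⌋.
⌈α_·_⌉ : ℕ → ℕ → ℕ
⌈α r · i ⌉ = i ∸ ⌊ i /√2^ r ⌋

-- The first r, starting from the given one and trying at most `steps` values,
-- with A < t at index ⌈α(r) i⌉, where i = length T + 2.  An index past the end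
-- of T (only i - 1 can occur) stands for t = +∞: the test succeeds without a
-- comparison.  For r the largest integer ≤ 2 lg i the index is i - 1, so the
-- search always stops before `steps` runs out.
firstAbove : (A : ℕ) (T : List ℕ) (steps r : ℕ) → Counted ℕ
firstAbove A T zero        r = pure r
firstAbove A T (suc steps) r with head (drop (⌈α r · length T + 2 ⌉ ∸ 1) T)
... | nothing = pure r
... | just t  = A ≺ t >>= λ below →
  if below then pure r else firstAbove A T steps (suc r)

-- Steps 2 to 4, for A < B.  The bound r ≤ 2 lg i is r ≤ ⌊lg i²⌋.
merge< : (A B : ℕ) → List ℕ → Counted (List ℕ)
merge< A B T =
  firstAbove A T ⌊log₂ (i ^ 2) ⌋ 1                        >>= λ r →
  rhbs A (take (⌈α r · i ⌉ ∸ 1 ∸ ⌈α r ∸ 1 · i ⌉)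
               (drop ⌈α r ∸ 1 · i ⌉ T))                   >>= λ j →
  let ℓ = ⌈α r ∸ 1 · i ⌉ + j in
  rhbsInsert B (drop ℓ T)                                 >>= λ U →
  pure (take ℓ T ++ A ∷ U)
  where
  i : ℕ
  i = length T + 2

2Merge : (A B : ℕ) → List ℕ → Counted (List ℕ)
2Merge A B T = A ≺ B >>= λ below →
  if below then merge< A B T else merge< B A T

p : ℕ → ℚᵘ
p n = (+ n / 2 ^ ⌈log₂ n ⌉) {{m^n≢0 2 ⌈log₂ n ⌉}}

insertPair : (n A B : ℕ) → List ℕ → Counted (List ℕ)
insertPair n A B T =
  if ((+ 5511 / 10000) ℚᵘ.≤ᵇ p n) ∧ (p n ℚᵘ.≤ᵇ (+ 888 / 1000))
  then 2Merge A B T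
  else (rhbsInsert A T >>= rhbsInsert B)

[1,2]Insertion : ∀ k → Vec ℕ (k * 2) → Counted (List ℕ)
[1,2]Insertion zero          []           = pure []
[1,2]Insertion (suc zero)    (a ∷ b ∷ []) = a ≺ b >>= λ below →
  pure (if below then a ∷ b ∷ [] else b ∷ a ∷ [])
[1,2]Insertion (suc (suc k)) S            =
  [1,2]Insertion (suc k) (init (init S)) >>=
  insertPair (suc (suc k) * 2) (last (init S)) (last S)

permutations : ∀ {n} → Vec ℕ n → List (Vec ℕ n)
permutations []               = [] ∷ []
permutations {suc n} (x ∷ xs) =
  concatMap (λ ys → map (λ i → insertAt ys i x) (allFin (suc n))) (permutations xs)

-- The expected number of comparisons over all n! orderings of 0 , … , n - 1.
complexity : ∀ {n} → (Vec ℕ n → Counted (List ℕ)) → ℚᵘ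
complexity {n} sort =
  (+ sum (map (λ S → comparisons (sort S)) (permutations (tabulate toℕ))) / n !) {{n !≢0}}

infix 4 _≤_·lg_

-- q ≤ a · lg m for m ≥ 1: exponentiating, a'/b ≤ a · lg m iff 2^a' ≤ m^(a·b).
-- A negative q lies below a · lg m ≥ 0.
_≤_·lg_ : ℚᵘ → ℕ → ℕ → Set
q@(mkℚᵘ (+ x)    _) ≤ a ·lg m = 2 ^ x ≤ m ^ (a * ℚᵘ.↧ₙ q)
mkℚᵘ -[1+ _ ] _     ≤ a ·lg m = ⊤

{-# OPTIONS --safe #-}
module Submission where

open import Data.Bool using (Bool; true; false; T; if_then_else_; _∧_; _∨_)
open import Data.Fin as Fin using (Fin; zero; suc; toℕ; inject₁; fromℕ)
import Data.Fin.Properties as Fin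
import Data.Integer as ℤ
import Data.Integer.Properties as ℤ
open import Data.List using (List; []; _∷_; _++_; length; take; drop; head; map; concatMap; allFin; tabulate; foldr)
open import Data.List.Membership.Propositional using (_∈_)
open import Data.List.Properties using (length-take; length-drop; map-++; map-tabulate; ≡-dec)
open import Data.List.Relation.Unary.All as All using (All; []; _∷_)
import Data.List.Relation.Unary.Any as Any
open import Data.Maybe using (just; nothing)
open import Data.Nat
open import Data.Nat.DivMod using (m/n*n≤m; /-monoˡ-≤; m*n/n≡m)
open import Data.Nat.Induction using (<-wellFounded)
open import Data.Nat.ListAction using (sum)
open import Data.Nat.ListAction.Properties using (sum-++)
open import Data.Nat.Logarithm
open import Data.Nat.Properties
open import Data.Nat.Tactic.RingSolver using (solve-∀)
open import Data.Product using (_×_; _,_; proj₁; proj₂; ∃-syntax)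
open import Data.Rational.Unnormalised as ℚᵘ using (mkℚᵘ)
open import Data.Sum using (_⊎_; inj₁; inj₂; [_,_]′)
open import Data.Unit using (⊤; tt)
open import Data.Vec as Vec using (Vec; []; _∷_; _∷ʳ_; insertAt; removeAt; lookup; toList; init; last)
open import Data.Vec.Properties using (init-∷ʳ; last-∷ʳ; length-toList)
open import Function using (_∘_; id; it)
open import Induction.WellFounded using (acc)
open import Relation.Binary.PropositionalEquality hiding ([_]; J)
open import Relation.Nullary using (yes; no; contradiction; Dec; _×-dec_)
open import Relation.Nullary.Decidable using (True; toWitness)
open import Defs

-- In a random permutation the last two elements fall into uniformly distributed
-- slots, independently of the order of the others, so the complexity is a sum of
-- averages over the slots of one pair.  RHBS in w slots takes ⌈lg w⌉ comparisons,
-- one less in the leftmost slots; for 2Merge the slot of A is weighted by the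
-- number of slots left to B, and the halving of i in Step 2 is bounded by a
-- potential ψ quadratic in i.  Up to O(1/i), a pair then costs 2 K + α - β/y + γ/y²
-- with y = i/2^K, where α, β, γ depend on the interval that contains y.
-- Summing over a doubling of n reduces the claim to finitely many inequalities
-- on small cells of (1/2,1]: on each cell the cost lies below a chord, verified by
-- Bernstein coefficients, and the logarithm lies above its chord, whose end
-- points are computed digit by digit.

-- Up to O(1/i) the cost of a pair depends on y and K only, so (complexity - n K) / 2^K behaves like
-- one function of n / 2^K that is the same at every scale. It therefore suffices to find a bound
-- `f₀` at y = 1/2 that a doubling of n reproduces; a single table then serves all scales. Exact
-- rounding errors would spoil this self-similarity, but the statement grants C lg n: all n below a
-- huge threshold are paid for by C, and beyond it the errors of a pair are smaller than the slack
-- left in each cell. Several cost functions arise because the depth of a search jumps where its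
-- number of slots crosses a power of two. The first block of Step 2 has about (1 - 1/√2) i slots
-- and the second about (1/√2 - 1/2) i; on the merging range they cross near y = 0.854 and y =
-- 0.604. Later blocks are halves of these two and cross at the same places. Reals are avoided
-- throughout: 1/√2 becomes a fraction r / X, and bounds on logarithms become inequalities between
-- powers.

-- A linear inequality follows from one hypothesis l ≤ r and a semiring identity.
linear : ∀ {l r} x y s → l ≤ r → y + l ≡ x + r + s → x ≤ y
linear {l} {r} x y s l≤r eq = +-cancelʳ-≤ r x y (begin
  x + r      ≤⟨ m≤m+n (x + r) s ⟩
  x + r + s  ≡⟨ eq ⟨
  y + l      ≤⟨ +-monoʳ-≤ y l≤r ⟩
  y + r      ∎)
  where open ≤-Reasoning

-- Halving and binary logarithms

2*⌊n/2⌋≤n : ∀ n → 2 * ⌊ n /2⌋ ≤ n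
2*⌊n/2⌋≤n zero          = z≤n
2*⌊n/2⌋≤n (suc zero)    = z≤n
2*⌊n/2⌋≤n (suc (suc n)) = ≤-trans (≤-reflexive (*-suc 2 ⌊ n /2⌋)) (s≤s (s≤s (2*⌊n/2⌋≤n n)))

n≤1+2*⌊n/2⌋ : ∀ n → n ≤ 1 + 2 * ⌊ n /2⌋
n≤1+2*⌊n/2⌋ zero          = z≤n
n≤1+2*⌊n/2⌋ (suc zero)    = s≤s z≤n
n≤1+2*⌊n/2⌋ (suc (suc n)) =
  ≤-trans (s≤s (s≤s (n≤1+2*⌊n/2⌋ n))) (≤-reflexive (cong suc (sym (*-suc 2 ⌊ n /2⌋))))

dyadic : ∀ n → ∃[ k ] 2 ^ k ≤ suc n × suc n < 2 ^ suc k
dyadic zero    = 0 , s≤s z≤n , s≤s (s≤s z≤n)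
dyadic (suc n) with dyadic n
... | k , lo , hi with suc (suc n) <? 2 ^ suc k
...   | yes lt = k , m≤n⇒m≤1+n lo , lt
...   | no ≮   = suc k , ≮⇒≥ ≮ , (begin-strict
  suc (suc n)      ≤⟨ hi ⟩
  2 ^ suc k        <⟨ m<m+n (2 ^ suc k) (m^n>0 2 (suc k)) ⟩
  2 ^ suc k + 2 ^ suc k  ≡⟨ solve-double (2 ^ suc k) ⟩
  2 ^ suc (suc k)  ∎)
  where
  open ≤-Reasoning
  solve-double : ∀ x → x + x ≡ 2 * x
  solve-double = solve-∀

⌊log₂⌋-unique : ∀ k {n} → 2 ^ k ≤ n → n < 2 ^ suc k → ⌊log₂ n ⌋ ≡ k
⌊log₂⌋-unique zero    {n} lo hi with refl ← ≤-antisym (≤-pred hi) lo = refl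
⌊log₂⌋-unique (suc k) {n} lo hi = begin
  ⌊log₂ n ⌋           ≡⟨ m∸n+n≡m pos ⟨
  ⌊log₂ n ⌋ ∸ 1 + 1   ≡⟨ cong (_+ 1) (⌊log₂⌊n/2⌋⌋≡⌊log₂n⌋∸1 n) ⟨
  ⌊log₂ ⌊ n /2⌋ ⌋ + 1 ≡⟨ cong (_+ 1) half ⟩
  k + 1               ≡⟨ +-comm k 1 ⟩
  suc k               ∎
  where
  open ≡-Reasoning
  half : ⌊log₂ ⌊ n /2⌋ ⌋ ≡ k
  half = ⌊log₂⌋-unique k
    (≤-pred (*-cancelˡ-< 2 _ _ (<-≤-trans (s≤s lo)
      (≤-trans (s≤s (n≤1+2*⌊n/2⌋ n)) (≤-reflexive (sym (*-suc 2 ⌊ n /2⌋)))))))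
    (*-cancelˡ-< 2 _ _ (≤-<-trans (2*⌊n/2⌋≤n n) hi))
  pos : 1 ≤ ⌊log₂ n ⌋
  pos = ⌊log₂⌋-mono-≤ {2} (≤-trans (*-monoʳ-≤ 2 (m^n>0 2 k)) lo)

⌈log₂⌉-unique : ∀ k {n} → 2 ^ k < n → n ≤ 2 ^ suc k → ⌈log₂ n ⌉ ≡ suc k
⌈log₂⌉-unique zero    {n} lo hi with refl ← ≤-antisym hi lo = refl
⌈log₂⌉-unique (suc k) {n} lo hi = begin
  ⌈log₂ n ⌉           ≡⟨ suc-pred ⌈log₂ n ⌉ {{≢-nonZero nz}} ⟨
  suc (⌈log₂ n ⌉ ∸ 1) ≡⟨ cong suc (⌈log₂⌈n/2⌉⌉≡⌈log₂n⌉∸1 n) ⟨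
  suc ⌈log₂ ⌈ n /2⌉ ⌉ ≡⟨ cong suc half ⟩
  suc (suc k)         ∎
  where
  open ≡-Reasoning
  half : ⌈log₂ ⌈ n /2⌉ ⌉ ≡ suc k
  half = ⌈log₂⌉-unique k {⌈ n /2⌉}
    (*-cancelˡ-< 2 _ ⌊ suc n /2⌋ (<-≤-trans lo (≤-pred (n≤1+2*⌊n/2⌋ (suc n)))))
    (≤-pred (*-cancelˡ-< 2 ⌊ suc n /2⌋ _ (≤-<-trans (2*⌊n/2⌋≤n (suc n))
      (<-≤-trans (s≤s (s≤s hi)) (≤-reflexive (sym (*-suc 2 (2 ^ suc k))))))))
  nz : ⌈log₂ n ⌉ ≢ 0
  nz eq with () ← trans (sym half) (trans (⌈log₂⌈n/2⌉⌉≡⌈log₂n⌉∸1 n) (cong (_∸ 1) eq))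

⌈log₂⌉-spec : ∀ {n} → 2 ≤ n → ∃[ k ] ⌈log₂ n ⌉ ≡ suc k × 2 ^ k < n × n ≤ 2 ^ suc k
⌈log₂⌉-spec {suc (suc n)} _ with dyadic n
... | k , lo , hi = k , ⌈log₂⌉-unique k (s≤s lo) hi , s≤s lo , hi
⌈log₂⌉-spec {suc zero} (s≤s ())

-- Right-heavy binary search

-- In terms of w = i + 1 slots with 2^k < w ≤ 2^(k+1), one side of the pivot is a perfect tree: the
-- left one with 2^(k-1) slots if w ≤ 3 · 2^(k-1), otherwise the right one with 2^k slots.
pivot-cases : ∀ i → 1 ≤ i → ∃[ k ] 2 ^ k < i + 1 × i + 1 ≤ 2 ^ suc k ×
  ((∃[ j ] k ≡ suc j × pivot i ≡ 2 ^ j × i + 1 ≤ 3 * 2 ^ j) ⊎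
   (pivot i + 2 ^ k ≡ i + 1 × 3 * 2 ^ k < 2 * (i + 1)))
pivot-cases i i≥1 with ⌈log₂⌉-spec (+-monoˡ-≤ 1 i≥1)
... | k , eq , lo , hi rewrite eq with 4 * (i + 1) ≤ᵇ 3 * 2 ^ suc k in test
-- With i + 1 ≥ 2 the test would read 8 ≤ 6.
pivot-cases i i≥1 | zero , eq , lo , hi | true =
  contradiction (≤-trans (*-monoʳ-≤ 4 lo) (≤ᵇ⇒≤ _ _ (subst T (sym test) tt)))
    λ where (s≤s (s≤s (s≤s (s≤s (s≤s (s≤s ()))))))
pivot-cases i i≥1 | suc j , eq , lo , hi | true = suc j , lo , hi , inj₁ (j , refl , refl ,
  *-cancelˡ-≤ 4 (≤-trans (≤ᵇ⇒≤ _ _ (subst T (sym test) tt)) (≤-reflexive (scale (2 ^ j)))))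
  where
  scale : ∀ x → 3 * (2 * (2 * x)) ≡ 4 * (3 * x)
  scale = solve-∀
pivot-cases i i≥1 | k , eq , lo , hi | false = k , lo , hi , inj₂
  ( (begin
      i ∸ 2 ^ k + 1 + 2 ^ k    ≡⟨ swap (i ∸ 2 ^ k) (2 ^ k) ⟩
      i ∸ 2 ^ k + 2 ^ k + 1    ≡⟨ cong (_+ 1) (m∸n+n≡m (≤-pred (≤-trans lo (≤-reflexive (+-comm i 1))))) ⟩
      i + 1                    ∎)
  , *-cancelˡ-< 2 _ _ (<-≤-trans (≤-<-trans (≤-reflexive (scale (2 ^ k)))
      (≰⇒> λ le → subst T test (≤⇒≤ᵇ le))) (≤-reflexive (scale′ (i + 1)))))
  where
  open ≡-Reasoning
  swap : ∀ x y → x + 1 + y ≡ x + y + 1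
  swap = solve-∀
  scale : ∀ x → 2 * (3 * x) ≡ 3 * (2 * x)
  scale = solve-∀
  scale′ : ∀ x → 4 * x ≡ 2 * (2 * x)
  scale′ = solve-∀

-- All that a search for A observes of T: s elements below A, then only larger ones. Equality is
-- excluded, so positions alone decide every comparison.
data Slot (A : ℕ) : ℕ → List ℕ → Set where
  here  : ∀ {T} → All (A <_) T → Slot A 0 T
  there : ∀ {s t T} → t < A → Slot A s T → Slot A (suc s) (t ∷ T)

slot≤length : ∀ {A s T} → Slot A s T → s ≤ length T
slot≤length (here _)    = z≤n
slot≤length (there _ σ) = s≤s (slot≤length σ)

slot-take : ∀ m {A s T} → s ≤ m → Slot A s T → Slot A s (take m T)
slot-take zero    z≤n     (here _)        = here []
slot-take (suc m) _       (here [])       = here []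
slot-take (suc m) _       (here (a ∷ as)) with slot-take m z≤n (here as)
... | here bs = here (a ∷ bs)
slot-take (suc m) (s≤s p) (there b σ)     = there b (slot-take m p σ)

slot-drop : ∀ m {A s T} → Slot A (m + s) T → Slot A s (drop m T)
slot-drop zero    σ           = σ
slot-drop (suc m) (there _ σ) = slot-drop m σ

slot-compare : ∀ m {A s T t R} → drop m T ≡ t ∷ R → Slot A s T →
               (s ≤ m × A < t) ⊎ (m < s × t < A)
slot-compare zero    refl (here (a ∷ _)) = inj₁ (z≤n , a)
slot-compare zero    refl (there b _)    = inj₂ (s≤s z≤n , b)
slot-compare (suc m) eq   (here (_ ∷ as)) with slot-compare m eq (here as)
... | inj₁ (_ , lt) = inj₁ (z≤n , lt)
slot-compare (suc m) eq   (there _ σ) with slot-compare m eq σ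
... | inj₁ (le , lt) = inj₁ (s≤s le , lt)
... | inj₂ (lt , gt) = inj₂ (s≤s lt , gt)

<ᵇ-true : ∀ {m n} → m < n → (m <ᵇ n) ≡ true
<ᵇ-true {m} {n} m<n with m <ᵇ n | <⇒<ᵇ m<n
... | true | _ = refl

<ᵇ-false : ∀ {m n} → n ≤ m → (m <ᵇ n) ≡ false
<ᵇ-false {m} {n} n≤m with m <ᵇ n in eq
... | false = refl
... | true  = contradiction (<ᵇ⇒< m n (subst T (sym eq) tt)) (≤⇒≯ n≤m)

drop-∷-length : ∀ m {T : List ℕ} {t R} → drop m T ≡ t ∷ R → length T ≡ m + suc (length R)
drop-∷-length zero            refl = refl
drop-∷-length (suc m) {_ ∷ _} eq   = cong suc (drop-∷-length m eq)

drop-suc : ∀ m {T : List ℕ} {t R} → drop m T ≡ t ∷ R → drop (suc m) T ≡ R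
drop-suc zero            refl = refl
drop-suc (suc m) {_ ∷ _} eq   = drop-suc m eq

drop-[]⇒≤ : ∀ m {T : List ℕ} → drop m T ≡ [] → length T ≤ m
drop-[]⇒≤ zero            refl = z≤n
drop-[]⇒≤ (suc m) {[]}    eq   = z≤n
drop-[]⇒≤ (suc m) {_ ∷ _} eq   = s≤s (drop-[]⇒≤ m eq)

-- A search over w slots takes at most k comparisons, and at most k - 1 for the
-- 2^k - w leftmost slots.
record Depth (k w s c : ℕ) : Set where
  constructor depth
  field
    long  : c ≤ k
    short : s + w < 2 ^ k → c < k
open Depth

depth-weaken : ∀ {w s c} k l → k ≤ l → w ≤ 2 ^ k → Depth k w s c → Depth l w s c
depth-weaken k l k≤l w≤ d with m≤n⇒m<n∨m≡n k≤l
... | inj₁ k<l  = depth (≤-trans (long d) k≤l) λ _ → ≤-<-trans (long d) k<l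
... | inj₂ refl = d

2^-cancel-< : ∀ l k → 2 ^ l < 2 ^ k → l < k
2^-cancel-< l k lt = ≰⇒> λ k≤l → <⇒≱ lt (^-monoʳ-≤ 2 k≤l)

2*n≡n+n : ∀ n → 2 * n ≡ n + n
2*n≡n+n = solve-∀

-- Quantifying over k lets a recursive call be read at whatever exponent its caller has at hand.
-- Above ⌈lg w⌉ the claim is just c < k, which `depth-weaken` supplies.
Within : ℕ → ℕ → ℕ → Set
Within w s c = ∀ k → w ≤ 2 ^ k → Depth k w s c

depth-any : ∀ {l w s c} → 2 ^ l < w → w ≤ 2 ^ suc l → Depth (suc l) w s c →
            Within w s c
depth-any {l} lo hi D k w≤ = depth-weaken (suc l) k (2^-cancel-< l k (<-≤-trans lo w≤)) hi D

pivot-bounds : ∀ i → 1 ≤ i → 1 ≤ pivot i × pivot i ≤ i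
pivot-bounds i i≥1 with pivot-cases i i≥1
... | k , lo , hi , inj₁ (j , refl , eq , le) rewrite eq =
  m^n>0 2 j , +-cancelʳ-≤ 1 _ _ (≤-trans (+-monoʳ-≤ (2 ^ j) (m^n>0 2 j))
    (≤-trans (≤-reflexive (sym (2*n≡n+n (2 ^ j)))) (<⇒≤ lo)))
... | k , lo , hi , inj₂ (eq , gt) =
  +-cancelʳ-< (2 ^ k) 0 (pivot i) (<-≤-trans lo (≤-reflexive (sym eq))) ,
  +-cancelʳ-≤ 1 _ _ (≤-trans (+-monoʳ-≤ (pivot i) (m^n>0 2 k)) (≤-reflexive eq))

module PivotStep (i : ℕ) (i≥1 : 1 ≤ i) (r : ℕ) (total : pivot i + r ≡ i + 1) where

  -- In the first case of `pivot-cases` the left tree is perfect and ends a level early, so all its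
  -- slots are short. In the second, removing the 2^l slots on the right turns the test for short
  -- slots into that of the left tree.
  left-depth : ∀ {s c} → Within (pivot i) s c → Within (i + 1) s (1 + c)
  left-depth {s} {c} ih with pivot-cases i i≥1
  ... | l , lo , hi , inj₁ (j , refl , eq , le) =
    depth-any lo hi (depth (s≤s (m≤n⇒m≤1+n c≤j)) λ _ → s≤s (s≤s c≤j))
    where
    c≤j : c ≤ j
    c≤j = long (ih j (≤-reflexive eq))
  ... | l , lo , hi , inj₂ (eq , gt) =
    depth-any lo hi (depth (s≤s (long D)) λ lt → s≤s (short D (+-cancelʳ-< (2 ^ l) _ _
      (begin-strict
        s + pivot i + 2 ^ l    ≡⟨ +-assoc s _ _ ⟩
        s + (pivot i + 2 ^ l)  ≡⟨ cong (s +_) eq ⟩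
        s + (i + 1)            <⟨ lt ⟩
        2 * 2 ^ l              ≡⟨ 2*n≡n+n (2 ^ l) ⟩
        2 ^ l + 2 ^ l          ∎))))
    where
    open ≤-Reasoning
    D : Depth l (pivot i) s c
    D = ih l (+-cancelʳ-≤ (2 ^ l) _ _
      (≤-trans (≤-reflexive eq) (≤-trans hi (≤-reflexive (2*n≡n+n (2 ^ l))))))

  -- In the first case the 2^j slots on the left enter the test twice, once in the position and once
  -- in the width, and cancel against 2^(j+2). In the second the right tree is perfect at full depth
  -- and its positions already fail the test.
  right-depth : ∀ {s c} → Within r s c → Within (i + 1) (pivot i + s) (1 + c)
  right-depth {s} {c} ih with pivot-cases i i≥1
  ... | l , lo , hi , inj₁ (j , refl , eq , le) =
    depth-any lo hi (depth (s≤s (long D)) λ lt → s≤s (short D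
      (linear _ _ 0 (≤-trans (s≤s (≤-reflexive (cong₂ (λ d w → d + s + w) (sym eq) total′))) lt)
        (balance s r (2 ^ j)))))
    where
    total′ : 2 ^ j + r ≡ i + 1
    total′ = trans (cong (_+ r) (sym eq)) total
    balance : ∀ s r x → 2 * x + suc (x + s + (x + r)) ≡ suc (s + r) + 2 * (2 * x) + 0
    balance = solve-∀
    D : Depth (suc j) r s c
    D = ih (suc j) (+-cancelˡ-≤ (2 ^ j) _ _ (≤-trans (≤-reflexive total′)
      (≤-trans le (≤-reflexive (triple (2 ^ j))))))
      where
      triple : ∀ x → 3 * x ≡ x + 2 * x
      triple = solve-∀
  ... | l , lo , hi , inj₂ (eq , gt) =
    depth-any lo hi (depth (s≤s c≤l) λ lt → contradiction lt (≤⇒≯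
      (linear (2 * 2 ^ l) (pivot i + s + (i + 1)) s
        (≤-trans (<⇒≤ gt) (≤-reflexive (cong (2 *_) (sym eq))))
        (balance (pivot i) s (i + 1) (2 ^ l) eq))))
    where
    balance : ∀ d s w x → d + x ≡ w → d + s + w + 3 * x ≡ 2 * x + 2 * (d + x) + s
    balance d s w x refl = balance′ d s x
      where
      balance′ : ∀ d s x → d + s + (d + x) + 3 * x ≡ 2 * x + 2 * (d + x) + s
      balance′ = solve-∀
    c≤l : c ≤ l
    c≤l = long (ih l (≤-reflexive (+-cancelˡ-≡ (pivot i) _ _ (trans total (sym eq)))))

module Pivot {T : List ℕ} (T≥1 : 1 ≤ length T) where
  d : ℕ
  d = pivot (length T)

  1+[d∸1] : d ∸ 1 + 1 ≡ d
  1+[d∸1] = m∸n+n≡m (proj₁ (pivot-bounds (length T) T≥1))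

  drop≢[] : drop (d ∸ 1) T ≢ []
  drop≢[] eq = <⇒≱
    (≤-trans (≤-reflexive (trans (+-comm 1 _) 1+[d∸1])) (proj₂ (pivot-bounds (length T) T≥1)))
    (drop-[]⇒≤ (d ∸ 1) eq)

  module _ {t R} (eq : drop (d ∸ 1) T ≡ t ∷ R) where
    total : d + (length R + 1) ≡ length T + 1
    total = begin
      d + (length R + 1)           ≡⟨ cong (_+ (length R + 1)) 1+[d∸1] ⟨
      d ∸ 1 + 1 + (length R + 1)   ≡⟨ regroup (d ∸ 1) (length R) ⟩
      d ∸ 1 + suc (length R) + 1   ≡⟨ cong (_+ 1) (drop-∷-length (d ∸ 1) eq) ⟨
      length T + 1                 ∎
      where
      open ≡-Reasoning
      regroup : ∀ m r → m + 1 + (r + 1) ≡ m + suc r + 1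
      regroup = solve-∀

    length-left : length (take (d ∸ 1) T) + 1 ≡ d
    length-left = trans (cong (_+ 1) (trans (length-take (d ∸ 1) T) (m≤n⇒m⊓n≡m
      (≤-trans (m≤m+n (d ∸ 1) _) (≤-reflexive (sym (drop-∷-length (d ∸ 1) eq))))))) 1+[d∸1]

    open PivotStep (length T) T≥1 (length R + 1) total public

    slot-right : ∀ {A s} → d ∸ 1 < s → Slot A s T → Slot A (s ∸ d) R
    slot-right {A} {s} lt σ = subst (Slot A (s ∸ d)) (drop-suc (d ∸ 1) eq)
      (slot-drop (suc (d ∸ 1)) (subst (λ x → Slot A x T) (sym split) σ))
      where
      1+m : suc (d ∸ 1) ≡ d
      1+m = trans (+-comm 1 _) 1+[d∸1]
      split : suc (d ∸ 1) + (s ∸ d) ≡ s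
      split = trans (cong (_+ (s ∸ d)) 1+m) (m+[n∸m]≡n (subst (_≤ s) 1+m lt))

    d≤ : ∀ {s} → d ∸ 1 < s → d ≤ s
    d≤ lt = subst (_≤ _) (trans (+-comm 1 _) 1+[d∸1]) lt

drop-∷⇒nonempty : ∀ m {T : List ℕ} {t R} → drop m T ≡ t ∷ R → 1 ≤ length T
drop-∷⇒nonempty m eq = ≤-trans (≤-trans (s≤s z≤n) (m≤n+m _ m)) (≤-reflexive (sym (drop-∷-length m eq)))

rhbs-empty : ∀ {A s} T → drop (pivot (length T) ∸ 1) T ≡ [] → Slot A s T →
             0 ≡ s × Within (length T + 1) s 0
rhbs-empty []      _  (here _) = refl , λ k _ → depth z≤n (positive k)
  where
  positive : ∀ k → 1 < 2 ^ k → 0 < k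
  positive zero    (s≤s ())
  positive (suc k) _ = s≤s z≤n
rhbs-empty (x ∷ T) eq _ = contradiction eq (Pivot.drop≢[] {x ∷ T} (s≤s z≤n))

-- rhbsAcc abstracts over `drop … T in eq`, so a proof has to abstract over the
-- same list and over `refl` at once, but must keep the left-hand side of the
-- type of `refl`.  The eta-rule of ⊤ makes h u and h tt equal but syntactically
-- different, which protects that side.
private
  pivot-refl : ∀ (h : ⊤ → List ℕ) u →
    drop (pivot (length (h u)) ∸ 1) (h u) ≡ drop (pivot (length (h tt)) ∸ 1) (h tt)
  pivot-refl h u = refl

rhbsAcc-spec : ∀ A (h : ⊤ → List ℕ) (u : ⊤) {s} ac → Slot A s (h tt) →
  proj₂ (rhbsAcc A (h tt) ac) ≡ s ×
  Within (length (h tt) + 1) s (proj₁ (rhbsAcc A (h tt) ac))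
rhbsAcc-spec A h u {s} (acc rs) σ with drop (pivot (length (h tt)) ∸ 1) (h tt) | pivot-refl h u
... | []    | eq = rhbs-empty (h tt) eq σ
... | t ∷ R | eq with slot-compare (pivot (length (h tt)) ∸ 1) eq σ
...   | inj₁ (s≤m , A<t) rewrite <ᵇ-true A<t = proj₁ ih , left-depth eq
        (subst (λ w → Within w s (proj₁ rec)) (length-left eq) (proj₂ ih))
  where
  open Pivot {h tt} (drop-∷⇒nonempty (pivot (length (h tt)) ∸ 1) eq)
  rec = rhbsAcc A (take (d ∸ 1) (h tt)) (rs (proj₁ (drop-∷-shorter (d ∸ 1) (h tt) eq)))
  ih = rhbsAcc-spec A (λ _ → take (d ∸ 1) (h tt)) tt
         (rs (proj₁ (drop-∷-shorter (d ∸ 1) (h tt) eq))) (slot-take (d ∸ 1) s≤m σ)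
...   | inj₂ (m<s , t<A) rewrite <ᵇ-false (<⇒≤ t<A) =
        trans (cong (d +_) (proj₁ ih)) (m+[n∸m]≡n (d≤ eq m<s)) ,
        λ k w≤ → subst₂ (Depth k (length (h tt) + 1)) (m+[n∸m]≡n (d≤ eq m<s))
          (cong suc (sym (+-identityʳ _))) (right-depth eq (proj₂ ih) k w≤)
  where
  open Pivot {h tt} (drop-∷⇒nonempty (pivot (length (h tt)) ∸ 1) eq)
  ih = rhbsAcc-spec A (λ _ → R) tt
         (rs (proj₂ (drop-∷-shorter (d ∸ 1) (h tt) eq))) (slot-right eq m<s σ)

rhbs-spec : ∀ {A s} T → Slot A s T → proj₂ (rhbs A T) ≡ s ×
  Within (length T + 1) s (proj₁ (rhbs A T))
rhbs-spec {A} T = rhbsAcc-spec A (λ _ → T) tt (<-wellFounded (length T))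

-- Finite sums and total depths

∑ : ℕ → (ℕ → ℕ) → ℕ
∑ zero    f = 0
∑ (suc n) f = ∑ n f + f n

∑-mono : ∀ n {f g} → (∀ i → i < n → f i ≤ g i) → ∑ n f ≤ ∑ n g
∑-mono zero    f≤g = z≤n
∑-mono (suc n) f≤g = +-mono-≤ (∑-mono n λ i i<n → f≤g i (m<n⇒m<1+n i<n)) (f≤g n ≤-refl)

∑-cong : ∀ n {f g} → (∀ i → i < n → f i ≡ g i) → ∑ n f ≡ ∑ n g
∑-cong n eq = ≤-antisym (∑-mono n λ i i<n → ≤-reflexive (eq i i<n))
                        (∑-mono n λ i i<n → ≤-reflexive (sym (eq i i<n)))

∑-split : ∀ m n f → ∑ (m + n) f ≡ ∑ m f + ∑ n (λ i → f (m + i))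
∑-split m zero    f = trans (cong (λ x → ∑ x f) (+-identityʳ m)) (sym (+-identityʳ _))
∑-split m (suc n) f = begin
  ∑ (m + suc n) f                                 ≡⟨ cong (λ x → ∑ x f) (+-suc m n) ⟩
  ∑ (m + n) f + f (m + n)                         ≡⟨ cong (_+ f (m + n)) (∑-split m n f) ⟩
  ∑ m f + ∑ n (λ i → f (m + i)) + f (m + n)       ≡⟨ +-assoc (∑ m f) _ _ ⟩
  ∑ m f + (∑ n (λ i → f (m + i)) + f (m + n))     ∎
  where open ≡-Reasoning

∑-distrib-+ : ∀ n f g → ∑ n (λ i → f i + g i) ≡ ∑ n f + ∑ n g
∑-distrib-+ zero    f g = refl
∑-distrib-+ (suc n) f g = trans (cong (_+ (f n + g n)) (∑-distrib-+ n f g)) (swap (∑ n f) (∑ n g) (f n) (g n))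
  where
  swap : ∀ a b c d → a + b + (c + d) ≡ a + c + (b + d)
  swap = solve-∀

*-distribˡ-∑ : ∀ c n f → c * ∑ n f ≡ ∑ n (λ i → c * f i)
*-distribˡ-∑ c zero    f = *-zeroʳ c
*-distribˡ-∑ c (suc n) f = trans (*-distribˡ-+ c (∑ n f) (f n)) (cong (_+ c * f n) (*-distribˡ-∑ c n f))

∑-const : ∀ n c → ∑ n (λ _ → c) ≡ n * c
∑-const zero    c = refl
∑-const (suc n) c = trans (cong (_+ c) (∑-const n c)) (+-comm (n * c) c)

tri : ℕ → ℕ
tri n = ∑ n id

2*tri : ∀ n → 2 * tri n + n ≡ n * n
2*tri zero    = refl
2*tri (suc n) = trans (step (tri n) n) (trans (cong (λ x → x + 2 * n + 1) (2*tri n)) (square n))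
  where
  step : ∀ t n → 2 * (t + n) + suc n ≡ 2 * t + n + 2 * n + 1
  step = solve-∀
  square : ∀ n → n * n + 2 * n + 1 ≡ suc n * suc n
  square = solve-∀

tri-+ : ∀ b w → tri b + ∑ w (b +_) ≡ tri (b + w)
tri-+ b w = sym (∑-split b w id)

depthAt : ℕ → ℕ → ℕ → ℕ
depthAt k w s = if s + w <ᵇ 2 ^ k then k ∸ 1 else k

depthAt-Depth : ∀ k w s → 1 ≤ w → Depth k w s (depthAt k w s)
depthAt-Depth k w s w≥1 with s + w <ᵇ 2 ^ k in test
depthAt-Depth (suc k) w s w≥1 | true  = depth (n≤1+n k) λ _ → ≤-refl
depthAt-Depth zero    w s w≥1 | true  = contradiction
  (≤-trans w≥1 (m≤n+m w s)) (<⇒≱ (<ᵇ⇒< (s + w) 1 (subst T (sym test) tt)))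
depthAt-Depth k       w s w≥1 | false = depth ≤-refl λ lt → contradiction lt
  λ lt → subst T test (<⇒<ᵇ lt)

-- For w ≥ 1 this is the largest c with `Within w s c` (`Within⇒≤dep`, `dep-Within`): a closed form
-- that can be summed.
dep : ℕ → ℕ → ℕ
dep w s = depthAt ⌈log₂ w ⌉ w s

n≤2^⌈log₂n⌉ : ∀ n → n ≤ 2 ^ ⌈log₂ n ⌉
n≤2^⌈log₂n⌉ zero          = z≤n
n≤2^⌈log₂n⌉ (suc zero)    = ≤-refl
n≤2^⌈log₂n⌉ (suc (suc n)) with ⌈log₂⌉-spec {suc (suc n)} (s≤s (s≤s z≤n))
... | k , eq , _ , hi = subst (λ x → suc (suc n) ≤ 2 ^ x) (sym eq) hi

Within⇒≤dep : ∀ {w s c} → Within w s c → c ≤ dep w s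
Within⇒≤dep {w} {s} W with s + w <ᵇ 2 ^ ⌈log₂ w ⌉ in test
... | false = long (W ⌈log₂ w ⌉ (n≤2^⌈log₂n⌉ w))
... | true  = ∸-monoˡ-≤ 1 (short (W ⌈log₂ w ⌉ (n≤2^⌈log₂n⌉ w)) (<ᵇ⇒< (s + w) (2 ^ ⌈log₂ w ⌉) (subst T (sym test) tt)))

dep-Within : ∀ w s → 1 ≤ w → Within w s (dep w s)
dep-Within w s w≥1 k w≤ = depth-weaken ⌈log₂ w ⌉ k (≤-trans (⌈log₂⌉-mono-≤ w≤) (≤-reflexive (⌈log₂2^n⌉≡n k)))
  (n≤2^⌈log₂n⌉ w) (depthAt-Depth ⌈log₂ w ⌉ w s w≥1)

-- The weighted number of comparisons over a block of w slots, where x counts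
-- the slots from the right and slot x has weight b + x.
blk : ℕ → ℕ → ℕ
blk b w = ∑ w (λ x → (b + x) * dep w (w ∸ suc x))

-- Of f + e slots, with f + 2 e = 2^k, the e leftmost ones have depth k - 1.
blk-bound : ∀ k b f e → f + e + e ≡ 2 ^ k →
            blk b (f + e) + ∑ e (λ x → b + f + x) ≤ k * ∑ (f + e) (b +_)
blk-bound k b f e p≡ = begin
  blk b w + ∑ e (λ x → b + f + x)
    ≡⟨ cong (_+ ∑ e (λ x → b + f + x)) (∑-split f e _) ⟩
  ∑ f (λ x → (b + x) * dep w (w ∸ suc x)) + ∑ e (λ x → (b + (f + x)) * dep w (w ∸ suc (f + x)))
    + ∑ e (λ x → b + f + x)
    ≡⟨ +-assoc (∑ f _) _ _ ⟩
  ∑ f (λ x → (b + x) * dep w (w ∸ suc x)) + (∑ e (λ x → (b + (f + x)) * dep w (w ∸ suc (f + x)))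
    + ∑ e (λ x → b + f + x))
    ≡⟨ cong (∑ f (λ x → (b + x) * dep w (w ∸ suc x)) +_) (∑-distrib-+ e _ _) ⟨
  ∑ f (λ x → (b + x) * dep w (w ∸ suc x)) + ∑ e (λ x → (b + (f + x)) * dep w (w ∸ suc (f + x)) + (b + f + x))
    ≤⟨ +-mono-≤ (∑-mono f longs) (∑-mono e shorts) ⟩
  ∑ f (λ x → k * (b + x)) + ∑ e (λ x → k * (b + (f + x)))
    ≡⟨ ∑-split f e _ ⟨
  ∑ w (λ x → k * (b + x))
    ≡⟨ *-distribˡ-∑ k w (b +_) ⟨
  k * ∑ w (b +_) ∎
  where
  open ≤-Reasoning
  w : ℕ
  w = f + e
  w≤ : w ≤ 2 ^ k
  w≤ = ≤-trans (m≤m+n w e) (≤-reflexive p≡)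
  D : ∀ x → x < w → ∀ s → Depth k w s (dep w s)
  D x x<w s = dep-Within w s (≤-trans (s≤s z≤n) x<w) k w≤
  longs : ∀ x → x < f → (b + x) * dep w (w ∸ suc x) ≤ k * (b + x)
  longs x x<f = ≤-trans (*-monoʳ-≤ (b + x) (long (D x (<-≤-trans x<f (m≤m+n f e)) (w ∸ suc x))))
                        (≤-reflexive (*-comm (b + x) k))
  shorts : ∀ x → x < e → (b + (f + x)) * dep w (w ∸ suc (f + x)) + (b + f + x) ≤ k * (b + (f + x))
  shorts x x<e = begin
    (b + (f + x)) * d + (b + f + x)  ≡⟨ regroup b f x d ⟩
    suc d * (b + (f + x))            ≤⟨ *-monoˡ-≤ (b + (f + x)) (short (D (f + x) (+-monoʳ-< f x<e) s) s+w<) ⟩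
    k * (b + (f + x))                ∎
    where
    s d : ℕ
    s = w ∸ suc (f + x)
    d = dep w s
    regroup : ∀ b f x d → (b + (f + x)) * d + (b + f + x) ≡ suc d * (b + (f + x))
    regroup = solve-∀
    s<e : s < e
    s<e = +-cancelˡ-≤ (f + x) _ _ (begin
      f + x + suc s   ≡⟨ trans (+-suc (f + x) s) (+-comm (suc (f + x)) s) ⟩
      s + suc (f + x) ≡⟨ m∸n+n≡m (+-monoʳ-< f x<e) ⟩
      f + e           ≤⟨ +-monoˡ-≤ e (m≤m+n f x) ⟩
      f + x + e       ∎)
    s+w< : s + w < 2 ^ k
    s+w< = <-≤-trans (+-monoˡ-< w s<e) (≤-reflexive (trans (+-comm e w) p≡))

-- Unweighted companion of `blk-bound`; slots are counted from the left, so the e short ones come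
-- first.
∑-dep : ∀ k f e → f + e + e ≡ 2 ^ k → ∑ (f + e) (dep (f + e)) + e ≤ k * (f + e)
∑-dep k f e p≡ = begin
  ∑ w (dep w) + e
    ≡⟨ cong (λ x → ∑ x (dep w) + e) (+-comm f e) ⟩
  ∑ (e + f) (dep w) + e
    ≡⟨ cong (_+ e) (∑-split e f (dep w)) ⟩
  ∑ e (dep w) + ∑ f (λ x → dep w (e + x)) + e
    ≡⟨ cong (∑ e (dep w) + ∑ f (λ x → dep w (e + x)) +_) (trans (sym (*-identityʳ e)) (sym (∑-const e 1))) ⟩
  ∑ e (dep w) + ∑ f (λ x → dep w (e + x)) + ∑ e (λ _ → 1)
    ≡⟨ regroup (∑ e (dep w)) _ _ ⟩
  ∑ e (dep w) + ∑ e (λ _ → 1) + ∑ f (λ x → dep w (e + x))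
    ≡⟨ cong (_+ ∑ f (λ x → dep w (e + x))) (∑-distrib-+ e _ _) ⟨
  ∑ e (λ x → dep w x + 1) + ∑ f (λ x → dep w (e + x))
    ≤⟨ +-mono-≤ (∑-mono e shorts) (∑-mono f longs) ⟩
  ∑ e (λ _ → k) + ∑ f (λ _ → k)
    ≡⟨ cong₂ _+_ (∑-const e k) (∑-const f k) ⟩
  e * k + f * k
    ≡⟨ total e f k ⟩
  k * (f + e) ∎
  where
  open ≤-Reasoning
  w : ℕ
  w = f + e
  regroup : ∀ a b c → a + b + c ≡ a + c + b
  regroup = solve-∀
  total : ∀ e f k → e * k + f * k ≡ k * (f + e)
  total = solve-∀
  w≤ : w ≤ 2 ^ k
  w≤ = ≤-trans (m≤m+n w e) (≤-reflexive p≡)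
  longs : ∀ x → x < f → dep w (e + x) ≤ k
  longs x x<f = long (dep-Within w (e + x) (≤-trans (≤-trans (s≤s z≤n) x<f) (m≤m+n f e)) k w≤)
  shorts : ∀ x → x < e → dep w x + 1 ≤ k
  shorts x x<e = ≤-trans (≤-reflexive (+-comm (dep w x) 1))
    (short (dep-Within w x (≤-trans (≤-trans (s≤s z≤n) x<e) (m≤n+m e f)) k w≤)
      (<-≤-trans (+-monoˡ-< w x<e) (≤-reflexive (trans (+-comm e w) p≡))))

-- w slots, 2^(k-1) ≤ w ≤ 2^k, split into f long ones and e short ones.
split-slots : ∀ p w → w ≤ p → p ≤ 2 * w → ∃[ f ] ∃[ e ] f + e ≡ w × f + e + e ≡ p
split-slots p w w≤p p≤2w = w ∸ (p ∸ w) , p ∸ w , f+e≡w , trans (cong (_+ (p ∸ w)) f+e≡w) (m+[n∸m]≡n w≤p)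
  where
  f+e≡w : w ∸ (p ∸ w) + (p ∸ w) ≡ w
  f+e≡w = m∸n+n≡m (≤-trans (∸-monoˡ-≤ w p≤2w) (≤-reflexive (trans (cong (_∸ w) (2*n≡n+n w)) (m+n∸n≡m w w))))

∑-dep-bound : ∀ k m → m ≤ 2 ^ k → 2 ^ k ≤ 2 * m → ∑ m (dep m) + 2 ^ k ≤ suc k * m
∑-dep-bound k m m≤ ≤2m with split-slots (2 ^ k) m m≤ ≤2m
... | f , e , refl , p≡ = linear _ _ 0 (∑-dep k f e p≡)
  (trans (balance (∑ (f + e) (dep (f + e))) f e k) (cong (λ p → ∑ (f + e) (dep (f + e)) + p + k * (f + e) + 0) p≡))
  where
  balance : ∀ s f e k → suc k * (f + e) + (s + e) ≡ s + (f + e + e) + k * (f + e) + 0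
  balance = solve-∀

private
  fold : ∀ b f e {c p} → f + e + e ≡ p → c + p ≡ b + 2 * (f + e) → c ≡ b + f
  fold b f e {c} refl c≡ = +-cancelʳ-≡ (f + e + e) c (b + f) (trans c≡ (regroup b f e))
    where
    regroup : ∀ b f e → b + 2 * (f + e) ≡ b + f + (f + e + e)
    regroup = solve-∀

-- Here c = b + f is the weight at which the short slots begin. They weigh tri (b + w) - tri c
-- together, which is what they save. Triangular numbers of the block ends let consecutive blocks be
-- chained.
blk-tri : ∀ k b w c → w ≤ 2 ^ k → 2 ^ k ≤ 2 * w → c + 2 ^ k ≡ b + 2 * w →
          blk b w + tri (b + w) + k * tri b ≤ k * tri (b + w) + tri c
blk-tri k b w c w≤ ≤2w c≡ with split-slots (2 ^ k) w w≤ ≤2w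
... | f , e , refl , p≡ with refl ← fold b f e p≡ c≡ = linear _ _ 0 (blk-bound k b f e p≡)
  (subst₂ (λ x y → k * x + tri (b + f) + (blk b (f + e) + S₂) ≡ blk b (f + e) + y + k * tri b + k * S₁ + 0)
    (tri-+ b (f + e)) (trans (tri-+ (b + f) e) (cong tri (+-assoc b f e)))
    (balance (tri b) S₁ (tri (b + f)) S₂ (blk b (f + e)) k))
  where
  S₁ S₂ : ℕ
  S₁ = ∑ (f + e) (b +_)
  S₂ = ∑ e (λ x → b + f + x)
  balance : ∀ tb s₁ tf s₂ B k → k * (tb + s₁) + tf + (B + s₂) ≡ B + (tf + s₂) + k * tb + k * s₁ + 0
  balance = solve-∀

-- 2Merge

-- The cost of Step 2 and Step 3 of 2Merge for an A with m slots to its right,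
-- m < a: a is the current ⌊i/2^(r/2)⌋ and h the next one, so that the one
-- after next is ⌊a/2⌋.
searchCost : ℕ → ℕ → ℕ → ℕ → ℕ
searchCost zero    a h m = 0
searchCost (suc f) a h m = suc (if h ≤ᵇ m then dep (a ∸ h) (a ∸ suc m) else searchCost f h ⌊ a /2⌋ m)

searchCost-mono : ∀ f a h m → searchCost f a h m ≤ searchCost (suc f) a h m
searchCost-mono zero    a h m = z≤n
searchCost-mono (suc f) a h m with h ≤ᵇ m
... | true  = ≤-refl
... | false = s≤s (searchCost-mono f h ⌊ a /2⌋ m)

searchSum : ℕ → ℕ → ℕ → ℕ
searchSum f a h = ∑ a (λ m → m * searchCost f a h m)

searchSum-mono : ∀ f a h → searchSum f a h ≤ searchSum (suc f) a h
searchSum-mono f a h = ∑-mono a λ m _ → *-monoʳ-≤ m (searchCost-mono f a h m)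

searchSum-step : ∀ f h w → searchSum (suc f) (h + w) h ≡
                 tri (h + w) + (searchSum f h ⌊ (h + w) /2⌋ + blk h w)
searchSum-step f h w = begin
  ∑ (h + w) (λ m → m * suc (next m))
    ≡⟨ ∑-cong (h + w) (λ m _ → *-suc m (next m)) ⟩
  ∑ (h + w) (λ m → m + m * next m)
    ≡⟨ ∑-distrib-+ (h + w) id _ ⟩
  tri (h + w) + ∑ (h + w) (λ m → m * next m)
    ≡⟨ cong (tri (h + w) +_) (∑-split h w _) ⟩
  tri (h + w) + (∑ h (λ m → m * next m) + ∑ w (λ x → (h + x) * next (h + x)))
    ≡⟨ cong (tri (h + w) +_) (cong₂ _+_ (∑-cong h below) (∑-cong w above)) ⟩
  tri (h + w) + (searchSum f h ⌊ (h + w) /2⌋ + blk h w) ∎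
  where
  open ≡-Reasoning
  next : ℕ → ℕ
  next m = if h ≤ᵇ m then dep (h + w ∸ h) (h + w ∸ suc m) else searchCost f h ⌊ (h + w) /2⌋ m
  below : ∀ m → m < h → m * next m ≡ m * searchCost f h ⌊ (h + w) /2⌋ m
  below m m<h with h ≤ᵇ m in test
  ... | false = refl
  ... | true  = contradiction (≤ᵇ⇒≤ h m (subst T (sym test) tt)) (<⇒≱ m<h)
  above : ∀ x → x < w → (h + x) * next (h + x) ≡ (h + x) * dep w (w ∸ suc x)
  above x _ with h ≤ᵇ (h + x) in test
  ... | true  = cong ((h + x) *_) (cong₂ dep (m+n∸m≡n h w)
                  (trans (cong (h + w ∸_) (sym (+-suc h x))) ([m+n]∸[m+o]≡n∸o h w (suc x))))
  ... | false = contradiction (≤⇒≤ᵇ (m≤m+n h x)) (subst T test)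

n<2^n : ∀ n → n < 2 ^ n
n<2^n zero    = s≤s z≤n
n<2^n (suc n) = ≤-trans (+-mono-≤ (m^n>0 2 n) (n<2^n n)) (≤-reflexive (sym (2*n≡n+n (2 ^ n))))

dep≤ : ∀ w s → dep w s ≤ w
dep≤ zero    s with s + 0 <ᵇ 1
... | true  = z≤n
... | false = z≤n
dep≤ (suc w) s = long (dep-Within (suc w) s (s≤s z≤n) (suc w) (<⇒≤ (n<2^n (suc w))))

blk≤ : ∀ b w → blk b w ≤ (b + w) * (w * (b + w))
blk≤ b w = begin
  blk b w                    ≤⟨ ∑-mono w (λ x x<w → *-mono-≤ (+-monoʳ-≤ b (<⇒≤ x<w)) (dep≤ w _)) ⟩
  ∑ w (λ _ → (b + w) * w)    ≡⟨ ∑-const w _ ⟩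
  w * ((b + w) * w)          ≡⟨ regroup b w ⟩
  w * (w * (b + w))          ≤⟨ *-monoˡ-≤ (w * (b + w)) (m≤n+m w b) ⟩
  (b + w) * (w * (b + w))    ∎
  where
  open ≤-Reasoning
  regroup : ∀ b w → w * ((b + w) * w) ≡ w * (w * (b + w))
  regroup = solve-∀

tri≤ : ∀ a → tri a ≤ a * a
tri≤ a = ≤-trans (m≤m+n (tri a) (tri a + a)) (≤-reflexive (trans (regroup (tri a) a) (2*tri a)))
  where
  regroup : ∀ t a → t + (t + a) ≡ 2 * t + a
  regroup = solve-∀

n*n≤n*n*n : ∀ n → n * n ≤ n * n * n
n*n≤n*n*n zero    = z≤n
n*n≤n*n*n (suc n) = m≤m*n (suc n * suc n) (suc n)

split-≤ : ∀ {m n} → m ≤ n → ∃[ o ] m + o ≡ n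
split-≤ {m} {n} m≤n = n ∸ m , m+[n∸m]≡n m≤n

-- A rough bound free of the fuel is enough, since it is applied only where a ≤ 6. Cubes form a
-- potential: b ≤ a/2 gives 2 a³ + 3 b³ ≤ 3 a³.
searchSum-crude : ∀ f a h → ⌊ a /2⌋ ≤ h → h ≤ a → searchSum f a h ≤ 3 * (a * a * a + h * h * h)
searchSum-crude zero    a h _   _ = ≤-trans (≤-reflexive (trans (∑-cong a λ m _ → *-zeroʳ m)
  (trans (∑-const a 0) (*-zeroʳ a)))) z≤n
searchSum-crude (suc f) a h a/2≤h h≤a with split-≤ h≤a
... | w , refl = begin
  searchSum (suc f) a h
    ≡⟨ searchSum-step f h w ⟩
  tri a + (searchSum f h b + blk h w)
    ≤⟨ +-mono-≤ (≤-trans (tri≤ a) (n*n≤n*n*n a))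
         (+-mono-≤ (searchSum-crude f h b (⌊n/2⌋-mono h≤a) a/2≤h)
           (≤-trans (blk≤ h w) (≤-trans (*-monoʳ-≤ a (*-monoˡ-≤ a (m≤n+m w h))) (≤-reflexive (sym (*-assoc a a a)))))) ⟩
  a * a * a + (3 * (h * h * h + b * b * b) + a * a * a)
    ≤⟨ *-cancelˡ-≤ 8 (linear _ _ (5 * (a * a * a)) (*-monoʳ-≤ 3 (*-mono-≤ (*-mono-≤ 2b≤a 2b≤a) 2b≤a)) (balance a h b)) ⟩
  3 * (a * a * a + h * h * h) ∎
  where
  open ≤-Reasoning
  b : ℕ
  b = ⌊ a /2⌋
  2b≤a : 2 * b ≤ a
  2b≤a = 2*⌊n/2⌋≤n a
  balance : ∀ a h b → 8 * (3 * (a * a * a + h * h * h)) + 3 * ((2 * b) * (2 * b) * (2 * b)) ≡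
    8 * (a * a * a + (3 * (h * h * h + b * b * b) + a * a * a)) + 3 * (a * a * a) + 5 * (a * a * a)
  balance = solve-∀

-- The square of c = t - s without subtraction, so that the block ends c₁ and c₂ can be expanded in
-- a semiring.
tri-square : ∀ {c s t} → c + s ≡ t → 2 * tri c + c + 2 * t * s ≡ t * t + s * s
tri-square {c} {s} refl = trans (cong (_+ 2 * (c + s) * s) (2*tri c)) (expand c s)
  where
  expand : ∀ c s → c * c + 2 * (c + s) * s ≡ (c + s) * (c + s) + s * s
  expand = solve-∀

⌊m+2*n/2⌋ : ∀ m n → ⌊ m + 2 * n /2⌋ ≡ ⌊ m /2⌋ + n
⌊m+2*n/2⌋ m zero    = trans (cong ⌊_/2⌋ (+-identityʳ m)) (sym (+-identityʳ _))
⌊m+2*n/2⌋ m (suc n) = trans (cong ⌊_/2⌋ (shift m n)) (trans (cong suc (⌊m+2*n/2⌋ m n)) (sym (+-suc _ n)))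
  where
  shift : ∀ m n → m + 2 * suc n ≡ suc (suc (m + 2 * n))
  shift = solve-∀

halve-≤ : ∀ h q {a} → a ≤ h + 2 * q → ⌊ a /2⌋ ≤ ⌊ h /2⌋ + q
halve-≤ h q le = ≤-trans (⌊n/2⌋-mono le) (≤-reflexive (⌊m+2*n/2⌋ h q))

halve-≥ : ∀ h q {a} → h + 2 * q ≤ a → ⌊ h /2⌋ + q ≤ ⌊ a /2⌋
halve-≥ h q le = ≤-trans (≤-reflexive (sym (⌊m+2*n/2⌋ h q))) (⌊n/2⌋-mono le)

halves : ∀ n → ∃[ ε ] ε ≤ 1 × n ≡ ε + 2 * ⌊ n /2⌋
halves zero          = 0 , z≤n , refl
halves (suc zero)    = 1 , ≤-refl , refl
halves (suc (suc n)) with halves n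
... | ε , ε≤1 , eq = ε , ε≤1 , trans (cong (2 +_) eq) (shift ε ⌊ n /2⌋)
  where
  shift : ∀ ε m → suc (suc (ε + 2 * m)) ≡ ε + 2 * suc m
  shift = solve-∀

level : ∀ k {a h c} → a ≤ h + 2 ^ k → 2 * h + 2 ^ k ≤ 2 * a → c + (2 ^ k + h) ≡ 2 * a →
        blk h (a ∸ h) + tri a + k * tri h ≤ k * tri a + tri c
level k {a} {h} {c} u l e with split-≤ {h} {a} (*-cancelˡ-≤ 2 (≤-trans (m≤m+n _ _) l))
... | w , refl = subst (λ x → blk h x + tri (h + w) + k * tri h ≤ k * tri (h + w) + tri c) (sym (m+n∸m≡n h w))
  (blk-tri k h w c (+-cancelˡ-≤ h _ _ u) (linear _ _ 0 l (balance h w (2 ^ k)))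
    (+-cancelʳ-≡ h _ _ (trans (+-assoc c _ h) (trans e (regroup h w)))))
  where
  balance : ∀ h w p → 2 * w + (2 * h + p) ≡ p + 2 * (h + w) + 0
  balance = solve-∀
  regroup : ∀ h w → 2 * (h + w) ≡ h + 2 * w + h
  regroup = solve-∀

searchSum-unfold : ∀ f {a h} → h ≤ a → searchSum (suc f) a h ≡ tri a + (searchSum f h ⌊ a /2⌋ + blk h (a ∸ h))
searchSum-unfold f {a} {h} h≤a with split-≤ h≤a
... | w , refl = trans (searchSum-step f h w)
  (cong (λ x → tri (h + w) + (searchSum f h ⌊ (h + w) /2⌋ + blk h x)) (sym (m+n∸m≡n h w)))

-- Two tests lead from (a , h) to (⌊ a /2⌋ , ⌊ h /2⌋), the same situation at half the size. As the
-- sum grows with the fuel, charging 2 + f on the left keeps f fixed, and the later induction can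
-- run on the exponent of the widths.
search-two-levels : ∀ f j k {a h c₁ c₂} →
  a ≤ h + 2 ^ j → 2 * h + 2 ^ j ≤ 2 * a → h ≤ ⌊ a /2⌋ + 2 ^ k → 2 * ⌊ a /2⌋ + 2 ^ k ≤ 2 * h →
  c₁ + (2 ^ j + h) ≡ 2 * a → c₂ + (2 ^ k + ⌊ a /2⌋) ≡ 2 * h →
  searchSum f a h + j * tri h + k * tri ⌊ a /2⌋ ≤
  j * tri a + tri c₁ + k * tri h + tri c₂ + searchSum f ⌊ a /2⌋ ⌊ h /2⌋
search-two-levels f j k {a} {h} {c₁} {c₂} u₁ l₁ u₂ l₂ e₁ e₂ = begin
  searchSum f a h + j * tri h + k * tri b
    ≤⟨ +-monoˡ-≤ _ (+-monoˡ-≤ _ (≤-trans (searchSum-mono f a h) (searchSum-mono (suc f) a h))) ⟩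
  searchSum (2 + f) a h + j * tri h + k * tri b
    ≡⟨ cong (λ x → x + j * tri h + k * tri b) (trans (searchSum-unfold (suc f) h≤a)
         (cong (λ x → tri a + (x + blk h (a ∸ h))) (searchSum-unfold f b≤h))) ⟩
  tri a + (tri h + (searchSum f b ⌊ h /2⌋ + blk b (h ∸ b)) + blk h (a ∸ h)) + j * tri h + k * tri b
    ≡⟨ regroup (tri a) (tri h) (searchSum f b ⌊ h /2⌋) (blk b (h ∸ b)) (blk h (a ∸ h)) (j * tri h) (k * tri b) ⟩
  (blk h (a ∸ h) + tri a + j * tri h) + (blk b (h ∸ b) + tri h + k * tri b) + searchSum f b ⌊ h /2⌋
    ≤⟨ +-monoˡ-≤ _ (+-mono-≤ (level j {c = c₁} u₁ l₁ e₁) (level k {c = c₂} u₂ l₂ e₂)) ⟩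
  j * tri a + tri c₁ + (k * tri h + tri c₂) + searchSum f b ⌊ h /2⌋
    ≡⟨ cong (_+ searchSum f b ⌊ h /2⌋) (+-assoc (j * tri a + tri c₁) _ _) ⟨
  j * tri a + tri c₁ + k * tri h + tri c₂ + searchSum f b ⌊ h /2⌋ ∎
  where
  open ≤-Reasoning
  b : ℕ
  b = ⌊ a /2⌋
  h≤a : h ≤ a
  h≤a = *-cancelˡ-≤ 2 (≤-trans (m≤m+n _ _) l₁)
  b≤h : b ≤ h
  b≤h = *-cancelˡ-≤ 2 (≤-trans (m≤m+n _ _) l₂)
  regroup : ∀ ta th z y x jt kt → ta + (th + (z + y) + x) + jt + kt ≡ (x + ta + jt) + (y + th + kt) + z
  regroup = solve-∀

m*ε≤m : ∀ m {ε} → ε ≤ 1 → m * ε ≤ m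
m*ε≤m m ε≤1 = ≤-trans (*-monoʳ-≤ m ε≤1) (≤-reflexive (*-identityʳ m))

-- 1296 = 3 (6³ + 6³).
searchSum-small : ∀ f a h → h ≤ a → ⌊ a /2⌋ ≤ h → a ≤ 6 → searchSum f a h ≤ 1296
searchSum-small f a h h≤a b≤h a≤6 = ≤-trans (searchSum-crude f a h b≤h h≤a)
  (*-monoʳ-≤ 3 (+-mono-≤ (*-mono-≤ (*-mono-≤ a≤6 a≤6) a≤6) (*-mono-≤ (*-mono-≤ h≤6 h≤6) h≤6)))
  where
  h≤6 : h ≤ 6
  h≤6 = ≤-trans h≤a a≤6

-- The search cost and ψ⁻ where the halving of i ends, at a, h ≤ 6 and q ≤ 1.
opaque
  base-cost : ℕ
  base-cost = 24 * 1296 + (96 * (6 * 6) + 112 * (6 * 1))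

  base-cost-≥ : 24 * 1296 + (96 * (6 * 6) + 112 * (6 * 1)) ≤ base-cost
  base-cost-≥ = ≤-refl

-- ψ⁺ - ψ⁻ bounds 24 times the search cost beyond k tri a.  One halving of
-- (a , h , q) divides its quadratic part by 4, and the linear term 288 a
-- absorbs the rounding.
module Equal where
  ψ⁺ ψ⁻ : ℕ → ℕ → ℕ → ℕ
  ψ⁺ a h q = 68 * (a * a) + 64 * (h * h) + 80 * (q * q) + 288 * a
  ψ⁻ a h q = 96 * (a * h) + 112 * (a * q)

  -- The quadratic parts agree exactly. For the third argument p = 2 q, those of ψ⁺ - ψ⁻ are 4/3 = 1
  -- + 1/4 + 1/16 + ... times 12 ((2 a - h - 2 p)² + (2 h - a/2 - p)² - h²), the contribution of two
  -- levels. What remains is of first order and comes from ε, η and from tri c being less than c²/2.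
  halving : ∀ b g q ε η {c₁ c₂} → ε ≤ 1 → η ≤ 1 → let a = ε + 2 * b ; h = η + 2 * g in
    h + 2 * q ≤ a → c₁ + (2 * (2 * q) + h) ≡ 2 * a → c₂ + (2 * q + b) ≡ 2 * h →
    24 * tri c₁ + 24 * tri c₂ + ψ⁺ b g q + ψ⁻ a h (2 * q) ≤ 24 * tri h + ψ⁻ b g q + ψ⁺ a h (2 * q)
  halving b g q ε η {c₁} {c₂} ε≤1 η≤1 q≤a e₁ e₂ =
    linear _ _ (112 * b + 80 * (b * ε) + 12 * c₁ + 12 * c₂ + 8 * g + 64 * (g * η) + 96 * q
                + 176 * ε + 20 * (ε * ε) + 52 * η + 16 * (η * η))
      (+-mono-≤ (≤-reflexive (cong₂ _+_ (cong (12 *_) (tri-square {c₁} e₁)) (cong (12 *_) (tri-square {c₂} e₂))))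
        (+-mono-≤ (≤-reflexive (cong (12 *_) (sym (2*tri (η + 2 * g)))))
          (+-mono-≤ (*-monoʳ-≤ 64 q≤a)
            (+-mono-≤ (+-mono-≤ (*-monoʳ-≤ 48 (m*ε≤m b η≤1)) (*-monoʳ-≤ 96 (m*ε≤m g ε≤1)))
              (+-mono-≤ (*-monoʳ-≤ 32 (m*ε≤m q ε≤1)) (*-monoʳ-≤ 48 (m*ε≤m ε η≤1)))))))
      (balance b g q ε η c₁ c₂ (tri c₁) (tri c₂) (tri (η + 2 * g)))
    where
    balance : ∀ b g q ε η c₁ c₂ t₁ t₂ th →
      24 * th + (96 * (b * g) + 112 * (b * q))
      + (68 * ((ε + 2 * b) * (ε + 2 * b)) + 64 * ((η + 2 * g) * (η + 2 * g)) + 80 * ((2 * q) * (2 * q)) + 288 * (ε + 2 * b))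
      + (12 * (2 * t₁ + c₁ + 2 * (2 * (ε + 2 * b)) * (2 * (2 * q) + (η + 2 * g)))
         + 12 * (2 * t₂ + c₂ + 2 * (2 * (η + 2 * g)) * (2 * q + b))
      + (12 * ((η + 2 * g) * (η + 2 * g))
      + (64 * (η + 2 * g + 2 * q)
      + (48 * (b * η) + 96 * (g * ε) + (32 * (q * ε) + 48 * (ε * η))))))
      ≡ 24 * t₁ + 24 * t₂ + (68 * (b * b) + 64 * (g * g) + 80 * (q * q) + 288 * b)
      + (96 * ((ε + 2 * b) * (η + 2 * g)) + 112 * ((ε + 2 * b) * (2 * q)))
      + (12 * ((2 * (ε + 2 * b)) * (2 * (ε + 2 * b)) + (2 * (2 * q) + (η + 2 * g)) * (2 * (2 * q) + (η + 2 * g)))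
         + 12 * ((2 * (η + 2 * g)) * (2 * (η + 2 * g)) + (2 * q + b) * (2 * q + b))
      + (12 * (2 * th + (η + 2 * g))
      + (64 * (ε + 2 * b)
      + (48 * b + 96 * g + (32 * q + 48 * ε)))))
      + (112 * b + 80 * (b * ε) + 12 * c₁ + 12 * c₂ + 8 * g + 64 * (g * η) + 96 * q
                + 176 * ε + 20 * (ε * ε) + 52 * η + 16 * (η * η))
    balance = solve-∀

  -- Each width is at least half its upper bound. At exponent 0 only the order is kept, because the
  -- crude bound takes over there.
  Lower : ℕ → ℕ → ℕ → Set
  Lower zero    a h = h ≤ a × ⌊ a /2⌋ ≤ h
  Lower (suc k) a h = h + 2 ^ suc k ≤ a × ⌊ a /2⌋ + 2 ^ k ≤ h

  halve-Lower : ∀ k {a h} → Lower (suc k) a h → Lower k ⌊ a /2⌋ ⌊ h /2⌋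
  halve-Lower zero    (l₁ , l₂) = ⌊n/2⌋-mono (m+n≤o⇒m≤o _ l₁) , ⌊n/2⌋-mono (m+n≤o⇒m≤o _ l₂)
  halve-Lower (suc k) {a} {h} (l₁ , l₂) = halve-≥ h (2 ^ suc k) l₁ , halve-≥ ⌊ a /2⌋ (2 ^ k) l₂

  searchSum-bound : ∀ f k a h → a ≤ h + 2 ^ suc k → h ≤ ⌊ a /2⌋ + 2 ^ k → Lower k a h →
    24 * searchSum f a h + ψ⁻ a h (2 ^ k) ≤ 24 * (suc k * tri a) + ψ⁺ a h (2 ^ k) + base-cost
  searchSum-bound f zero a h u₁ u₂ (h≤a , b≤h) = ≤-trans
    (+-mono-≤ (*-monoʳ-≤ 24 (searchSum-small f a h h≤a b≤h a≤6))
      (+-mono-≤ (*-monoʳ-≤ 96 (*-mono-≤ a≤6 (≤-trans h≤a a≤6))) (*-monoʳ-≤ 112 (*-monoˡ-≤ 1 a≤6))))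
    (≤-trans base-cost-≥ (m≤n+m base-cost _))
    where
    a≤6 : a ≤ 6
    a≤6 = linear _ _ 0 (+-mono-≤ (+-mono-≤ (*-monoʳ-≤ 2 u₁) (*-monoʳ-≤ 2 u₂)) (2*⌊n/2⌋≤n a)) (balance a h ⌊ a /2⌋)
      where
      balance : ∀ a h b → 6 + (2 * a + 2 * h + 2 * b) ≡ a + (2 * (h + 2) + 2 * (b + 1) + a) + 0
      balance = solve-∀
  searchSum-bound f (suc k) a h u₁ u₂ l@(l₁ , l₂)
    with split-≤ {2 ^ suc (suc k) + h} {2 * a} (linear _ _ h (*-monoʳ-≤ 2 l₁) (room a h (2 ^ suc k)))
       | split-≤ {2 ^ suc k + ⌊ a /2⌋} {2 * h} (linear _ _ ⌊ a /2⌋ (*-monoʳ-≤ 2 l₂) (room h ⌊ a /2⌋ (2 ^ k)))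
       | halves a | halves h
    where
    room : ∀ a h q → 2 * a + 2 * (h + q) ≡ 2 * q + h + 2 * a + h
    room = solve-∀
  ... | c₁ , e₁ | c₂ , e₂ | ε , ε≤1 , a≡ | η , η≤1 , h≡ =
    combine (searchSum f a h) (searchSum f ⌊ a /2⌋ ⌊ h /2⌋) (suc k) (tri a) (tri h) (tri ⌊ a /2⌋) (tri c₁) (tri c₂)
      (search-two-levels f (suc (suc k)) (suc k) {c₁ = c₁} {c₂} u₁
        (linear _ _ 0 (*-monoʳ-≤ 2 l₁) (double a h (2 ^ suc k))) u₂
        (linear _ _ 0 (*-monoʳ-≤ 2 l₂) (double h ⌊ a /2⌋ (2 ^ k))) e₁′ e₂′)
      (searchSum-bound f k ⌊ a /2⌋ ⌊ h /2⌋ (halve-≤ h (2 ^ suc k) u₁) (halve-≤ ⌊ a /2⌋ (2 ^ k) u₂) (halve-Lower k l))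
      (subst₂ (λ x y → 24 * tri c₁ + 24 * tri c₂ + ψ⁺ ⌊ a /2⌋ ⌊ h /2⌋ (2 ^ k) + ψ⁻ x y (2 ^ suc k) ≤
                       24 * tri y + ψ⁻ ⌊ a /2⌋ ⌊ h /2⌋ (2 ^ k) + ψ⁺ x y (2 ^ suc k)) (sym a≡) (sym h≡)
        (halving ⌊ a /2⌋ ⌊ h /2⌋ (2 ^ k) ε η {c₁} {c₂} ε≤1 η≤1
          (subst₂ (λ x y → y + 2 ^ suc k ≤ x) a≡ h≡ l₁)
          (subst₂ (λ x y → c₁ + (2 ^ suc (suc k) + y) ≡ 2 * x) a≡ h≡ e₁′)
          (subst (λ y → c₂ + (2 ^ suc k + ⌊ a /2⌋) ≡ 2 * y) h≡ e₂′)))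
    where
    double : ∀ a h q → 2 * a + 2 * (h + q) ≡ 2 * h + 2 * q + 2 * a + 0
    double = solve-∀
    e₁′ : c₁ + (2 ^ suc (suc k) + h) ≡ 2 * a
    e₁′ = trans (+-comm c₁ _) e₁
    e₂′ : c₂ + (2 ^ suc k + ⌊ a /2⌋) ≡ 2 * h
    e₂′ = trans (+-comm c₂ _) e₂
    combine : ∀ S S′ k ta th tb t₁ t₂ {m m′ p p′} →
      S + suc k * th + k * tb ≤ suc k * ta + t₁ + k * th + t₂ + S′ →
      24 * S′ + m′ ≤ 24 * (k * tb) + p′ + base-cost →
      24 * t₁ + 24 * t₂ + p′ + m ≤ 24 * th + m′ + p →
      24 * S + m ≤ 24 * (suc k * ta) + p + base-cost
    combine S S′ k ta th tb t₁ t₂ {m} {m′} {p} {p′} x y z =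
      linear _ _ 0 (+-mono-≤ (*-monoʳ-≤ 24 x) (+-mono-≤ y z)) (balance S S′ k ta th tb t₁ t₂ m m′ p p′ base-cost)
      where
      balance : ∀ S S′ k ta th tb t₁ t₂ m m′ p p′ c → 24 * (suc k * ta) + p + c +
        (24 * (S + suc k * th + k * tb) + (24 * S′ + m′ + (24 * t₁ + 24 * t₂ + p′ + m))) ≡
        24 * S + m + (24 * (suc k * ta + t₁ + k * th + t₂ + S′) + (24 * (k * tb) + p′ + c + (24 * th + m′ + p))) + 0
      balance = solve-∀

-- The names compare the worst costs of two consecutive blocks, tests plus search. At exponent k + 1
-- these are 1 + (k + 2) and 2 + (k + 1) in `Equal`, but 1 + (k + 1) and 2 + (k + 1) here, where
-- both widths lie between 2^k and 2^(k+1). The coefficients of ψ are again 4/3 times those of two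
-- levels, now 12 ((2 a - h - q)² + (2 h - a/2 - q)² - (a/2)²).
module Less where
  ψ⁺ ψ⁻ : ℕ → ℕ → ℕ → ℕ
  ψ⁺ a h q = 64 * (a * a) + 80 * (h * h) + 32 * (q * q) + 288 * a
  ψ⁻ a h q = 96 * (a * h) + 48 * (a * q) + 32 * (h * q)

  halving : ∀ b g q ε η {c₁ c₂} → ε ≤ 1 → η ≤ 1 → let a = ε + 2 * b ; h = η + 2 * g in
    h + q ≤ a → c₁ + (2 * q + h) ≡ 2 * a → c₂ + (2 * q + b) ≡ 2 * h →
    24 * tri c₁ + 24 * tri c₂ + ψ⁺ b g q + ψ⁻ a h (2 * q) ≤ 24 * tri b + ψ⁻ b g q + ψ⁺ a h (2 * q)
  halving b g q ε η {c₁} {c₂} ε≤1 η≤1 q≤a e₁ e₂ =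
    linear _ _ (100 * b + 64 * (b * ε) + 12 * c₁ + 12 * c₂ + 32 * g + 80 * (g * η) + 48 * q
                + 176 * ε + 16 * (ε * ε) + 64 * η + 20 * (η * η))
      (+-mono-≤ (≤-reflexive (cong₂ _+_ (cong (12 *_) (tri-square {c₁} e₁)) (cong (12 *_) (tri-square {c₂} e₂))))
        (+-mono-≤ (≤-reflexive (cong (12 *_) (sym (2*tri b))))
          (+-mono-≤ (*-monoʳ-≤ 64 q≤a)
            (+-mono-≤ (+-mono-≤ (*-monoʳ-≤ 48 (m*ε≤m b η≤1)) (*-monoʳ-≤ 96 (m*ε≤m g ε≤1)))
              (+-mono-≤ (*-monoʳ-≤ 16 (m*ε≤m q η≤1)) (*-monoʳ-≤ 48 (m*ε≤m ε η≤1)))))))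
      (balance b g q ε η c₁ c₂ (tri c₁) (tri c₂) (tri b))
    where
    balance : ∀ b g q ε η c₁ c₂ t₁ t₂ tb →
      24 * tb + (96 * (b * g) + 48 * (b * q) + 32 * (g * q))
      + (64 * ((ε + 2 * b) * (ε + 2 * b)) + 80 * ((η + 2 * g) * (η + 2 * g)) + 32 * ((2 * q) * (2 * q)) + 288 * (ε + 2 * b))
      + (12 * (2 * t₁ + c₁ + 2 * (2 * (ε + 2 * b)) * (2 * q + (η + 2 * g)))
         + 12 * (2 * t₂ + c₂ + 2 * (2 * (η + 2 * g)) * (2 * q + b))
      + (12 * (b * b)
      + (64 * (η + 2 * g + q)
      + (48 * (b * η) + 96 * (g * ε) + (16 * (q * η) + 48 * (ε * η))))))
      ≡ 24 * t₁ + 24 * t₂ + (64 * (b * b) + 80 * (g * g) + 32 * (q * q) + 288 * b)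
      + (96 * ((ε + 2 * b) * (η + 2 * g)) + 48 * ((ε + 2 * b) * (2 * q)) + 32 * ((η + 2 * g) * (2 * q)))
      + (12 * ((2 * (ε + 2 * b)) * (2 * (ε + 2 * b)) + (2 * q + (η + 2 * g)) * (2 * q + (η + 2 * g)))
         + 12 * ((2 * (η + 2 * g)) * (2 * (η + 2 * g)) + (2 * q + b) * (2 * q + b))
      + (12 * (2 * tb + b)
      + (64 * (ε + 2 * b)
      + (48 * b + 96 * g + (16 * q + 48 * ε)))))
      + (100 * b + 64 * (b * ε) + 12 * c₁ + 12 * c₂ + 32 * g + 80 * (g * η) + 48 * q
                + 176 * ε + 16 * (ε * ε) + 64 * η + 20 * (η * η))
    balance = solve-∀

  Lower : ℕ → ℕ → ℕ → Set
  Lower zero    a h = h ≤ a × ⌊ a /2⌋ ≤ h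
  Lower (suc k) a h = h + 2 ^ k ≤ a × ⌊ a /2⌋ + 2 ^ k ≤ h

  halve-Lower : ∀ k {a h} → Lower (suc k) a h → Lower k ⌊ a /2⌋ ⌊ h /2⌋
  halve-Lower zero    (l₁ , l₂) = ⌊n/2⌋-mono (m+n≤o⇒m≤o _ l₁) , ⌊n/2⌋-mono (m+n≤o⇒m≤o _ l₂)
  halve-Lower (suc k) {a} {h} (l₁ , l₂) = halve-≥ h (2 ^ k) l₁ , halve-≥ ⌊ a /2⌋ (2 ^ k) l₂

  searchSum-bound : ∀ f k a h → a ≤ h + 2 ^ k → h ≤ ⌊ a /2⌋ + 2 ^ k → Lower k a h →
    24 * searchSum f a h + ψ⁻ a h (2 ^ k) ≤ 24 * (k * tri a) + ψ⁺ a h (2 ^ k) + base-cost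
  searchSum-bound f zero a h u₁ u₂ (h≤a , b≤h) = ≤-trans
    (+-mono-≤ (*-monoʳ-≤ 24 (searchSum-small f a h h≤a b≤h a≤6))
      (≤-trans (+-mono-≤ (+-mono-≤ (*-monoʳ-≤ 96 (*-mono-≤ a≤6 (≤-trans h≤a a≤6))) (*-monoʳ-≤ 48 (*-monoˡ-≤ 1 a≤6)))
                 (*-monoʳ-≤ 32 (*-monoˡ-≤ 1 (≤-trans h≤a a≤6))))
        (≤ᵇ⇒≤ (96 * 36 + 48 * 6 + 32 * 6) (96 * 36 + 112 * 6) tt)))
    (≤-trans base-cost-≥ (m≤n+m base-cost _))
    where
    a≤6 : a ≤ 6
    a≤6 = linear _ _ 2 (+-mono-≤ (+-mono-≤ (*-monoʳ-≤ 2 u₁) (*-monoʳ-≤ 2 u₂)) (2*⌊n/2⌋≤n a)) (balance a h ⌊ a /2⌋)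
      where
      balance : ∀ a h b → 6 + (2 * a + 2 * h + 2 * b) ≡ a + (2 * (h + 1) + 2 * (b + 1) + a) + 2
      balance = solve-∀
  searchSum-bound f (suc k) a h u₁ u₂ l@(l₁ , l₂)
    with split-≤ {2 ^ suc k + h} {2 * a} (linear _ _ h (*-monoʳ-≤ 2 l₁) (room a h (2 ^ k)))
       | split-≤ {2 ^ suc k + ⌊ a /2⌋} {2 * h} (linear _ _ ⌊ a /2⌋ (*-monoʳ-≤ 2 l₂) (room h ⌊ a /2⌋ (2 ^ k)))
       | halves a | halves h
    where
    room : ∀ a h q → 2 * a + 2 * (h + q) ≡ 2 * q + h + 2 * a + h
    room = solve-∀
  ... | c₁ , e₁ | c₂ , e₂ | ε , ε≤1 , a≡ | η , η≤1 , h≡ =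
    combine (searchSum f a h) (searchSum f ⌊ a /2⌋ ⌊ h /2⌋) k (tri a) (tri h) (tri ⌊ a /2⌋) (tri c₁) (tri c₂)
      (search-two-levels f (suc k) (suc k) {c₁ = c₁} {c₂} u₁
        (linear _ _ 0 (*-monoʳ-≤ 2 l₁) (double a h (2 ^ k))) u₂
        (linear _ _ 0 (*-monoʳ-≤ 2 l₂) (double h ⌊ a /2⌋ (2 ^ k))) e₁′ e₂′)
      (searchSum-bound f k ⌊ a /2⌋ ⌊ h /2⌋ (halve-≤ h (2 ^ k) u₁) (halve-≤ ⌊ a /2⌋ (2 ^ k) u₂) (halve-Lower k l))
      (subst₂ (λ x y → 24 * tri c₁ + 24 * tri c₂ + ψ⁺ ⌊ a /2⌋ ⌊ h /2⌋ (2 ^ k) + ψ⁻ x y (2 ^ suc k) ≤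
                       24 * tri ⌊ a /2⌋ + ψ⁻ ⌊ a /2⌋ ⌊ h /2⌋ (2 ^ k) + ψ⁺ x y (2 ^ suc k)) (sym a≡) (sym h≡)
        (halving ⌊ a /2⌋ ⌊ h /2⌋ (2 ^ k) ε η {c₁} {c₂} ε≤1 η≤1
          (subst₂ (λ x y → y + 2 ^ k ≤ x) a≡ h≡ l₁)
          (subst₂ (λ x y → c₁ + (2 ^ suc k + y) ≡ 2 * x) a≡ h≡ e₁′)
          (subst (λ y → c₂ + (2 ^ suc k + ⌊ a /2⌋) ≡ 2 * y) h≡ e₂′)))
    where
    double : ∀ a h q → 2 * a + 2 * (h + q) ≡ 2 * h + 2 * q + 2 * a + 0
    double = solve-∀
    e₁′ : c₁ + (2 ^ suc k + h) ≡ 2 * a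
    e₁′ = trans (+-comm c₁ _) e₁
    e₂′ : c₂ + (2 ^ suc k + ⌊ a /2⌋) ≡ 2 * h
    e₂′ = trans (+-comm c₂ _) e₂
    combine : ∀ S S′ k ta th tb t₁ t₂ {m m′ p p′} →
      S + suc k * th + suc k * tb ≤ suc k * ta + t₁ + suc k * th + t₂ + S′ →
      24 * S′ + m′ ≤ 24 * (k * tb) + p′ + base-cost →
      24 * t₁ + 24 * t₂ + p′ + m ≤ 24 * tb + m′ + p →
      24 * S + m ≤ 24 * (suc k * ta) + p + base-cost
    combine S S′ k ta th tb t₁ t₂ {m} {m′} {p} {p′} x y z =
      linear _ _ 0 (+-mono-≤ (*-monoʳ-≤ 24 x) (+-mono-≤ y z)) (balance S S′ k ta th tb t₁ t₂ m m′ p p′ base-cost)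
      where
      balance : ∀ S S′ k ta th tb t₁ t₂ m m′ p p′ c → 24 * (suc k * ta) + p + c +
        (24 * (S + suc k * th + suc k * tb) + (24 * S′ + m′ + (24 * t₁ + 24 * t₂ + p′ + m))) ≡
        24 * S + m + (24 * (suc k * ta + t₁ + suc k * th + t₂ + S′) + (24 * (k * tb) + p′ + c + (24 * tb + m′ + p))) + 0
      balance = solve-∀

-- Thresholds of Step 2

-- `search` is local to ⌊_/√2^_⌋ and occurs there only with the first and the
-- last argument equal.  Abstracting over `suc x` separates them, so that
-- unification finds the function.
mutual
  largestRoot : (i r q : ℕ) → ℕ
  largestRoot = _

  largestRoot-solution : ∀ x r → (suc x ^ 2 * 2 ^ r ≤ᵇ suc x ^ 2) ≡ false →
                         ⌊ suc x /√2^ r ⌋ ≡ largestRoot (suc x) r x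
  largestRoot-solution x r with suc x ^ 2 * 2 ^ r ≤ᵇ suc x ^ 2 | suc x
  ... | false | y = λ _ → refl
  ... | true  | y = λ ()

largestRoot-lower : ∀ i r q → largestRoot i r q ^ 2 * 2 ^ r ≤ i ^ 2
largestRoot-lower i r zero = z≤n
largestRoot-lower i r (suc q) with suc q ^ 2 * 2 ^ r ≤ᵇ i ^ 2 in test
... | true  = ≤ᵇ⇒≤ _ _ (subst T (sym test) tt)
... | false = largestRoot-lower i r q

largestRoot-greatest : ∀ i r q {x} → x ≤ q → x ^ 2 * 2 ^ r ≤ i ^ 2 → x ≤ largestRoot i r q
largestRoot-greatest i r zero    x≤q le = x≤q
largestRoot-greatest i r (suc q) {x} x≤q le with suc q ^ 2 * 2 ^ r ≤ᵇ i ^ 2 in test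
... | true  = x≤q
... | false with m≤n⇒m<n∨m≡n x≤q
...   | inj₁ (s≤s x≤q′) = largestRoot-greatest i r q x≤q′ le
...   | inj₂ refl       = contradiction (≤⇒≤ᵇ le) (subst T test)

root-lower : ∀ i r → ⌊ i /√2^ r ⌋ ^ 2 * 2 ^ r ≤ i ^ 2
root-lower i r = largestRoot-lower i r i

root-greatest : ∀ i r {x} → x ^ 2 * 2 ^ r ≤ i ^ 2 → x ≤ ⌊ i /√2^ r ⌋
root-greatest i r {x} le = largestRoot-greatest i r i
  (^-cancelˡ-≤ (≤-trans (m≤m*n (x ^ 2) (2 ^ r) {{m^n≢0 2 r}}) le)) le
  where
  ^-cancelˡ-≤ : x ^ 2 ≤ i ^ 2 → x ≤ i
  ^-cancelˡ-≤ sq = ≮⇒≥ λ i<x → <⇒≱ (^-monoˡ-< 2 i<x) sq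

root-zero : ∀ i → ⌊ i /√2^ 0 ⌋ ≡ i
root-zero i = ≤-antisym (≮⇒≥ λ i<q → <⇒≱ (^-monoˡ-< 2 i<q)
    (≤-trans (≤-reflexive (sym (*-identityʳ _))) (root-lower i 0)))
  (root-greatest i 0 (≤-reflexive (*-identityʳ (i ^ 2))))

root-halve : ∀ i r → ⌊ i /√2^ suc (suc r) ⌋ ≡ ⌊ ⌊ i /√2^ r ⌋ /2⌋
root-halve i r = ≤-antisym
  (≤-trans (≤-reflexive (half-double q)) (⌊n/2⌋-mono (root-greatest i r (≤-trans (≤-reflexive (sym (shift q (2 ^ r)))) (root-lower i (suc (suc r)))))))
  (root-greatest i (suc (suc r)) (≤-trans (≤-reflexive (shift ⌊ a /2⌋ (2 ^ r)))
    (≤-trans (*-monoˡ-≤ (2 ^ r) (^-monoˡ-≤ 2 (2*⌊n/2⌋≤n a))) (root-lower i r))))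
  where
  q a : ℕ
  q = ⌊ i /√2^ suc (suc r) ⌋
  a = ⌊ i /√2^ r ⌋
  shift : ∀ x p → x * (x * 1) * (2 * (2 * p)) ≡ 2 * x * (2 * x * 1) * p
  shift = solve-∀
  half-double : ∀ n → n ≡ ⌊ 2 * n /2⌋
  half-double n = sym (⌊m+2*n/2⌋ 0 n)

root-antitone : ∀ i r → ⌊ i /√2^ suc r ⌋ ≤ ⌊ i /√2^ r ⌋
root-antitone i r = root-greatest i r (≤-trans (*-monoʳ-≤ (⌊ i /√2^ suc r ⌋ ^ 2) (^-monoʳ-≤ 2 (n≤1+n r))) (root-lower i (suc r)))

root-< : ∀ i r → 1 ≤ i → ⌊ i /√2^ suc r ⌋ < i
root-< i r i≥1 = ≰⇒> λ i≤q → <⇒≱ (m<m*n (i ^ 2) (2 ^ suc r) {{>-nonZero (m^n>0 i {{>-nonZero i≥1}} 2)}}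
    (*-monoʳ-≤ 2 (m^n>0 2 r)))
  (≤-trans (*-monoˡ-≤ (2 ^ suc r) (^-monoˡ-≤ 2 i≤q)) (root-lower i (suc r)))

-- Otherwise 4 · 2^L ≤ i² < 2^(L+1). Since every A has m ≥ 1, `firstAbove` stops before its steps
-- run out.
root-last : ∀ i → 1 ≤ i → ⌊ i /√2^ ⌊log₂ i ^ 2 ⌋ ⌋ ≤ 1
root-last i i≥1 = ≮⇒≥ λ q≥2 → <⇒≱ (upper (m^n>0 i {{>-nonZero i≥1}} 2))
  (≤-trans (≤-trans (≤-trans (m≤m+n _ (2 * 2 ^ L)) (≤-reflexive (double (2 ^ L)))) (*-monoˡ-≤ (2 ^ L) (^-monoˡ-≤ 2 q≥2)))
    (root-lower i L))
  where
  L : ℕ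
  L = ⌊log₂ i ^ 2 ⌋
  double : ∀ x → 2 * x + 2 * x ≡ 4 * x
  double = solve-∀
  upper : ∀ {n} → 1 ≤ n → n < 2 ^ suc ⌊log₂ n ⌋
  upper {suc n} _ with dyadic n
  ... | k , lo , hi = subst (λ x → suc n < 2 ^ suc x) (sym (⌊log₂⌋-unique k lo hi)) hi

head-drop-nothing : ∀ m (T : List ℕ) → head (drop m T) ≡ nothing → length T ≤ m
head-drop-nothing zero    []      eq = z≤n
head-drop-nothing (suc m) []      eq = z≤n
head-drop-nothing (suc m) (_ ∷ T) eq = s≤s (head-drop-nothing m T eq)

head-drop-just : ∀ m (T : List ℕ) {t} → head (drop m T) ≡ just t → ∃[ R ] drop m T ≡ t ∷ R
head-drop-just zero    (_ ∷ T) refl = T , refl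
head-drop-just (suc m) (_ ∷ T) eq   = head-drop-just m T eq

-- m is the number of slots at or to the right of the slot ℓ of A, without the
-- last one.
module FirstAbove {A ℓ m : ℕ} (T : List ℕ) (σ : Slot A ℓ T) (total : ℓ + suc m ≡ length T + 2) where
  i : ℕ
  i = length T + 2

  Q : ℕ → ℕ
  Q r = ⌊ i /√2^ r ⌋

  m≥1 : 1 ≤ m
  m≥1 = +-cancelˡ-≤ ℓ _ _ (≤-pred (begin
    suc (ℓ + 1)          ≤⟨ s≤s (+-monoˡ-≤ 1 (slot≤length σ)) ⟩
    suc (length T + 1)   ≡⟨ +-suc (length T) 1 ⟨
    length T + 2         ≡⟨ total ⟨
    ℓ + suc m            ≡⟨ +-suc ℓ m ⟩
    suc (ℓ + m)          ∎))
    where open ≤-Reasoning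

  i≥1 : 1 ≤ i
  i≥1 = ≤-trans (s≤s z≤n) (m≤n+m 2 (length T))

  -- The search of Step 3 is charged together with the tests of Step 2, because `searchCost` counts
  -- both.
  Found : ℕ → ℕ → Counted ℕ → Set
  Found steps r x = ∃[ r′ ] proj₂ x ≡ suc r′ × Q (suc r′) ≤ m × m < Q r′ ×
    proj₁ x + dep (Q r′ ∸ Q (suc r′)) (Q r′ ∸ suc m) ≤ searchCost steps (Q r) (Q (suc r)) m

  pos : ℕ → ℕ
  pos r = ⌈α suc r · i ⌉ ∸ 1

  pos+Q : ∀ r → pos r + suc (Q (suc r)) ≡ i
  pos+Q r = trans (shuffle (pos r) (Q (suc r)))
    (trans (cong (_+ Q (suc r)) (m∸n+n≡m (m<n⇒0<n∸m (root-< i r i≥1))))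
      (m∸n+n≡m (<⇒≤ (root-< i r i≥1))))
    where
    shuffle : ∀ x q → x + suc q ≡ x + 1 + q
    shuffle = solve-∀

  stopHere : ∀ steps r → Q (suc r) ≤ m → m < Q r → ∀ {c} → c ≤ 1 → Found (suc steps) r (c , suc r)
  stopHere steps r Q≤m m<Q c≤1 = r , refl , Q≤m , m<Q , +-mono-≤ c≤1 (≤-reflexive found)
    where
    found : dep (Q r ∸ Q (suc r)) (Q r ∸ suc m) ≡
      (if Q (suc r) ≤ᵇ m then dep (Q r ∸ Q (suc r)) (Q r ∸ suc m) else searchCost steps (Q (suc r)) ⌊ Q r /2⌋ m)
    found with Q (suc r) ≤ᵇ m in test
    ... | true  = refl
    ... | false = contradiction (≤⇒≤ᵇ Q≤m) (subst Data.Bool.T test)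

  goOn : ∀ steps r → m < Q (suc r) → ∀ {x} → Found steps (suc r) x → Found (suc steps) r (1 + proj₁ x , proj₂ x)
  goOn steps r m<Q (r′ , eq , lo , hi , le) = r′ , eq , lo , hi , s≤s (≤-trans le (≤-reflexive next))
    where
    next : searchCost steps (Q (suc r)) (Q (suc (suc r))) m ≡
      (if Q (suc r) ≤ᵇ m then dep (Q r ∸ Q (suc r)) (Q r ∸ suc m) else searchCost steps (Q (suc r)) ⌊ Q r /2⌋ m)
    next with Q (suc r) ≤ᵇ m in test
    ... | true  = contradiction (≤ᵇ⇒≤ _ _ (subst Data.Bool.T (sym test) tt)) (<⇒≱ m<Q)
    ... | false = cong (λ h → searchCost steps (Q (suc r)) h m) (root-halve i r)

  firstAbove-spec : ∀ steps r → r + steps ≡ ⌊log₂ i ^ 2 ⌋ → m < Q r → Found steps r (firstAbove A T steps (suc r))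
  firstAbove-spec zero r end m<Q = contradiction
    (<-≤-trans m<Q (≤-trans (≤-reflexive (cong Q (trans (sym (+-identityʳ r)) end))) (root-last i i≥1)))
    (≤⇒≯ m≥1)
  firstAbove-spec (suc steps) r end m<Q with head (drop (pos r) T) in eq
  -- Past the end of `T` the test is free, while `searchCost` charges a comparison.
  ... | nothing = stopHere steps r (≤-trans Q≤1 m≥1) m<Q z≤n
    where
    Q≤1 : Q (suc r) ≤ 1
    Q≤1 = +-cancelˡ-≤ (length T) _ _ (≤-pred (begin
      suc (length T + Q (suc r))    ≡⟨ +-suc (length T) _ ⟨
      length T + suc (Q (suc r))    ≤⟨ +-monoˡ-≤ _ (head-drop-nothing (pos r) T eq) ⟩
      pos r + suc (Q (suc r))       ≡⟨ pos+Q r ⟩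
      length T + 2                  ≡⟨ +-suc (length T) 1 ⟩
      suc (length T + 1)            ∎))
      where open ≤-Reasoning
  ... | just t with slot-compare (pos r) (proj₂ (head-drop-just (pos r) T eq)) σ
  ...   | inj₁ (ℓ≤ , A<t) rewrite <ᵇ-true A<t = stopHere steps r (≤-pred (+-cancelˡ-≤ ℓ _ _ (begin
      ℓ + suc (Q (suc r))       ≤⟨ +-monoˡ-≤ _ ℓ≤ ⟩
      pos r + suc (Q (suc r))   ≡⟨ pos+Q r ⟩
      i                         ≡⟨ total ⟨
      ℓ + suc m                 ∎))) m<Q (s≤s z≤n)
    where open ≤-Reasoning
  ...   | inj₂ (<ℓ , t<A) rewrite <ᵇ-false (<⇒≤ t<A) = goOn steps r m<Q′
      (firstAbove-spec steps (suc r) (trans (sym (+-suc r steps)) end) m<Q′)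
    where
    open ≤-Reasoning
    m<Q′ : m < Q (suc r)
    m<Q′ = ≤-pred (+-cancelˡ-< (pos r) _ _ (begin-strict
      pos r + suc m             <⟨ +-monoˡ-< (suc m) <ℓ ⟩
      ℓ + suc m                 ≡⟨ total ⟩
      i                         ≡⟨ pos+Q r ⟨
      pos r + suc (Q (suc r))   ∎))

Within-mono : ∀ {v w s c} → v ≤ w → Within v s c → Within w s c
Within-mono v≤w W k w≤ = depth (long D) λ lt → short D (≤-<-trans (+-monoʳ-≤ _ v≤w) lt)
  where
  D = W k (≤-trans v≤w w≤)

bind-≡ : ∀ {A B : Set} (x : Counted A) (f : A → Counted B) {v} → proj₂ x ≡ v →
         (x >>= f) ≡ (proj₁ x + proj₁ (f v) , proj₂ (f v))
bind-≡ x f refl = refl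

rhbsInsert-spec : ∀ {A s} T → Slot A s T →
  proj₂ (rhbsInsert A T) ≡ placeAt s A T × proj₁ (rhbsInsert A T) ≤ dep (length T + 1) s
rhbsInsert-spec {A} T σ = cong (λ j → placeAt j A T) (proj₁ (rhbs-spec T σ)) ,
  ≤-trans (≤-reflexive (+-identityʳ _)) (Within⇒≤dep (proj₂ (rhbs-spec T σ)))

root≤ : ∀ i r → ⌊ i /√2^ r ⌋ ≤ i
root≤ i zero    = ≤-reflexive (root-zero i)
root≤ i (suc r) = ≤-trans (root-antitone i r) (root≤ i r)

mergeCost : ℕ → ℕ → ℕ → ℕ
mergeCost i ℓ t = searchCost ⌊log₂ i ^ 2 ⌋ i ⌊ i /√2^ 1 ⌋ (i ∸ suc ℓ) + dep (i ∸ suc ℓ) (t ∸ ℓ)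

merge<-spec : ∀ {A B ℓ t} T → Slot A ℓ T → Slot B t T → ℓ ≤ t →
  proj₂ (merge< A B T) ≡ take ℓ T ++ A ∷ placeAt (t ∸ ℓ) B (drop ℓ T) ×
  proj₁ (merge< A B T) ≤ mergeCost (length T + 2) ℓ t
merge<-spec {A} {B} {ℓ} {t} T σ τ ℓ≤t = subst₂ (λ x y → proj₂ x ≡ y × proj₁ x ≤ mergeCost (length T + 2) ℓ t) (sym unfolded) refl
  (cong (take ℓ T ++_) (cong (A ∷_) (proj₁ inserted)) , bound)
  where
  i m : ℕ
  i = length T + 2
  m = i ∸ suc ℓ
  total : ℓ + suc m ≡ i
  total = trans (+-suc ℓ m) (m+[n∸m]≡n (≤-trans (s≤s (slot≤length σ))
    (≤-trans (≤-reflexive (+-comm 1 (length T))) (+-monoʳ-≤ (length T) (s≤s z≤n)))))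
  open FirstAbove T σ total using (Q; pos; pos+Q; m≥1; i≥1; Found; firstAbove-spec)
  L = ⌊log₂ i ^ 2 ⌋
  found : Found L 0 (firstAbove A T L 1)
  found = firstAbove-spec L 0 refl (≤-trans (≤-trans (m≤n+m (suc m) ℓ) (≤-reflexive total)) (≤-reflexive (sym (root-zero i))))
  r o : ℕ
  r = proj₁ found
  o = ⌈α r · i ⌉
  block : List ℕ
  block = take (pos r ∸ o) (drop o T)
  o+Q : o + Q r ≡ i
  o+Q = m∸n+n≡m (root≤ i r)
  m<Q : m < Q r
  m<Q = proj₁ (proj₂ (proj₂ (proj₂ found)))
  Q≤m : Q (suc r) ≤ m
  Q≤m = proj₁ (proj₂ (proj₂ found))
  s : ℕ
  s = Q r ∸ suc m
  o+s : o + s ≡ ℓ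
  o+s = +-cancelʳ-≡ (suc m) _ _ (trans (+-assoc o s (suc m)) (trans (cong (o +_) (m∸n+n≡m m<Q)) (trans o+Q (sym total))))
  ℓ≤pos : ℓ ≤ pos r
  ℓ≤pos = +-cancelʳ-≤ (suc (Q (suc r))) _ _ (≤-trans (+-monoʳ-≤ ℓ (s≤s Q≤m)) (≤-reflexive (trans total (sym (pos+Q r)))))
  o≤pos : o ≤ pos r
  o≤pos = ≤-trans (≤-trans (m≤m+n o s) (≤-reflexive o+s)) ℓ≤pos
  width : pos r ∸ o + 1 ≡ Q r ∸ Q (suc r)
  width = sym (trans (cong (_∸ Q (suc r)) (+-cancelˡ-≡ o _ _ (begin
    o + Q r                            ≡⟨ trans o+Q (sym (pos+Q r)) ⟩
    pos r + suc (Q (suc r))            ≡⟨ cong (_+ suc (Q (suc r))) (m+[n∸m]≡n o≤pos) ⟨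
    o + (pos r ∸ o) + suc (Q (suc r))  ≡⟨ regroup o (pos r ∸ o) (Q (suc r)) ⟩
    o + (pos r ∸ o + 1 + Q (suc r))    ∎))) (m+n∸n≡m (pos r ∸ o + 1) (Q (suc r))))
    where
    open ≡-Reasoning
    regroup : ∀ o x q → o + x + suc q ≡ o + (x + 1 + q)
    regroup = solve-∀
  σ′ : Slot A s block
  σ′ = slot-take (pos r ∸ o) (≤-trans (≤-reflexive (sym (trans (cong (_∸ o) (sym o+s)) (m+n∸m≡n o s)))) (∸-monoˡ-≤ o ℓ≤pos))
    (slot-drop o (subst (λ x → Slot A x T) (sym o+s) σ))
  searched = rhbs-spec block σ′
  -- `take` stops at the end of its list, so the width is only bounded above; `Within-mono` then
  -- widens the block.
  block≤ : length block + 1 ≤ Q r ∸ Q (suc r)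
  block≤ = ≤-trans (+-monoˡ-≤ 1 (≤-trans (≤-reflexive (length-take (pos r ∸ o) (drop o T))) (m⊓n≤m (pos r ∸ o) _)))
    (≤-reflexive width)
  inserted = rhbsInsert-spec (drop ℓ T) (slot-drop ℓ {s = t ∸ ℓ} (subst (λ x → Slot B x T) (sym (m+[n∸m]≡n ℓ≤t)) τ))
  rest : ℕ → Counted (List ℕ)
  rest j = rhbsInsert B (drop j T) >>= λ U → pure (take j T ++ A ∷ U)
  afterSearch : ℕ → Counted (List ℕ)
  afterSearch r = rhbs A (take (⌈α r · i ⌉ ∸ 1 ∸ ⌈α r ∸ 1 · i ⌉) (drop ⌈α r ∸ 1 · i ⌉ T)) >>=
    λ j → rest (⌈α r ∸ 1 · i ⌉ + j)
  unfolded : merge< A B T ≡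
    (proj₁ (firstAbove A T L 1) + (proj₁ (rhbs A block) + proj₁ (rest ℓ)) , proj₂ (rest ℓ))
  unfolded = trans (bind-≡ (firstAbove A T L 1) afterSearch (proj₁ (proj₂ found)))
    (cong (λ x → (proj₁ (firstAbove A T L 1) + proj₁ x , proj₂ x)) {x = afterSearch (suc r)}
      (trans (bind-≡ (rhbs A block) (λ j → rest (o + j)) (proj₁ searched))
        (cong (λ ℓ → proj₁ (rhbs A block) + proj₁ (rest ℓ) , proj₂ (rest ℓ)) o+s)))
  bound : proj₁ (firstAbove A T L 1) + (proj₁ (rhbs A block) + proj₁ (rest ℓ)) ≤ mergeCost i ℓ t
  bound = begin
    proj₁ (firstAbove A T L 1) + (proj₁ (rhbs A block) + proj₁ (rest ℓ))
      ≡⟨ +-assoc (proj₁ (firstAbove A T L 1)) _ _ ⟨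
    proj₁ (firstAbove A T L 1) + proj₁ (rhbs A block) + proj₁ (rest ℓ)
      ≤⟨ +-mono-≤ (≤-trans (+-monoʳ-≤ (proj₁ (firstAbove A T L 1)) (Within⇒≤dep (Within-mono block≤ (proj₂ searched))))
           (proj₂ (proj₂ (proj₂ (proj₂ found)))))
         (≤-trans (≤-reflexive (+-identityʳ _)) (proj₂ inserted)) ⟩
    searchCost L (Q 0) (Q 1) m + dep (length (drop ℓ T) + 1) (t ∸ ℓ)
      ≡⟨ cong₂ (λ a w → searchCost L a (Q 1) m + dep w (t ∸ ℓ)) (root-zero i) slots ⟩
    mergeCost i ℓ t ∎
    where
    open ≤-Reasoning
    slots : length (drop ℓ T) + 1 ≡ m
    slots = +-cancelˡ-≡ (suc ℓ) _ _ (trans (cong (λ x → suc ℓ + (x + 1)) (length-drop ℓ T))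
      (trans (regroup ℓ (length T ∸ ℓ)) (trans (cong (_+ 2) (m+[n∸m]≡n (slot≤length σ)))
        (trans (sym total) (+-suc ℓ m)))))
      where
      regroup : ∀ ℓ x → suc ℓ + (x + 1) ≡ ℓ + x + 2
      regroup = solve-∀

-- A random order yields the slot of B in the list that already contains A, whereas 2Merge needs
-- both slots in T. That of B shifts by one exactly when A lies below B.
slot-place : ∀ {A B a b T} → Slot A a T → Slot B b (placeAt a A T) →
  (a < b × A < B × Slot B (pred b) T) ⊎ (b ≤ a × B < A × Slot B b T)
slot-place (here _)    (here (B<A ∷ B<T)) = inj₂ (z≤n , B<A , here B<T)
slot-place (here _)    (there A<B σ)      = inj₁ (s≤s z≤n , A<B , σ)
slot-place (there _ τ) (here (B<t ∷ B<T)) with slot-place τ (here B<T)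
... | inj₂ (_ , B<A , here B<T′) = inj₂ (z≤n , B<A , here (B<t ∷ B<T′))
slot-place (there _ τ) (there {suc b} t<B σ) with slot-place τ σ
... | inj₁ (a<b , A<B , σ′) = inj₁ (s≤s a<b , A<B , there t<B σ′)
... | inj₂ (b≤a , B<A , σ′) = inj₂ (s≤s b≤a , B<A , there t<B σ′)
slot-place (there _ τ) (there {zero} t<B σ) with slot-place τ σ
... | inj₂ (b≤a , B<A , σ′) = inj₂ (s≤s b≤a , B<A , there t<B σ′)

place-after : ∀ A B a b T → a ≤ length T → a < b →
  take a T ++ A ∷ placeAt (pred b ∸ a) B (drop a T) ≡ placeAt b B (placeAt a A T)
place-after A B zero    (suc b)       T       _         _         = refl
place-after A B (suc a) (suc zero)    (t ∷ T) _         (s≤s ())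
place-after A B (suc a) (suc (suc b)) (t ∷ T) (s≤s a≤) (s≤s a<b) = cong (t ∷_) (place-after A B a (suc b) T a≤ a<b)

place-before : ∀ A B a b T → a ≤ length T → b ≤ a →
  take b T ++ B ∷ placeAt (a ∸ b) A (drop b T) ≡ placeAt b B (placeAt a A T)
place-before A B a       zero    T       _        _         = refl
place-before A B (suc a) (suc b) (t ∷ T) (s≤s a≤) (s≤s b≤a) = cong (t ∷_) (place-before A B a b T a≤ b≤a)

length-placeAt : ∀ a A T → a ≤ length T → length (placeAt a A T) ≡ suc (length T)
length-placeAt zero    A T       _        = refl
length-placeAt (suc a) A (t ∷ T) (s≤s a≤) = cong suc (length-placeAt a A T a≤)

merges : ℕ → Bool
merges n = (((ℤ.+ 5511) ℚᵘ./ 10000) ℚᵘ.≤ᵇ p n) ∧ (p n ℚᵘ.≤ᵇ ((ℤ.+ 888) ℚᵘ./ 1000))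

orderedCost : ℕ → ℕ → ℕ → ℕ
orderedCost n a b = if a <ᵇ b then mergeCost n a (pred b) else mergeCost n b a

pairCost : ℕ → ℕ → ℕ → ℕ
pairCost n a b = if merges n then suc (orderedCost n a b) else dep (pred n) a + dep n b

Correct : Counted (List ℕ) → List ℕ → ℕ → Set
Correct x L c = proj₂ x ≡ L × proj₁ x ≤ c

Correct-if : ∀ b {x y L c d} → Correct x L c → Correct y L d →
             Correct (if b then x else y) L (if b then c else d)
Correct-if true  p _ = p
Correct-if false _ q = q

tick : Counted (List ℕ) → Counted (List ℕ)
tick x = suc (proj₁ x) , proj₂ x

2Merge-if : ∀ A B T {b} → (A <ᵇ B) ≡ b → 2Merge A B T ≡ tick (if b then merge< A B T else merge< B A T)
2Merge-if A B T refl = refl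

2Merge-spec : ∀ {A B a b} T → Slot A a T → Slot B b (placeAt a A T) →
  Correct (2Merge A B T) (placeAt b B (placeAt a A T)) (suc (orderedCost (length T + 2) a b))
2Merge-spec {A} {B} {a} {b} T σ τ = [ after , before ]′ (slot-place σ τ)
  where
  n : ℕ
  n = length T + 2
  Goal : Set
  Goal = Correct (2Merge A B T) (placeAt b B (placeAt a A T)) (suc (orderedCost n a b))
  order : ∀ x → (A <ᵇ B) ≡ x → (a <ᵇ b) ≡ x →
    Correct (if x then merge< A B T else merge< B A T) (placeAt b B (placeAt a A T))
            (if x then mergeCost n a (pred b) else mergeCost n b a) → Goal
  order x A?B a?b (result , cost) = subst₂ (λ y c → Correct y (placeAt b B (placeAt a A T)) (suc c))
    (sym (2Merge-if A B T A?B))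
    (sym (cong (λ x → if x then mergeCost n a (pred b) else mergeCost n b a) a?b))
    (result , s≤s cost)
  after : a < b × A < B × Slot B (pred b) T → Goal
  after (a<b , A<B , τ′) = order true (<ᵇ-true A<B) (<ᵇ-true a<b)
    (trans (proj₁ spec) (place-after A B a b T (slot≤length σ) a<b) , proj₂ spec)
    where
    spec = merge<-spec T σ τ′ (≤-pred (≤-trans a<b (≤-reflexive (sym (suc-pred b {{>-nonZero (≤-trans (s≤s z≤n) a<b)}})))))
  before : b ≤ a × B < A × Slot B b T → Goal
  before (b≤a , B<A , τ′) = order false (<ᵇ-false (<⇒≤ B<A)) (<ᵇ-false b≤a)
    (trans (proj₁ spec) (place-before A B a b T (slot≤length σ) b≤a) , proj₂ spec)
    where
    spec = merge<-spec T τ′ σ b≤a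

rhbsTwice-spec : ∀ {A B a b} T → Slot A a T → Slot B b (placeAt a A T) →
  Correct (rhbsInsert A T >>= rhbsInsert B) (placeAt b B (placeAt a A T))
          (dep (pred (length T + 2)) a + dep (length T + 2) b)
rhbsTwice-spec {A} {B} {a} {b} T σ τ =
  subst (λ x → Correct x (placeAt b B (placeAt a A T)) (dep (pred (length T + 2)) a + dep (length T + 2) b))
    (sym (bind-≡ (rhbsInsert A T) (rhbsInsert B) (proj₁ first)))
    (proj₁ second , +-mono-≤
      (≤-trans (proj₂ first) (≤-reflexive (cong (λ w → dep w a) (sym (cong pred (+-suc (length T) 1))))))
      (≤-trans (proj₂ second) (≤-reflexive (cong (λ w → dep w b)
        (trans (cong (_+ 1) (length-placeAt a A T (slot≤length σ))) (sym (+-suc (length T) 1)))))))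
  where
  first = rhbsInsert-spec T σ
  second = rhbsInsert-spec (placeAt a A T) τ

insertPair-spec : ∀ {A B a b} T → Slot A a T → Slot B b (placeAt a A T) →
  Correct (insertPair (length T + 2) A B T) (placeAt b B (placeAt a A T)) (pairCost (length T + 2) a b)
insertPair-spec T σ τ = Correct-if (merges (length T + 2)) (2Merge-spec T σ τ) (rhbsTwice-spec T σ τ)

-- Random permutations

∑ᶠ : ∀ n → (Fin n → ℕ) → ℕ
∑ᶠ zero    f = 0
∑ᶠ (suc n) f = f zero + ∑ᶠ n (f ∘ suc)

∑ᶠ-cong : ∀ n {f g} → (∀ i → f i ≡ g i) → ∑ᶠ n f ≡ ∑ᶠ n g
∑ᶠ-cong zero    eq = refl
∑ᶠ-cong (suc n) eq = cong₂ _+_ (eq zero) (∑ᶠ-cong n (eq ∘ suc))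

∑ᶠ-mono : ∀ n {f g} → (∀ i → f i ≤ g i) → ∑ᶠ n f ≤ ∑ᶠ n g
∑ᶠ-mono zero    le = z≤n
∑ᶠ-mono (suc n) le = +-mono-≤ (le zero) (∑ᶠ-mono n (le ∘ suc))

∑ᶠ-const : ∀ n c → ∑ᶠ n (λ _ → c) ≡ n * c
∑ᶠ-const zero    c = refl
∑ᶠ-const (suc n) c = cong (c +_) (∑ᶠ-const n c)

∑ᶠ-last : ∀ n f → ∑ᶠ (suc n) f ≡ ∑ᶠ n (f ∘ inject₁) + f (fromℕ n)
∑ᶠ-last zero    f = +-identityʳ _
∑ᶠ-last (suc n) f = trans (cong (f zero +_) (∑ᶠ-last n (f ∘ suc))) (sym (+-assoc (f zero) _ _))

sum-allFin : ∀ {A : Set} n (g : Fin n → A) f → sum (map f (map g (allFin n))) ≡ ∑ᶠ n (f ∘ g)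
sum-allFin n g f = trans (cong (sum ∘ map f) (map-tabulate id g)) (trans (cong sum (map-tabulate g f)) (sum-tabulate n (f ∘ g)))
  where
  sum-tabulate : ∀ n f → sum (tabulate f) ≡ ∑ᶠ n f
  sum-tabulate zero    f = refl
  sum-tabulate (suc n) f = cong (f zero +_) (sum-tabulate n (f ∘ suc))

module _ {A : Set} where
  sum-cong : ∀ (xs : List A) {f g} → (∀ x → f x ≡ g x) → sum (map f xs) ≡ sum (map g xs)
  sum-cong []       eq = refl
  sum-cong (x ∷ xs) eq = cong₂ _+_ (eq x) (sum-cong xs eq)

  sum-mono : ∀ {xs : List A} {f g} → All (λ x → f x ≤ g x) xs → sum (map f xs) ≤ sum (map g xs)
  sum-mono []         = z≤n
  sum-mono (le ∷ les) = +-mono-≤ le (sum-mono les)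

  sum-+ : ∀ (xs : List A) f g → sum (map (λ x → f x + g x) xs) ≡ sum (map f xs) + sum (map g xs)
  sum-+ []       f g = refl
  sum-+ (x ∷ xs) f g = trans (cong (f x + g x +_) (sum-+ xs f g)) (swap (f x) (g x) (sum (map f xs)) (sum (map g xs)))
    where
    swap : ∀ a b c d → a + b + (c + d) ≡ a + c + (b + d)
    swap = solve-∀

  sum≡0⇒All : ∀ (xs : List A) {f} → sum (map f xs) ≡ 0 → All (λ x → f x ≡ 0) xs
  sum≡0⇒All []       eq = []
  sum≡0⇒All (x ∷ xs) eq = m+n≡0⇒m≡0 _ eq ∷ sum≡0⇒All xs (m+n≡0⇒n≡0 _ eq)

  All⇒sum≡0 : ∀ {xs : List A} {f} → All (λ x → f x ≡ 0) xs → sum (map f xs) ≡ 0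
  All⇒sum≡0 []         = refl
  All⇒sum≡0 (eq ∷ eqs) = cong₂ _+_ eq (All⇒sum≡0 eqs)

∑ₚ : ∀ {n} → Vec ℕ n → (Vec ℕ n → ℕ) → ℕ
∑ₚ v f = sum (map f (permutations v))

∑ₚ-∷ : ∀ {n} x (xs : Vec ℕ n) f → ∑ₚ (x ∷ xs) f ≡ ∑ₚ xs (λ ys → ∑ᶠ (suc n) (λ i → f (insertAt ys i x)))
∑ₚ-∷ {n} x xs f = go (permutations xs)
  where
  go : ∀ yss → sum (map f (concatMap (λ ys → map (λ i → insertAt ys i x) (allFin (suc n))) yss)) ≡
               sum (map (λ ys → ∑ᶠ (suc n) (λ i → f (insertAt ys i x))) yss)
  go []         = refl
  go (ys ∷ yss) = trans (cong sum (map-++ f (map (λ i → insertAt ys i x) (allFin (suc n))) _))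
    (trans (sum-++ (map f (map (λ i → insertAt ys i x) (allFin (suc n)))) _)
      (cong₂ _+_ (sum-allFin (suc n) (λ i → insertAt ys i x) f) (go yss)))

∑ₚ-const : ∀ {n} (v : Vec ℕ n) c → ∑ₚ v (λ _ → c) ≡ n ! * c
∑ₚ-const []               c = refl
∑ₚ-const {suc n} (x ∷ xs) c = trans (∑ₚ-∷ x xs (λ _ → c))
  (trans (sum-cong (permutations xs) (λ _ → ∑ᶠ-const (suc n) c))
    (trans (∑ₚ-const xs (suc n * c)) (regroup (n !) n c)))
  where
  regroup : ∀ f n c → f * (suc n * c) ≡ (suc n * f) * c
  regroup = solve-∀

insertAt-inject₁ : ∀ {n} (S : Vec ℕ n) y i x → insertAt (S ∷ʳ y) (inject₁ i) x ≡ insertAt S i x ∷ʳ y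
insertAt-inject₁ S       y zero    x = refl
insertAt-inject₁ (s ∷ S) y (suc i) x = cong (s ∷_) (insertAt-inject₁ S y i x)

insertAt-fromℕ : ∀ {n} (S : Vec ℕ n) x → insertAt S (fromℕ n) x ≡ S ∷ʳ x
insertAt-fromℕ []      x = refl
insertAt-fromℕ (s ∷ S) x = cong (s ∷_) (insertAt-fromℕ S x)

-- Every element is the last one in the same number of permutations.
∑ₚ-last : ∀ n (v : Vec ℕ (suc n)) f →
  ∑ₚ v f ≡ ∑ᶠ (suc n) (λ i → ∑ₚ (removeAt v i) (λ S → f (S ∷ʳ lookup v i)))
∑ₚ-last zero    (x ∷ [])         f = sym (+-identityʳ _)
∑ₚ-last (suc n) (x ∷ xs@(_ ∷ _)) f = begin
  ∑ₚ (x ∷ xs) f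
    ≡⟨ ∑ₚ-∷ x xs f ⟩
  ∑ₚ xs (λ ys → ∑ᶠ (suc (suc n)) (λ i → f (insertAt ys i x)))
    ≡⟨ sum-cong (permutations xs) (λ ys → trans (∑ᶠ-last (suc n) (λ i → f (insertAt ys i x)))
         (cong (inner ys +_) (cong f (insertAt-fromℕ ys x)))) ⟩
  ∑ₚ xs (λ ys → inner ys + f (ys ∷ʳ x))
    ≡⟨ trans (sum-+ (permutations xs) inner (λ ys → f (ys ∷ʳ x))) (+-comm (∑ₚ xs inner) _) ⟩
  ∑ₚ xs (λ ys → f (ys ∷ʳ x)) + ∑ₚ xs inner
    ≡⟨ cong (∑ₚ xs (λ ys → f (ys ∷ʳ x)) +_) (trans (∑ₚ-last n xs inner) (∑ᶠ-cong (suc n) later)) ⟩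
  ∑ₚ xs (λ ys → f (ys ∷ʳ x)) + ∑ᶠ (suc n) (λ i → ∑ₚ (x ∷ removeAt xs i) (λ S → f (S ∷ʳ lookup xs i))) ∎
  where
  open ≡-Reasoning
  inner : Vec ℕ (suc n) → ℕ
  inner ys = ∑ᶠ (suc n) (λ i → f (insertAt ys (inject₁ i) x))
  later : ∀ i → ∑ₚ (removeAt xs i) (λ S → inner (S ∷ʳ lookup xs i)) ≡
                ∑ₚ (x ∷ removeAt xs i) (λ S → f (S ∷ʳ lookup xs i))
  later i = trans
    (sum-cong (permutations (removeAt xs i)) (λ S → ∑ᶠ-cong (suc n) (λ j → cong f (insertAt-inject₁ S (lookup xs i) j x))))
    (sym (∑ₚ-∷ x (removeAt xs i) (λ S → f (S ∷ʳ lookup xs i))))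

-- A sum of natural numbers vanishes only if every term does, so `∑ₚ-last`, an identity of sums,
-- also transports statements about all permutations.
All-∷ʳ⇒All : ∀ {n} (v : Vec ℕ (suc n)) {f : Vec ℕ (suc n) → ℕ} →
  (∀ i → All (λ S → f (S ∷ʳ lookup v i) ≡ 0) (permutations (removeAt v i))) → All (λ S → f S ≡ 0) (permutations v)
All-∷ʳ⇒All {n} v {f} all = sum≡0⇒All (permutations v) (trans (∑ₚ-last n v f)
  (trans (∑ᶠ-cong (suc n) (λ i → All⇒sum≡0 (all i))) (trans (∑ᶠ-const (suc n) 0) (*-zeroʳ n))))

data Ascending : ∀ {n} → Vec ℕ n → Set where
  []  : Ascending []
  _∷_ : ∀ {n x} {xs : Vec ℕ n} → All (x <_) (toList xs) → Ascending xs → Ascending (x ∷ xs)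

All-removeAt : ∀ {P : ℕ → Set} {n} (v : Vec ℕ (suc n)) i → All P (toList v) →
               P (lookup v i) × All P (toList (removeAt v i))
All-removeAt (x ∷ xs)         zero    (p ∷ ps) = p , ps
All-removeAt (x ∷ xs@(_ ∷ _)) (suc i) (p ∷ ps) =
  proj₁ (All-removeAt xs i ps) , p ∷ proj₂ (All-removeAt xs i ps)

Ascending-removeAt : ∀ {n} (v : Vec ℕ (suc n)) i → Ascending v → Ascending (removeAt v i)
Ascending-removeAt (x ∷ xs)         zero    (_ ∷ as) = as
Ascending-removeAt (x ∷ xs@(_ ∷ _)) (suc i) (a ∷ as) =
  proj₂ (All-removeAt xs i a) ∷ Ascending-removeAt xs i as

Slot-removeAt : ∀ {n} (v : Vec ℕ (suc n)) i → Ascending v → Slot (lookup v i) (toℕ i) (toList (removeAt v i))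
Slot-removeAt (x ∷ xs)         zero    (a ∷ _)  = here a
Slot-removeAt (x ∷ xs@(_ ∷ _)) (suc i) (a ∷ as) = there (proj₁ (All-removeAt xs i a)) (Slot-removeAt xs i as)

placeAt-removeAt : ∀ {n} (v : Vec ℕ (suc n)) i → placeAt (toℕ i) (lookup v i) (toList (removeAt v i)) ≡ toList v
placeAt-removeAt (x ∷ xs)         zero    = refl
placeAt-removeAt (x ∷ xs@(_ ∷ _)) (suc i) = cong (x ∷_) (placeAt-removeAt xs i)

Ascending-tabulate : ∀ n (f : Fin n → ℕ) → (∀ {i j} → i Fin.< j → f i < f j) → Ascending (Vec.tabulate f)
Ascending-tabulate zero    f mono = []
Ascending-tabulate (suc n) f mono =
  all n (f ∘ suc) (λ i → mono (s≤s z≤n)) ∷ Ascending-tabulate n (f ∘ suc) (λ i<j → mono (s≤s i<j))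
  where
  all : ∀ n (g : Fin n → ℕ) → (∀ i → f zero < g i) → All (f zero <_) (toList (Vec.tabulate g))
  all zero    g lt = []
  all (suc n) g lt = lt zero ∷ all n (g ∘ suc) (lt ∘ suc)

∑ᶠ-∑ : ∀ n f → ∑ᶠ n (f ∘ toℕ) ≡ ∑ n f
∑ᶠ-∑ zero    f = refl
∑ᶠ-∑ (suc n) f = trans (∑ᶠ-last n (f ∘ toℕ)) (cong₂ _+_
  (trans (∑ᶠ-cong n (λ i → cong f (Fin.toℕ-inject₁ i))) (∑ᶠ-∑ n f)) (cong f (Fin.toℕ-fromℕ n)))

init-last-∷ʳ : ∀ {m} {X : Set} (G : Vec ℕ m → ℕ → ℕ → X) S A B →
  G (init (init (S ∷ʳ A ∷ʳ B))) (last (init (S ∷ʳ A ∷ʳ B))) (last (S ∷ʳ A ∷ʳ B)) ≡ G S A B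
init-last-∷ʳ G S A B = trans
  (cong₂ (λ X b → G (init X) (last X) b) (init-∷ʳ B (S ∷ʳ A)) (last-∷ʳ B (S ∷ʳ A)))
  (cong₂ (λ X a → G X a B) (init-∷ʳ A S) (last-∷ʳ A S))

-- Counting the unsorted outputs turns the correctness of sorting into a
-- statement about ∑ₚ, to which ∑ₚ-last applies.
private
  errors : ∀ {n} → (Vec ℕ n → Counted (List ℕ)) → List ℕ → Vec ℕ n → ℕ
  errors sort L S with ≡-dec _≟_ (proj₂ (sort S)) L
  ... | yes _ = 0
  ... | no  _ = 1

  errors≡0 : ∀ {n} (sort : Vec ℕ n → Counted (List ℕ)) L S → errors sort L S ≡ 0 → proj₂ (sort S) ≡ L
  errors≡0 sort L S eq with ≡-dec _≟_ (proj₂ (sort S)) L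
  ... | yes p = p

  ≡⇒errors≡0 : ∀ {n} (sort : Vec ℕ n → Counted (List ℕ)) L S → proj₂ (sort S) ≡ L → errors sort L S ≡ 0
  ≡⇒errors≡0 sort L S eq with ≡-dec _≟_ (proj₂ (sort S)) L
  ... | yes _ = refl
  ... | no ¬p = contradiction eq ¬p

Sorts : ∀ {m} → (Vec ℕ m → Counted (List ℕ)) → Set
Sorts {m} sort = ∀ v → Ascending v → All (λ S → proj₂ (sort S) ≡ toList v) (permutations v)

CostAtMost : ∀ {m} → ℕ → (Vec ℕ m → Counted (List ℕ)) → Set
CostAtMost {m} c sort = ∀ v → Ascending v → ∑ₚ v (λ S → comparisons (sort S)) ≤ c

-- Every pair of slots (b , a) of the last two elements occurs with all m ! orderings of the rest.
-- Hence the total of the recursive call is counted (m + 2) (m + 1) times and the cost of each pair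
-- of slots m ! times.
module InsertTwo {m} (sort : Vec ℕ m → Counted (List ℕ)) (sort⁺ : Vec ℕ (suc (suc m)) → Counted (List ℕ))
  (insert : ℕ → ℕ → List ℕ → Counted (List ℕ)) (cost : ℕ → ℕ → ℕ)
  (unfold : ∀ S → sort⁺ S ≡ (sort (init (init S)) >>= insert (last (init S)) (last S)))
  (insert-spec : ∀ {A B a b} T → length T ≡ m → Slot A a T → Slot B b (placeAt a A T) →
                 Correct (insert A B T) (placeAt b B (placeAt a A T)) (cost a b)) where

  module _ (v : Vec ℕ (suc (suc m))) (asc : Ascending v) (b : Fin (suc (suc m))) (a : Fin (suc m)) where
    rest : Vec ℕ m
    rest = removeAt (removeAt v b) a
    A B : ℕ
    A = lookup (removeAt v b) a
    B = lookup v b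

    rest-asc : Ascending rest
    rest-asc = Ascending-removeAt (removeAt v b) a (Ascending-removeAt v b asc)

    inserted : Correct (insert A B (toList rest)) (toList v) (cost (toℕ a) (toℕ b))
    inserted = subst (λ L → Correct (insert A B (toList rest)) L (cost (toℕ a) (toℕ b)))
      (trans (cong (placeAt (toℕ b) B) (placeAt-removeAt (removeAt v b) a)) (placeAt-removeAt v b))
      (insert-spec (toList rest) (length-toList rest) (Slot-removeAt (removeAt v b) a (Ascending-removeAt v b asc))
        (subst (Slot B (toℕ b)) (sym (placeAt-removeAt (removeAt v b) a)) (Slot-removeAt v b asc)))

    step : ∀ {S} → proj₂ (sort S) ≡ toList rest →
      Correct (sort⁺ (S ∷ʳ A ∷ʳ B)) (toList v) (comparisons (sort S) + cost (toℕ a) (toℕ b))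
    step {S} eq = subst (λ x → Correct x (toList v) (comparisons (sort S) + cost (toℕ a) (toℕ b)))
      (sym (trans (trans (unfold _) (init-last-∷ʳ (λ X A B → sort X >>= insert A B) S A B))
        (bind-≡ (sort S) (insert A B) eq)))
      (proj₁ inserted , +-monoʳ-≤ (comparisons (sort S)) (proj₂ inserted))

  sorts⁺ : Sorts sort → Sorts sort⁺
  sorts⁺ sorts v asc = All.map (errors≡0 sort⁺ (toList v) _)
    (All-∷ʳ⇒All v λ b → All-∷ʳ⇒All (removeAt v b) λ a →
      All.map (λ eq → ≡⇒errors≡0 sort⁺ (toList v) _ (proj₁ (step v asc b a eq)))
        (sorts (rest v asc b a) (rest-asc v asc b a)))

  costAtMost⁺ : ∀ {c} → Sorts sort → CostAtMost c sort → CostAtMost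
    (suc (suc m) * (suc m * c) + m ! * ∑ (suc (suc m)) (λ b → ∑ (suc m) (λ a → cost a b))) sort⁺
  costAtMost⁺ {c} sorts bound v asc = begin
    ∑ₚ v f
      ≡⟨ ∑ₚ-last (suc m) v f ⟩
    ∑ᶠ n (λ b → ∑ₚ (removeAt v b) (λ S → f (S ∷ʳ lookup v b)))
      ≡⟨ ∑ᶠ-cong n (λ b → ∑ₚ-last m (removeAt v b) (λ S → f (S ∷ʳ lookup v b))) ⟩
    ∑ᶠ n (λ b → ∑ᶠ (suc m) (λ a → ∑ₚ (rest v asc b a) (λ S → f (S ∷ʳ lookup (removeAt v b) a ∷ʳ lookup v b))))
      ≤⟨ ∑ᶠ-mono n (λ b → ∑ᶠ-mono (suc m) (λ a → pair b a)) ⟩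
    ∑ᶠ n (λ b → ∑ᶠ (suc m) (λ a → c + m ! * cost (toℕ a) (toℕ b)))
      ≡⟨ ∑ᶠ-cong n (λ b → row (λ a → cost a (toℕ b))) ⟩
    ∑ᶠ n (λ b → suc m * c + m ! * ∑ (suc m) (λ a → cost a (toℕ b)))
      ≡⟨ affine n (suc m * c) (m !) (λ b → ∑ (suc m) (λ a → cost a b)) ⟩
    n * (suc m * c) + m ! * ∑ n (λ b → ∑ (suc m) (λ a → cost a b)) ∎
    where
    open ≤-Reasoning
    n : ℕ
    n = suc (suc m)
    f : Vec ℕ n → ℕ
    f S = comparisons (sort⁺ S)
    affine : ∀ l x y g → ∑ᶠ l (λ a → x + y * g (toℕ a)) ≡ l * x + y * ∑ l g
    affine l x y g = trans (∑ᶠ-∑ l (λ a → x + y * g a)) (trans (∑-distrib-+ l (λ _ → x) (λ a → y * g a))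
      (cong₂ _+_ (∑-const l x) (sym (*-distribˡ-∑ y l g))))
    row : ∀ g → ∑ᶠ (suc m) (λ a → c + m ! * g (toℕ a)) ≡ suc m * c + m ! * ∑ (suc m) g
    row = affine (suc m) c (m !)
    pair : ∀ b a → ∑ₚ (rest v asc b a) (λ S → f (S ∷ʳ lookup (removeAt v b) a ∷ʳ lookup v b)) ≤
                   c + m ! * cost (toℕ a) (toℕ b)
    pair b a = begin
      ∑ₚ (rest v asc b a) (λ S → f (S ∷ʳ lookup (removeAt v b) a ∷ʳ lookup v b))
        ≤⟨ sum-mono (All.map (λ eq → proj₂ (step v asc b a eq)) (sorts (rest v asc b a) (rest-asc v asc b a))) ⟩
      ∑ₚ (rest v asc b a) (λ S → comparisons (sort S) + cost (toℕ a) (toℕ b))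
        ≡⟨ sum-+ (permutations (rest v asc b a)) _ _ ⟩
      ∑ₚ (rest v asc b a) (λ S → comparisons (sort S)) + ∑ₚ (rest v asc b a) (λ _ → cost (toℕ a) (toℕ b))
        ≤⟨ +-mono-≤ (bound (rest v asc b a) (rest-asc v asc b a)) (≤-reflexive (∑ₚ-const (rest v asc b a) _)) ⟩
      c + m ! * cost (toℕ a) (toℕ b) ∎

-- Opaque, because comparing the unfolded definitions is costly.
opaque
  insertTwo : ℕ → ℕ → ℕ → List ℕ → Counted (List ℕ)
  insertTwo = insertPair

  slotCost : ℕ → ℕ → ℕ → ℕ
  slotCost = pairCost

  slotCost-≡ : ∀ n a b → slotCost n a b ≡ pairCost n a b
  slotCost-≡ n a b = refl

  insertion-unfold : ∀ k S → [1,2]Insertion (suc (suc k)) S ≡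
    ([1,2]Insertion (suc k) (init (init S)) >>= insertTwo (suc (suc k) * 2) (last (init S)) (last S))
  insertion-unfold k S = refl

  insertTwo-spec : ∀ {A B a b} T → Slot A a T → Slot B b (placeAt a A T) →
    Correct (insertTwo (length T + 2) A B T) (placeAt b B (placeAt a A T)) (slotCost (length T + 2) a b)
  insertTwo-spec = insertPair-spec

insertTwo-correct : ∀ k {A B a b} T → length T ≡ suc k * 2 → Slot A a T → Slot B b (placeAt a A T) →
  Correct (insertTwo (suc (suc k) * 2) A B T) (placeAt b B (placeAt a A T)) (slotCost (suc (suc k) * 2) a b)
insertTwo-correct k {A} {B} {a} {b} T len σ τ =
  subst (λ n → Correct (insertTwo n A B T) (placeAt b B (placeAt a A T)) (slotCost n a b))
    (trans (cong (_+ 2) len) (+-comm (suc k * 2) 2)) (insertTwo-spec T σ τ)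

pairTotal : ℕ → ℕ
pairTotal n = ∑ n (λ b → ∑ (pred n) (λ a → slotCost n a b))

totalCost : ℕ → ℕ
totalCost zero          = 0
totalCost (suc zero)    = 2
totalCost (suc (suc k)) = suc (suc k) * 2 * (pred (suc (suc k) * 2) * totalCost (suc k))
                        + (suc k * 2) ! * pairTotal (suc (suc k) * 2)

sorts : ∀ k → Sorts ([1,2]Insertion (suc k))
sorts zero (x ∷ y ∷ []) ((x<y ∷ []) ∷ _) =
  cong (λ b → if b then x ∷ y ∷ [] else y ∷ x ∷ []) (<ᵇ-true x<y) ∷
  cong (λ b → if b then y ∷ x ∷ [] else x ∷ y ∷ []) (<ᵇ-false (<⇒≤ x<y)) ∷ []
sorts (suc k) = InsertTwo.sorts⁺ ([1,2]Insertion (suc k)) ([1,2]Insertion (suc (suc k)))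
  (insertTwo (suc (suc k) * 2)) (slotCost (suc (suc k) * 2)) (insertion-unfold k) (insertTwo-correct k) (sorts k)

totalCost-bound : ∀ k → CostAtMost (totalCost (suc k)) ([1,2]Insertion (suc k))
totalCost-bound zero    (x ∷ y ∷ []) _ = ≤-refl
totalCost-bound (suc k) = InsertTwo.costAtMost⁺ ([1,2]Insertion (suc k)) ([1,2]Insertion (suc (suc k)))
  (insertTwo (suc (suc k) * 2)) (slotCost (suc (suc k) * 2)) (insertion-unfold k) (insertTwo-correct k)
  (sorts k) (totalCost-bound k)

-- Total cost of inserting a pair

∑-head : ∀ n f → ∑ (suc n) f ≡ f 0 + ∑ n (f ∘ suc)
∑-head zero    f = +-comm 0 (f 0)
∑-head (suc n) f = trans (cong (_+ f (suc n)) (∑-head n f)) (+-assoc (f 0) _ _)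

m∸1+n≡[m∸1]∸n : ∀ m n → m ∸ suc n ≡ pred m ∸ n
m∸1+n≡[m∸1]∸n zero    n = sym (0∸n≡0 n)
m∸1+n≡[m∸1]∸n (suc m) n = refl

-- The positions (a , b) of the two new elements, unordered, against the number
-- suc m of slots available to the larger one and the slot s it goes to.
∑-ordered : ∀ N (γ : ℕ → ℕ → ℕ) →
  ∑ (suc N) (λ b → ∑ N (λ a → if a <ᵇ b then γ (N ∸ a) (pred b ∸ a) else γ (N ∸ b) (a ∸ b))) ≡
  2 * ∑ N (λ m → ∑ (suc m) (γ (suc m)))
∑-ordered zero    γ = refl
∑-ordered (suc N) γ = begin
  ∑ (suc (suc N)) (λ b → ∑ (suc N) (G b))
    ≡⟨ ∑-head (suc N) (λ b → ∑ (suc N) (G b)) ⟩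
  ∑ (suc N) (γ (suc N)) + ∑ (suc N) (λ b → ∑ (suc N) (G (suc b)))
    ≡⟨ cong (∑ (suc N) (γ (suc N)) +_) (∑-cong (suc N) (λ b _ → ∑-head N (G (suc b)))) ⟩
  ∑ (suc N) (γ (suc N)) + ∑ (suc N) (λ b → γ (suc N) b + ∑ N (λ a → G (suc b) (suc a)))
    ≡⟨ cong (∑ (suc N) (γ (suc N)) +_) (∑-distrib-+ (suc N) (γ (suc N)) _) ⟩
  ∑ (suc N) (γ (suc N)) + (∑ (suc N) (γ (suc N)) + ∑ (suc N) (λ b → ∑ N (λ a → G (suc b) (suc a))))
    ≡⟨ cong (λ x → ∑ (suc N) (γ (suc N)) + (∑ (suc N) (γ (suc N)) + x))
         (trans (∑-cong (suc N) (λ b _ → ∑-cong N (λ a _ →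
           cong (λ s → if a <ᵇ b then γ (N ∸ a) s else γ (N ∸ b) (a ∸ b)) (m∸1+n≡[m∸1]∸n b a)))) (∑-ordered N γ)) ⟩
  ∑ (suc N) (γ (suc N)) + (∑ (suc N) (γ (suc N)) + 2 * ∑ N (λ m → ∑ (suc m) (γ (suc m))))
    ≡⟨ regroup (∑ (suc N) (γ (suc N))) (∑ N (λ m → ∑ (suc m) (γ (suc m)))) ⟩
  2 * ∑ (suc N) (λ m → ∑ (suc m) (γ (suc m))) ∎
  where
  open ≡-Reasoning
  G : ℕ → ℕ → ℕ
  G b a = if a <ᵇ b then γ (suc N ∸ a) (pred b ∸ a) else γ (suc N ∸ b) (a ∸ b)
  regroup : ∀ x y → x + (x + 2 * y) ≡ 2 * (y + x)
  regroup = solve-∀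

singleTotal mergeTotal : ℕ → ℕ
singleTotal n = ∑ n (λ b → ∑ (pred n) (λ a → dep (pred n) a + dep n b))
mergeTotal n = ∑ n (λ b → ∑ (pred n) (λ a → suc (orderedCost n a b)))

pairTotal-if : ∀ n → pairTotal n ≡ (if merges n then mergeTotal n else singleTotal n)
pairTotal-if n = trans (∑-cong n (λ b _ → ∑-cong (pred n) (λ a _ → slotCost-≡ n a b))) (split (merges n))
  where
  split : ∀ c → ∑ n (λ b → ∑ (pred n) (λ a → if c then suc (orderedCost n a b) else dep (pred n) a + dep n b)) ≡
                (if c then mergeTotal n else singleTotal n)
  split true  = refl
  split false = refl

mergeTotal-≡ : ∀ N → let n = suc N in mergeTotal n ≡
  n * N + 2 * (searchSum ⌊log₂ n ^ 2 ⌋ n ⌊ n /√2^ 1 ⌋ + ∑ n (λ m → ∑ m (dep m)))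
mergeTotal-≡ N = begin
  ∑ n (λ b → ∑ N (λ a → suc (orderedCost n a b)))
    ≡⟨ ∑-cong n (λ b _ → trans (∑-distrib-+ N (λ _ → 1) (λ a → orderedCost n a b))
         (cong (_+ ∑ N (λ a → orderedCost n a b)) (trans (∑-const N 1) (*-identityʳ N)))) ⟩
  ∑ n (λ b → N + ∑ N (λ a → orderedCost n a b))
    ≡⟨ trans (∑-distrib-+ n (λ _ → N) _) (cong₂ _+_ (∑-const n N) (∑-ordered N γ)) ⟩
  n * N + 2 * ∑ N (λ m → ∑ (suc m) (γ (suc m)))
    ≡⟨ cong (λ x → n * N + 2 * x) (trans (∑-cong N (λ m _ → trans (∑-distrib-+ (suc m) (λ _ → c (suc m)) (dep (suc m)))
         (cong (_+ ∑ (suc m) (dep (suc m))) (∑-const (suc m) (c (suc m))))))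
         (∑-distrib-+ N (λ m → suc m * c (suc m)) (λ m → ∑ (suc m) (dep (suc m))))) ⟩
  n * N + 2 * (∑ N (λ m → suc m * c (suc m)) + ∑ N (λ m → ∑ (suc m) (dep (suc m))))
    ≡⟨ cong₂ (λ x y → n * N + 2 * (x + y)) (∑-head N (λ m → m * c m)) (∑-head N (λ m → ∑ m (dep m))) ⟨
  n * N + 2 * (∑ n (λ m → m * c m) + ∑ n (λ m → ∑ m (dep m))) ∎
  where
  open ≡-Reasoning
  n : ℕ
  n = suc N
  c : ℕ → ℕ
  c = searchCost ⌊log₂ n ^ 2 ⌋ n ⌊ n /√2^ 1 ⌋
  γ : ℕ → ℕ → ℕ
  γ m s = c m + dep m s

-- Within one scale `∑-dep-bound` is added up term by term. The last summand, about 4^K, is the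
-- geometric series of the earlier scales: with it the bounds for K and K + 1 differ by nothing at i
-- = 2^K, where one hands over to the other.
∑-∑-dep : ∀ K i → 2 ^ K ≤ 2 * i → i ≤ 2 ^ K →
  6 * ∑ i (λ m → ∑ m (dep m)) + 6 * (2 ^ K * i) ≤ 6 * (suc K * tri i) + (2 ^ K + 1) * (2 ^ K + 2)
∑-∑-dep zero    (suc zero)    lo hi = ≤-refl
∑-∑-dep zero    (suc (suc i)) lo (s≤s ())
∑-∑-dep (suc K) i lo hi = subst P split (go (i ∸ 2 ^ K) (≤-trans (≤-reflexive split) hi))
  where
  2^K≤i : 2 ^ K ≤ i
  2^K≤i = *-cancelˡ-≤ 2 lo
  split : 2 ^ K + (i ∸ 2 ^ K) ≡ i
  split = m+[n∸m]≡n 2^K≤i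
  P : ℕ → Set
  P i = 6 * ∑ i (λ m → ∑ m (dep m)) + 6 * (2 ^ suc K * i) ≤
        6 * (suc (suc K) * tri i) + (2 ^ suc K + 1) * (2 ^ suc K + 2)
  go : ∀ t → 2 ^ K + t ≤ 2 ^ suc K → P (2 ^ K + t)
  go zero    _  = subst P (sym (+-identityʳ (2 ^ K)))
    (linear _ _ 0 (+-mono-≤ (∑-∑-dep K (2 ^ K) (m≤m+n (2 ^ K) _) ≤-refl) (≤-reflexive (cong (3 *_) (sym (2*tri (2 ^ K))))))
      (balance (2 ^ K) K (∑ (2 ^ K) (λ m → ∑ m (dep m))) (tri (2 ^ K))))
    where
    balance : ∀ p K s t → 6 * (suc (suc K) * t) + (2 * p + 1) * (2 * p + 2) + (6 * s + 6 * (p * p) + 3 * (p * p)) ≡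
      6 * s + 6 * (2 * p * p) + (6 * (suc K * t) + (p + 1) * (p + 2) + 3 * (2 * t + p)) + 0
    balance = solve-∀
  go (suc t) le = subst P (sym (+-suc (2 ^ K) t))
    (linear _ _ 0 (+-mono-≤ (go t (≤-trans (+-monoʳ-≤ (2 ^ K) (n≤1+n t)) le))
      (*-monoʳ-≤ 6 (∑-dep-bound (suc K) (2 ^ K + t) (≤-trans (+-monoʳ-≤ (2 ^ K) (n≤1+n t)) le) (*-monoʳ-≤ 2 (m≤m+n (2 ^ K) t)))))
      (balance (2 ^ suc K) K (2 ^ K + t) (∑ (2 ^ K + t) (λ m → ∑ m (dep m))) (tri (2 ^ K + t))
        (∑ (2 ^ K + t) (dep (2 ^ K + t)))))
    where
    balance : ∀ p K i s t d → 6 * (suc (suc K) * (t + i)) + (p + 1) * (p + 2)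
      + (6 * s + 6 * (p * i) + 6 * (d + p)) ≡
      6 * (s + d) + 6 * (p * suc i) + (6 * (suc (suc K) * t) + (p + 1) * (p + 2) + 6 * (suc (suc K) * i)) + 0
    balance = solve-∀

-- `∑-dep-bound` for N and for N + 1 slots saves (2 N + 1) 2^K in total; the 2^K on the right rounds
-- this to 2 (N + 1) 2^K.
singleTotal-bound : ∀ K N → 2 ^ K ≤ 2 * N → suc N ≤ 2 ^ K →
  singleTotal (suc N) + 2 * (suc N * 2 ^ K) ≤ (2 * K + 2) * (suc N * N) + 2 ^ K
singleTotal-bound K N lo hi = linear _ _ 0
  (+-mono-≤ (≤-reflexive value)
    (+-mono-≤ (*-monoʳ-≤ n (∑-dep-bound K N (≤-trans (n≤1+n N) hi) lo))
      (*-monoʳ-≤ N (∑-dep-bound K n hi (≤-trans lo (*-monoʳ-≤ 2 (n≤1+n N)))))))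
  (balance (singleTotal n) (∑ N (dep N)) (∑ n (dep n)) N K (2 ^ K))
  where
  n : ℕ
  n = suc N
  value : singleTotal n ≡ n * ∑ N (dep N) + N * ∑ n (dep n)
  value = trans (∑-cong n (λ b _ → trans (∑-distrib-+ N (dep N) (λ _ → dep n b)) (cong (∑ N (dep N) +_) (∑-const N (dep n b)))))
    (trans (∑-distrib-+ n (λ _ → ∑ N (dep N)) (λ b → N * dep n b))
      (cong₂ _+_ (∑-const n (∑ N (dep N))) (sym (*-distribˡ-∑ N n (dep n)))))
  balance : ∀ s x y N K p → (2 * K + 2) * (suc N * N) + p + (s + (suc N * (x + p) + N * (y + p))) ≡
    s + 2 * (suc N * p) + (suc N * x + N * y + (suc N * (suc K * N) + N * (suc K * suc N))) + 0
  balance = solve-∀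

-- Widths of the first two blocks

module _ (i : ℕ) (i≥1 : 1 ≤ i) where
  private
    h : ℕ
    h = ⌊ i /√2^ 1 ⌋

  2h²≤i² : 2 * (h * h) ≤ i * i
  2h²≤i² = ≤-trans (≤-reflexive (shape h)) (≤-trans (root-lower i 1) (≤-reflexive (cong (i *_) (*-identityʳ i))))
    where
    shape : ∀ h → 2 * (h * h) ≡ h * (h * 1) * 2
    shape = solve-∀

  i²<2[h+1]² : i * i < 2 * (suc h * suc h)
  i²<2[h+1]² = ≰⇒> λ le → <⇒≱ (n<1+n h) (root-greatest i 1 {suc h}
    (≤-trans (≤-reflexive (shape (suc h))) (≤-trans le (≤-reflexive (cong (i *_) (sym (*-identityʳ i)))))))
    where
    shape : ∀ h → h * (h * 1) * 2 ≡ 2 * (h * h)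
    shape = solve-∀

  -- For r / x ≤ 1/√2 this is r i / x ≤ i/√2 < h + 1, proved by squaring; `root-≤` is the opposite
  -- estimate.
  root-≥ : ∀ r x → 2 * (r * r) ≤ x * x → r * i ≤ x * suc h
  root-≥ r x 2r²≤x² = ≮⇒≥ λ lt → <-irrefl refl (begin-strict
    2 * ((x * suc h) * (x * suc h))   <⟨ *-monoʳ-< 2 (*-mono-< lt lt) ⟩
    2 * ((r * i) * (r * i))           ≡⟨ regroup r i ⟩
    2 * (r * r) * (i * i)             ≤⟨ *-mono-≤ 2r²≤x² (<⇒≤ i²<2[h+1]²) ⟩
    x * x * (2 * (suc h * suc h))     ≡⟨ regroup′ x (suc h) ⟩
    2 * ((x * suc h) * (x * suc h))   ∎)
    where
    open ≤-Reasoning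
    regroup : ∀ r i → 2 * ((r * i) * (r * i)) ≡ 2 * (r * r) * (i * i)
    regroup = solve-∀
    regroup′ : ∀ x h → x * x * (2 * (h * h)) ≡ 2 * ((x * h) * (x * h))
    regroup′ = solve-∀

  root-≤ : ∀ r x → x * x ≤ 2 * (r * r) → x * h ≤ r * i
  root-≤ r x x²≤2r² = ≮⇒≥ λ lt → <-irrefl refl (begin-strict
    x * x * (i * i)               ≤⟨ *-monoˡ-≤ (i * i) x²≤2r² ⟩
    2 * (r * r) * (i * i)         ≡⟨ regroup r i ⟩
    2 * ((r * i) * (r * i))       <⟨ *-monoʳ-< 2 (*-mono-< lt lt) ⟩
    2 * ((x * h) * (x * h))       ≡⟨ regroup′ x h ⟩
    x * x * (2 * (h * h))         ≤⟨ *-monoʳ-≤ (x * x) 2h²≤i² ⟩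
    x * x * (i * i)               ∎)
    where
    open ≤-Reasoning
    regroup : ∀ r i → 2 * (r * r) * (i * i) ≡ 2 * ((r * i) * (r * i))
    regroup = solve-∀
    regroup′ : ∀ x h → 2 * ((x * h) * (x * h)) ≡ x * x * (2 * (h * h))
    regroup′ = solve-∀

  -- 0.5511 ≤ i / (16 u) ≤ 0.888
  module Widths (u : ℕ) (u≥10 : 10 ≤ u) (lo : 88176 * u ≤ 10000 * i) (hi : 1000 * i ≤ 14208 * u) where
    private
      b : ℕ
      b = ⌊ i /2⌋
      -- 0.7071 < 1/√2 < 0.7072 is precise enough to separate the widths.
      h≤ : 10000 * h ≤ 7072 * i
      h≤ = root-≤ 7072 10000 (≤ᵇ⇒≤ (10000 * 10000) (2 * (7072 * 7072)) tt)
      h≥ : 7071 * i ≤ 10000 * suc h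
      h≥ = root-≥ 7071 10000 (≤ᵇ⇒≤ (2 * (7071 * 7071)) (10000 * 10000) tt)
      u≥1 : 1 ≤ u
      u≥1 = ≤-trans (s≤s z≤n) u≥10

    h+2u≤i : h + 2 * u ≤ i
    h+2u≤i = *-cancelˡ-≤ 40000 (linear _ _ (1712 * i + 8176 * u) (+-mono-≤ (*-monoʳ-≤ 4 h≤) lo) (balance h i u))
      where
      balance : ∀ h i u → 40000 * i + (4 * (10000 * h) + 88176 * u) ≡
        40000 * (h + 2 * u) + (4 * (7072 * i) + 10000 * i) + (1712 * i + 8176 * u)
      balance = solve-∀

    b+u≤h : b + u ≤ h
    b+u≤h = *-cancelˡ-≤ 100000 (linear _ _ (710 * i + 26352 * u)
      (+-mono-≤ (*-monoʳ-≤ 50000 (2*⌊n/2⌋≤n i)) (+-mono-≤ (*-monoʳ-≤ 10 h≥)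
        (+-mono-≤ (*-monoʳ-≤ 2 lo) (*-monoʳ-≤ 50000 (≤-trans (s≤s (s≤s z≤n)) u≥10))))) (balance b h i u))
      where
      balance : ∀ b h i u → 100000 * h + (50000 * (2 * b) + (10 * (7071 * i) + (2 * (88176 * u) + 50000 * 2))) ≡
        100000 * (b + u) + (50000 * i + (10 * (10000 * suc h) + (2 * (10000 * i) + 50000 * u))) + (710 * i + 26352 * u)
      balance = solve-∀

    i≤h+8u : i ≤ h + 8 * u
    i≤h+8u = *-cancelˡ-≤ 10000 (linear _ _ (71 * i + 27376 * u)
      (+-mono-≤ h≥ (+-mono-≤ (*-monoʳ-≤ 3 hi) (*-monoʳ-≤ 10000 u≥1))) (balance h i u))
      where
      balance : ∀ h i u → 10000 * (h + 8 * u) + (7071 * i + (3 * (1000 * i) + 10000 * 1)) ≡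
        10000 * i + (10000 * suc h + (3 * (14208 * u) + 10000 * u)) + (71 * i + 27376 * u)
      balance = solve-∀

    h≤b+4u : h ≤ b + 4 * u
    h≤b+4u = *-cancelˡ-≤ 100000 (linear _ _ (280 * i + 51632 * u)
      (+-mono-≤ (*-monoʳ-≤ 10 h≤) (+-mono-≤ (*-monoʳ-≤ 50000 (n≤1+2*⌊n/2⌋ i))
        (+-mono-≤ (*-monoʳ-≤ 21 hi) (*-monoʳ-≤ 50000 u≥1)))) (balance b h i u))
      where
      balance : ∀ b h i u → 100000 * (b + 4 * u) + (10 * (10000 * h) + (50000 * i + (21 * (1000 * i) + 50000 * 1))) ≡
        100000 * h + (10 * (7072 * i) + (50000 * (1 + 2 * b) + (21 * (14208 * u) + 50000 * u))) + (280 * i + 51632 * u)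
      balance = solve-∀

    2i≤3h : 2 * i ≤ 3 * h
    2i≤3h = *-cancelˡ-≤ 10000 (linear _ _ (13 * i) (+-mono-≤ (*-monoʳ-≤ 3 h≥) (*-monoʳ-≤ 1200 25≤i)) (balance h i))
      where
      25≤i : 25 ≤ i
      25≤i = *-cancelˡ-≤ 10000 (≤-trans (≤ᵇ⇒≤ (10000 * 25) (88176 * 10) tt) (≤-trans (*-monoʳ-≤ 88176 u≥10) lo))
      balance : ∀ h i → 10000 * (3 * h) + (3 * (7071 * i) + 1200 * 25) ≡
        10000 * (2 * i) + (3 * (10000 * suc h) + 1200 * i) + 13 * i
      balance = solve-∀

-- The three shapes of the bound for 2Merge

-- The cost of inserting two elements is compared with 2 K + α - β / y + γ / y²,
-- where y = i / 2^K.
PairBound : (D B α β γ K i : ℕ) → Set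
PairBound D B α β γ K i = D * pairTotal i + β * (i * 2 ^ K) ≤
  D * (2 * K * (i * pred i)) + α * (i * i) + γ * (2 ^ K * 2 ^ K) + B * i

-- The terms in t fit exactly: the comparison of A with B, the search for A and Step 4 contribute 1
-- + (k + 1) + (K + 1) = 2 K for K = k + 3. Of the terms in h, 64 h² is bounded above by 32 i² at
-- once, while 96 i h is kept for a lower estimate of h.
combine-narrow : ∀ i h q k t S E c →
  24 * S + (96 * (i * h) + 112 * (i * q)) ≤ 24 * (suc k * t) + (68 * (i * i) + 64 * (h * h) + 80 * (q * q) + 288 * i) + c →
  6 * E + 6 * (8 * q * i) ≤ 6 * (suc (k + 3) * t) + (8 * q + 1) * (8 * q + 2) →
  2 * (h * h) ≤ i * i → 8 * q ≤ 2 * i → 1 ≤ i →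
  12 * (2 * t + 2 * (S + E)) + 38 * (i * (8 * q)) + 96 * (i * h) ≤
  12 * (2 * (k + 3) * (2 * t)) + 100 * (i * i) + 336 * (q * q) + (c + 320) * i
combine-narrow i h q k t S E c H₁ H₂ H₃ H₄ H₅ = linear _ _ 0
  (+-mono-≤ H₁ (+-mono-≤ (*-monoʳ-≤ 4 H₂) (+-mono-≤ (*-monoʳ-≤ 32 H₃)
    (+-mono-≤ (*-monoʳ-≤ 12 H₄) (*-monoʳ-≤ (c + 8) H₅)))))
  (balance i h q k t S E c)
  where
  balance : ∀ i h q k t S E c →
    12 * (2 * (k + 3) * (2 * t)) + 100 * (i * i) + 336 * (q * q) + (c + 320) * i +
    (24 * S + (96 * (i * h) + 112 * (i * q)) + (4 * (6 * E + 6 * (8 * q * i)) + (32 * (2 * (h * h))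
    + (12 * (8 * q) + (c + 8) * 1))))
    ≡ 12 * (2 * t + 2 * (S + E)) + 38 * (i * (8 * q)) + 96 * (i * h) +
    (24 * (suc k * t) + (68 * (i * i) + 64 * (h * h) + 80 * (q * q) + 288 * i) + c
    + (4 * (6 * (suc (k + 3) * t) + (8 * q + 1) * (8 * q + 2)) + (32 * (i * i)
    + (12 * (2 * i) + (c + 8) * i)))) + 0
  balance = solve-∀

-- For K = k + 2 the count 1 + (k + 1) + (K + 1) is 2 K + 1. The surplus 24 t ≤ 12 i² raises the
-- coefficient 68 + 32 of i² to 112.
combine-wide : ∀ i h q k t S E c →
  24 * S + (96 * (i * h) + 112 * (i * q)) ≤ 24 * (suc k * t) + (68 * (i * i) + 64 * (h * h) + 80 * (q * q) + 288 * i) + c →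
  6 * E + 6 * (4 * q * i) ≤ 6 * (suc (k + 2) * t) + (4 * q + 1) * (4 * q + 2) →
  2 * (h * h) ≤ i * i → 4 * q ≤ 2 * i → 1 ≤ i → 2 * t ≤ i * i →
  12 * (2 * t + 2 * (S + E)) + 52 * (i * (4 * q)) + 96 * (i * h) ≤
  12 * (2 * (k + 2) * (2 * t)) + 112 * (i * i) + 144 * (q * q) + (c + 320) * i
combine-wide i h q k t S E c H₁ H₂ H₃ H₄ H₅ H₆ = linear _ _ 0
  (+-mono-≤ H₁ (+-mono-≤ (*-monoʳ-≤ 4 H₂) (+-mono-≤ (*-monoʳ-≤ 32 H₃)
    (+-mono-≤ (*-monoʳ-≤ 12 H₄) (+-mono-≤ (*-monoʳ-≤ (c + 8) H₅) (*-monoʳ-≤ 12 H₆))))))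
  (balance i h q k t S E c)
  where
  balance : ∀ i h q k t S E c →
    12 * (2 * (k + 2) * (2 * t)) + 112 * (i * i) + 144 * (q * q) + (c + 320) * i +
    (24 * S + (96 * (i * h) + 112 * (i * q)) + (4 * (6 * E + 6 * (4 * q * i)) + (32 * (2 * (h * h))
    + (12 * (4 * q) + ((c + 8) * 1 + 12 * (2 * t))))))
    ≡ 12 * (2 * t + 2 * (S + E)) + 52 * (i * (4 * q)) + 96 * (i * h) +
    (24 * (suc k * t) + (68 * (i * i) + 64 * (h * h) + 80 * (q * q) + 288 * i) + c
    + (4 * (6 * (suc (k + 2) * t) + (4 * q + 1) * (4 * q + 2)) + (32 * (i * i)
    + (12 * (2 * i) + ((c + 8) * i + 12 * (i * i)))))) + 0
  balance = solve-∀

-- The search contributes k instead of k + 1, so for K = k + 2 the count is 2 K again. Beside 96 i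
-- h, the product 32 h q awaits a lower estimate of h.
combine-mixed : ∀ i h q k t S E c →
  24 * S + (96 * (i * h) + 48 * (i * q) + 32 * (h * q)) ≤ 24 * (k * t) + (64 * (i * i) + 80 * (h * h) + 32 * (q * q) + 288 * i) + c →
  6 * E + 6 * (4 * q * i) ≤ 6 * (suc (k + 2) * t) + (4 * q + 1) * (4 * q + 2) →
  2 * (h * h) ≤ i * i → 4 * q ≤ 2 * i → 1 ≤ i →
  12 * (2 * t + 2 * (S + E)) + 36 * (i * (4 * q)) + (96 * i + 32 * q) * h ≤
  12 * (2 * (k + 2) * (2 * t)) + 104 * (i * i) + 96 * (q * q) + (c + 320) * i
combine-mixed i h q k t S E c H₁ H₂ H₃ H₄ H₅ = linear _ _ 0
  (+-mono-≤ H₁ (+-mono-≤ (*-monoʳ-≤ 4 H₂) (+-mono-≤ (*-monoʳ-≤ 40 H₃)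
    (+-mono-≤ (*-monoʳ-≤ 12 H₄) (*-monoʳ-≤ (c + 8) H₅)))))
  (balance i h q k t S E c)
  where
  balance : ∀ i h q k t S E c →
    12 * (2 * (k + 2) * (2 * t)) + 104 * (i * i) + 96 * (q * q) + (c + 320) * i +
    (24 * S + (96 * (i * h) + 48 * (i * q) + 32 * (h * q)) + (4 * (6 * E + 6 * (4 * q * i)) + (40 * (2 * (h * h))
    + (12 * (4 * q) + (c + 8) * 1))))
    ≡ 12 * (2 * t + 2 * (S + E)) + 36 * (i * (4 * q)) + (96 * i + 32 * q) * h +
    (24 * (k * t) + (64 * (i * i) + 80 * (h * h) + 32 * (q * q) + 288 * i) + c
    + (4 * (6 * (suc (k + 2) * t) + (4 * q + 1) * (4 * q + 2)) + (40 * (i * i)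
    + (12 * (2 * i) + (c + 8) * i)))) + 0
  balance = solve-∀

-- After multiplication by X, the product w h can be replaced through h ≥ r i / X - 1; w X is the
-- price of rounding h down.
scale-root : ∀ X r i h w {x y} → x + w * h ≤ y → r * i ≤ X * suc h → X * x + w * (r * i) ≤ X * y + w * X
scale-root X r i h w {x} {y} le ri≤ = linear _ _ 0 (+-mono-≤ (*-monoʳ-≤ X le) (*-monoʳ-≤ w ri≤)) (balance X (r * i) h w x y)
  where
  balance : ∀ X ri h w x y → X * y + w * X + (X * (x + w * h) + w * ri) ≡ X * x + w * ri + (X * y + w * (X * suc h)) + 0
  balance = solve-∀

scale-form : ∀ X r i h T z M Q β α γ {e e′} → e + 96 ≡ e′ → 12 * T + β * z + 96 * (i * h) ≤ 12 * M + α * (i * i) + γ * Q + e * i →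
  r * i ≤ X * suc h →
  12 * X * T + β * X * z + 96 * r * (i * i) ≤ 12 * X * M + α * X * (i * i) + γ * X * Q + e′ * X * i
scale-form X r i h T z M Q β α γ {e} refl le ri≤ = subst₂ _≤_ (left X r i T z β) (right X i M Q α γ e)
  (scale-root X r i h (96 * i) (≤-trans (≤-reflexive (cong (12 * T + β * z +_) (*-assoc 96 i h))) le) ri≤)
  where
  left : ∀ X r i T z β → X * (12 * T + β * z) + 96 * i * (r * i) ≡ 12 * X * T + β * X * z + 96 * r * (i * i)
  left = solve-∀
  right : ∀ X i M Q α γ e → X * (12 * M + α * (i * i) + γ * Q + e * i) + 96 * i * X ≡
    12 * X * M + α * X * (i * i) + γ * X * Q + (e + 96) * X * i
  right = solve-∀

scale-mixed : ∀ X r i h q T M c → 4 * q ≤ 2 * i →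
  12 * T + 36 * (i * (4 * q)) + (96 * i + 32 * q) * h ≤ 12 * M + 104 * (i * i) + 96 * (q * q) + (c + 320) * i →
  r * i ≤ X * suc h →
  12 * X * T + (36 * X + 8 * r) * (i * (4 * q)) + 96 * r * (i * i) ≤
  12 * X * M + 104 * X * (i * i) + 96 * X * (q * q) + (c + 432) * X * i
scale-mixed X r i h q T M c 4q≤2i le ri≤ = linear _ _ 0
  (+-mono-≤ (scale-root X r i h (96 * i + 32 * q) le ri≤) (*-monoʳ-≤ (8 * X) 4q≤2i)) (balance X r i q T M c)
  where
  balance : ∀ X r i q T M c → 12 * X * M + 104 * X * (i * i) + 96 * X * (q * q) + (c + 432) * X * i +
    (X * (12 * T + 36 * (i * (4 * q))) + (96 * i + 32 * q) * (r * i) + 8 * X * (4 * q)) ≡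
    12 * X * T + (36 * X + 8 * r) * (i * (4 * q)) + 96 * r * (i * i) +
    (X * (12 * M + 104 * (i * i) + 96 * (q * q) + (c + 320) * i) + (96 * i + 32 * q) * X + 8 * X * (2 * i)) + 0
  balance = solve-∀

2*tri-suc : ∀ N → 2 * tri (suc N) ≡ suc N * N
2*tri-suc N = +-cancelʳ-≡ (suc N) _ _ (trans (2*tri (suc N)) (shape N))
  where
  shape : ∀ N → suc N * suc N ≡ suc N * N + suc N
  shape = solve-∀

2*tri-pred : ∀ n → 2 * tri n ≡ n * pred n
2*tri-pred zero    = refl
2*tri-pred (suc N) = 2*tri-suc N

mergeTotal-tri : ∀ n → 1 ≤ n → mergeTotal n ≡
  2 * tri n + 2 * (searchSum ⌊log₂ n ^ 2 ⌋ n ⌊ n /√2^ 1 ⌋ + ∑ n (λ m → ∑ m (dep m)))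
mergeTotal-tri (suc N) _ = trans (mergeTotal-≡ N)
  (cong (_+ 2 * (searchSum ⌊log₂ n ^ 2 ⌋ n ⌊ n /√2^ 1 ⌋ + ∑ n (λ m → ∑ m (dep m)))) (sym (2*tri-pred n)))
  where
  n : ℕ
  n = suc N

drop-common : ∀ l e R g B α β c x → α + β ≡ c → l + e + β * x ≤ R + c * x + g + B → l + e ≤ R + α * x + g + B
drop-common l e R g B α β c x refl le = linear _ _ 0 le (balance l e R g B α β x)
  where
  balance : ∀ l e R g B α β x → R + α * x + g + B + (l + e + β * x) ≡ l + e + (R + (α + β) * x + g + B) + 0
  balance = solve-∀

-- Scaled by X, the term 96 i h becomes 96 r i² up to first order, which is subtracted from 100 X,
-- 104 X or 112 X. In the mixed shape 32 h q adds 8 r i 2^K because q = 2^K / 4. The coefficients of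
-- 4^K are 336 / 64, 96 / 16 and 144 / 16 times X, as q is 2^K / 8 in the narrow shape and 2^K / 4
-- in the others.
module MergeBound (X r αₙ αₘ αₗ γₙ : ℕ) (2r²≤X² : 2 * (r * r) ≤ X * X)
  (αₙ≡ : αₙ + 96 * r ≡ 100 * X) (αₗ≡ : αₗ + 96 * r ≡ 112 * X) (αₘ≡ : αₘ + 96 * r ≡ 104 * X)
  (γₙ≡ : 64 * γₙ ≡ 336 * X) where

  D B : ℕ
  D = 12 * X
  B = (base-cost + 432) * X

  Narrow Mixed Wide : ℕ → ℕ → Set
  Narrow = PairBound D B αₙ (38 * X) γₙ
  Mixed  = PairBound D B αₘ (36 * X + 8 * r) (6 * X)
  Wide   = PairBound D B αₗ (52 * X) (9 * X)

  module _ (j i : ℕ) (i≥1 : 1 ≤ i) (u≥10 : 10 ≤ 2 ^ j) (lo : 88176 * 2 ^ j ≤ 10000 * i) (hi : 1000 * i ≤ 14208 * 2 ^ j)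
    (merge : merges i ≡ true) where
    private
      N h b u t S E K P : ℕ
      N = pred i
      h = ⌊ i /√2^ 1 ⌋
      b = ⌊ i /2⌋
      u = 2 ^ j
      t = tri i
      S = searchSum ⌊log₂ i ^ 2 ⌋ i h
      E = ∑ i (λ m → ∑ m (dep m))
      K = 4 + j
      P = 2 ^ K
      open Widths i i≥1 u u≥10 lo hi

      pairTotal-≡ : pairTotal i ≡ 2 * t + 2 * (S + E)
      pairTotal-≡ = trans (pairTotal-if i) (trans (cong (λ c → if c then mergeTotal i else singleTotal i) merge)
        (mergeTotal-tri i i≥1))

      P≡16u : P ≡ 16 * u
      P≡16u = shape u
        where
        shape : ∀ u → 2 * (2 * (2 * (2 * u))) ≡ 16 * u
        shape = solve-∀

      P≤2i : P ≤ 2 * i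
      P≤2i = ≤-trans (≤-reflexive P≡16u) (*-cancelˡ-≤ 10000 (linear _ _ (16352 * u) (*-monoʳ-≤ 2 lo) (balance u i)))
        where
        balance : ∀ u i → 10000 * (2 * i) + 2 * (88176 * u) ≡ 10000 * (16 * u) + 2 * (10000 * i) + 16352 * u
        balance = solve-∀

      i≤P : i ≤ P
      i≤P = ≤-trans (*-cancelˡ-≤ 1000 (linear _ _ (1792 * u) hi (balance u i))) (≤-reflexive (sym P≡16u))
        where
        balance : ∀ u i → 1000 * (16 * u) + 1000 * i ≡ 1000 * i + 14208 * u + 1792 * u
        balance = solve-∀

      inner : 6 * E + 6 * (P * i) ≤ 6 * (suc K * t) + (P + 1) * (P + 2)
      inner = ∑-∑-dep K i P≤2i i≤P

      2h² = 2h²≤i² i i≥1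
      ri≤ = root-≥ i i≥1 r X 2r²≤X²

      2t≤i² : 2 * t ≤ i * i
      2t≤i² = ≤-trans (m≤m+n (2 * t) i) (≤-reflexive (2*tri i))

    narrow : i ≤ h + 4 * u → h ≤ b + 2 * u → Narrow K i
    narrow u₁ u₂ = begin
      D * pairTotal i + 38 * X * (i * P)
        ≡⟨ cong₂ (λ T p → D * T + 38 * X * (i * p)) pairTotal-≡ P≡8q ⟩
      D * (2 * t + 2 * (S + E)) + 38 * X * (i * (8 * q))
        ≤⟨ drop-common (D * (2 * t + 2 * (S + E))) (38 * X * (i * (8 * q)))
             (D * (2 * (suc j + 3) * (2 * t))) (336 * X * (q * q)) ((base-cost + 416) * X * i) αₙ (96 * r) (100 * X) (i * i) αₙ≡ (scale-form X r i h (2 * t + 2 * (S + E)) (i * (8 * q)) (2 * (suc j + 3) * (2 * t)) (q * q) 38 100 336 (+-assoc base-cost 320 96)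
             (combine-narrow i h q (suc j) t S E base-cost
             (Equal.searchSum-bound _ (suc j) i h (≤-trans u₁ (≤-reflexive (cong (h +_) (shape₄ u)))) u₂ (h+2u≤i , b+u≤h))
             (subst₂ (λ p k → 6 * E + 6 * (p * i) ≤ 6 * (suc k * t) + (p + 1) * (p + 2)) P≡8q K≡ inner)
             2h² (≤-trans (≤-reflexive (sym P≡8q)) P≤2i) i≥1) ri≤) ⟩
      D * (2 * (suc j + 3) * (2 * t)) + αₙ * (i * i) + 336 * X * (q * q) + (base-cost + 416) * X * i
        ≤⟨ +-mono-≤ (≤-reflexive (cong₂ (λ x y → x + αₙ * (i * i) + y)
             (cong₂ (λ k x → D * (2 * k * x)) (sym K≡) (2*tri-pred i)) γ-term))
             (*-monoˡ-≤ i (*-monoˡ-≤ X (+-monoʳ-≤ base-cost (≤ᵇ⇒≤ 416 432 tt)))) ⟩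
      D * (2 * K * (i * N)) + αₙ * (i * i) + γₙ * (P * P) + B * i ∎
      where
      open ≤-Reasoning
      q : ℕ
      q = 2 ^ suc j
      P≡8q : P ≡ 8 * q
      P≡8q = shape q
        where
        shape : ∀ q → 2 * (2 * (2 * q)) ≡ 8 * q
        shape = solve-∀
      K≡ : K ≡ suc j + 3
      K≡ = cong (1 +_) (+-comm 3 j)
      shape₄ : ∀ u → 4 * u ≡ 2 * (2 * u)
      shape₄ = solve-∀
      γ-term : 336 * X * (q * q) ≡ γₙ * (P * P)
      γ-term = trans (cong (_* (q * q)) (sym γₙ≡)) (trans (shape γₙ q) (cong (λ p → γₙ * (p * p)) (sym P≡8q)))
        where
        shape : ∀ γ q → 64 * γ * (q * q) ≡ γ * (8 * q * (8 * q))
        shape = solve-∀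

    private
      q : ℕ
      q = 2 ^ suc (suc j)
      P≡4q : P ≡ 4 * q
      P≡4q = shape q
        where
        shape : ∀ q → 2 * (2 * q) ≡ 4 * q
        shape = solve-∀
      K≡ : K ≡ suc (suc j) + 2
      K≡ = cong (2 +_) (+-comm 2 j)
      4u≡q : 4 * u ≡ q
      4u≡q = shape u
        where
        shape : ∀ u → 4 * u ≡ 2 * (2 * u)
        shape = solve-∀
      inner′ = subst₂ (λ p k → 6 * E + 6 * (p * i) ≤ 6 * (suc k * t) + (p + 1) * (p + 2)) P≡4q K≡ inner
      4q≤2i = ≤-trans (≤-reflexive (sym P≡4q)) P≤2i
      h≤b+q : h ≤ b + q
      h≤b+q = ≤-trans h≤b+4u (≤-reflexive (cong (b +_) 4u≡q))

    mixed : i ≤ h + 4 * u → b + 2 * u ≤ h → Mixed K i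
    mixed u₁ l₂ = begin
      D * pairTotal i + (36 * X + 8 * r) * (i * P)
        ≡⟨ cong₂ (λ T p → D * T + (36 * X + 8 * r) * (i * p)) pairTotal-≡ P≡4q ⟩
      D * (2 * t + 2 * (S + E)) + (36 * X + 8 * r) * (i * (4 * q))
        ≤⟨ drop-common (D * (2 * t + 2 * (S + E))) ((36 * X + 8 * r) * (i * (4 * q)))
             (D * (2 * (suc (suc j) + 2) * (2 * t))) (96 * X * (q * q)) (B * i) αₘ (96 * r) (104 * X) (i * i) αₘ≡ (scale-mixed X r i h q (2 * t + 2 * (S + E)) (2 * (suc (suc j) + 2) * (2 * t)) base-cost 4q≤2i
             (combine-mixed i h q (suc (suc j)) t S E base-cost
             (Less.searchSum-bound _ (suc (suc j)) i h (≤-trans u₁ (≤-reflexive (cong (h +_) 4u≡q))) h≤b+q (h+2u≤i , l₂))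
             inner′ 2h² 4q≤2i i≥1) ri≤) ⟩
      D * (2 * (suc (suc j) + 2) * (2 * t)) + αₘ * (i * i) + 96 * X * (q * q) + B * i
        ≡⟨ cong₂ (λ x y → x + αₘ * (i * i) + y + B * i)
             (cong₂ (λ k x → D * (2 * k * x)) (sym K≡) (2*tri-pred i))
             (trans (shape X q) (cong (λ p → 6 * X * (p * p)) (sym P≡4q))) ⟩
      D * (2 * K * (i * N)) + αₘ * (i * i) + 6 * X * (P * P) + B * i ∎
      where
      open ≤-Reasoning
      shape : ∀ X q → 96 * X * (q * q) ≡ 6 * X * (4 * q * (4 * q))
      shape = solve-∀

    wide : h + 4 * u ≤ i → Wide K i
    wide l₁ = begin
      D * pairTotal i + 52 * X * (i * P)
        ≡⟨ cong₂ (λ T p → D * T + 52 * X * (i * p)) pairTotal-≡ P≡4q ⟩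
      D * (2 * t + 2 * (S + E)) + 52 * X * (i * (4 * q))
        ≤⟨ drop-common (D * (2 * t + 2 * (S + E))) (52 * X * (i * (4 * q)))
             (D * (2 * (suc (suc j) + 2) * (2 * t))) (144 * X * (q * q)) ((base-cost + 416) * X * i) αₗ (96 * r) (112 * X) (i * i) αₗ≡ (scale-form X r i h (2 * t + 2 * (S + E)) (i * (4 * q)) (2 * (suc (suc j) + 2) * (2 * t)) (q * q) 52 112 144 (+-assoc base-cost 320 96)
             (combine-wide i h q (suc (suc j)) t S E base-cost
             (Equal.searchSum-bound _ (suc (suc j)) i h (≤-trans i≤h+8u (≤-reflexive (cong (h +_) (shape₈ u)))) h≤b+q
               (≤-trans (≤-reflexive (cong (h +_) (sym 4u≡q))) l₁ , b+2u≤h))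
             inner′ 2h² 4q≤2i i≥1 2t≤i²) ri≤) ⟩
      D * (2 * (suc (suc j) + 2) * (2 * t)) + αₗ * (i * i) + 144 * X * (q * q) + (base-cost + 416) * X * i
        ≤⟨ +-mono-≤ (≤-reflexive (cong₂ (λ x y → x + αₗ * (i * i) + y)
             (cong₂ (λ k x → D * (2 * k * x)) (sym K≡) (2*tri-pred i))
             (trans (shape X q) (cong (λ p → 9 * X * (p * p)) (sym P≡4q)))))
             (*-monoˡ-≤ i (*-monoˡ-≤ X (+-monoʳ-≤ base-cost (≤ᵇ⇒≤ 416 432 tt)))) ⟩
      D * (2 * K * (i * N)) + αₗ * (i * i) + 9 * X * (P * P) + B * i ∎
      where
      open ≤-Reasoning
      shape : ∀ X q → 144 * X * (q * q) ≡ 9 * X * (4 * q * (4 * q))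
      shape = solve-∀
      shape₈ : ∀ u → 8 * u ≡ 2 * (2 * (2 * u))
      shape₈ = solve-∀
      b+2u≤h : b + 2 * u ≤ h
      b+2u≤h = *-cancelˡ-≤ 2 (linear _ _ 0 (+-mono-≤ l₁ (+-mono-≤ 2i≤3h (2*⌊n/2⌋≤n i))) (balance i h b u))
        where
        balance : ∀ i h b u → 2 * h + (h + 4 * u + (2 * i + 2 * b)) ≡ 2 * (b + 2 * u) + (i + (3 * h + i)) + 0
        balance = solve-∀

    -- Once the first width reaches 4 u, the second is at least 2 u (`wide` derives this from 2 i ≤
    -- 3 h), so only three of the four combinations occur.
    merge-bound : Narrow K i ⊎ Mixed K i ⊎ Wide K i
    merge-bound = [ (λ u₁ → [ (λ u₂ → inj₁ (narrow u₁ u₂)) , (λ l₂ → inj₂ (inj₁ (mixed u₁ l₂))) ]′ (≤-total h (b + 2 * u)))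
                  , (λ l₁ → inj₂ (inj₂ (wide l₁))) ]′ (≤-total i (h + 4 * u))

-- Accumulation over a cell

-- An upper bound W / s of the complexity for n = 2 k elements, shifted by 3 n to
-- keep all quantities natural numbers.
AtMost : (s k W : ℕ) → Set
AtMost s k W = s * (totalCost k + 6 * k * (k * 2) !) ≤ (k * 2) ! * W

AtMost-step : ∀ s k W V → 1 ≤ k → let i = suc k * 2 in
  s * (pairTotal i + 6 * (i * pred i)) ≤ i * pred i * V → AtMost s k W → AtMost s (suc k) (W + V)
AtMost-step s (suc k) W V _ pair before = linear _ _ 0
  (+-mono-≤ (*-monoʳ-≤ (i * pred i) before) (*-monoʳ-≤ (m !) pair))
  (balance s (suc k) W V (m !) (totalCost (suc k)) (pairTotal i) i (pred i))
  where
  m i : ℕ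
  m = suc k * 2
  i = suc (suc k) * 2
  balance : ∀ s k W V f T pT i N →
    i * (N * f) * (W + V) + (i * N * (s * (T + 6 * k * f)) + f * (s * (pT + 6 * (i * N)))) ≡
    s * (i * (N * T) + f * pT + 6 * suc k * (i * (N * f))) + (i * N * (f * W) + f * (i * N * V)) + 0
  balance = solve-∀

AtMost-weaken : ∀ s k {W W′} → W ≤ W′ → AtMost s k W → AtMost s k W′
AtMost-weaken s k W≤W′ le = ≤-trans le (*-monoʳ-≤ ((k * 2) !) W≤W′)

AtMost-scale : ∀ h s k W → AtMost s k W → AtMost (h * s) k (h * W)
AtMost-scale h s k W le = subst₂ _≤_ (sym (*-assoc h s _)) (swap h ((k * 2) !) W) (*-monoʳ-≤ h le)
  where
  swap : ∀ h f W → h * (f * W) ≡ f * (h * W)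
  swap = solve-∀

AtMost-unscale : ∀ h .{{_ : NonZero h}} s k W → AtMost (h * s) k (h * W) → AtMost s k W
AtMost-unscale h s k W le = *-cancelˡ-≤ h (subst₂ _≤_ (*-assoc h s _) (swap h ((k * 2) !) W) le)
  where
  swap : ∀ h f W → f * (h * W) ≡ h * (f * W)
  swap = solve-∀

record Class : Set where
  constructor class
  field α β γ : ℕ

-- The 6 is the growth of the shift 3 n when n grows by two; it keeps α - β/y + γ/y² positive.
ClassBound : (D B : ℕ) → Class → (K i : ℕ) → Set
ClassBound D B (class α β γ) K i = D * (pairTotal i + 6 * (i * pred i)) + β * (i * 2 ^ K) ≤
  D * (2 * K * (i * pred i)) + α * (i * i) + γ * (2 ^ K * 2 ^ K) + B * i

PairBound⇒ClassBound : ∀ D B α β γ K i {α′} → α + 6 * D ≡ α′ → PairBound D B α β γ K i → ClassBound D B (class α′ β γ) K i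
PairBound⇒ClassBound D B α β γ K i refl le = linear _ _ 0
  (+-mono-≤ le (*-monoʳ-≤ (6 * D) (*-monoʳ-≤ i (pred[n]≤n {i}))))
  (balance D B α β γ (2 * K) (pairTotal i) i (pred i) (2 ^ K))
  where
  balance : ∀ D B α β γ κ T i N P →
    D * (κ * (i * N)) + (α + 6 * D) * (i * i) + γ * (P * P) + B * i + (D * T + β * (i * P) + 6 * D * (i * N)) ≡
    D * (T + 6 * (i * N)) + β * (i * P) + (D * (κ * (i * N)) + α * (i * i) + γ * (P * P) + B * i + 6 * D * (i * i)) + 0
  balance = solve-∀

-- On the cell l ≤ J y ≤ l + 1 the bound α - β / y + γ / y² lies below the chord
-- through the values L and R, since the Bernstein coefficients of y² times the
-- difference are non-negative.
Bernstein : (J l L R : ℕ) → Class → Set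
Bernstein J l L R (class α β γ) = let j = suc l in
  (α * (l * l) + γ * (J * J) ≤ L * (l * l) + β * (J * l)) ×
  (α * (l * l) + 2 * α * (l * j) + 3 * (γ * (J * J)) ≤ 2 * L * (l * j) + R * (l * l) + β * (J * (j + 2 * l))) ×
  (α * (j * j) + 2 * α * (l * j) + 3 * (γ * (J * J)) ≤ L * (j * j) + 2 * R * (l * j) + β * (J * (2 * j + l))) ×
  (α * (j * j) + γ * (J * J) ≤ R * (j * j) + β * (J * j))

-- Homogeneous form: x and y are barycentric coordinates of i in the cell, scaled to sum h. With the
-- factor h both sides are cubic forms in x and y, compared coefficient by coefficient.
chord : ∀ J l L R α β γ x y → Bernstein J l L R (class α β γ) → let h = x + y ; i = l * x + suc l * y ; P = J * h in
  h * (α * (i * i) + γ * (P * P)) ≤ (L * x + R * y) * (i * i) + h * (β * (i * P))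
chord J l L R α β γ x y (b₀ , b₁ , b₂ , b₃) = ≤-trans (≤-reflexive (left α γ J x y l (suc l)))
  (≤-trans (+-mono-≤ (+-mono-≤ (*-monoʳ-≤ (x * x * x) b₀) (*-monoʳ-≤ (x * x * y) b₁))
                     (+-mono-≤ (*-monoʳ-≤ (x * y * y) b₂) (*-monoʳ-≤ (y * y * y) b₃)))
    (≤-reflexive (sym (right L R β J x y l (suc l)))))
  where
  left : ∀ α γ J x y l j →
    (x + y) * (α * ((l * x + j * y) * (l * x + j * y)) + γ * (J * (x + y) * (J * (x + y)))) ≡
    x * x * x * (α * (l * l) + γ * (J * J))
    + x * x * y * (α * (l * l) + 2 * α * (l * j) + 3 * (γ * (J * J)))
    + (x * y * y * (α * (j * j) + 2 * α * (l * j) + 3 * (γ * (J * J)))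
    + y * y * y * (α * (j * j) + γ * (J * J)))
  left = solve-∀
  right : ∀ L R β J x y l j →
    (L * x + R * y) * ((l * x + j * y) * (l * x + j * y)) + (x + y) * (β * ((l * x + j * y) * (J * (x + y)))) ≡
    x * x * x * (L * (l * l) + β * (J * l))
    + x * x * y * (2 * L * (l * j) + R * (l * l) + β * (J * (j + 2 * l)))
    + (x * y * y * (L * (j * j) + 2 * R * (l * j) + β * (J * (2 * j + l)))
    + y * y * y * (R * (j * j) + β * (J * j)))
  right = solve-∀

-- The rounding errors, of order i, vanish in i (i - 1) because i is large.
chord-pair : ∀ D B c K i J H l L R x y → x + y ≡ H → l * x + suc l * y ≡ i → J * H ≡ 2 ^ K →
  Bernstein J l L R c → L ≤ R → R + B ≤ pred i → ClassBound D B c K i →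
  H * D * (pairTotal i + 6 * (i * pred i)) ≤ i * pred i * (H * (D * (2 * K)) + (L * x + R * y) + H)
chord-pair D B c@(class α β γ) K i J H l L R x y refl i≡ P≡ bern L≤R large bound =
  +-cancelʳ-≤ (H * (β * (i * P))) _ _ (begin
    H * D * pT + H * (β * (i * P))
      ≡⟨ factor H D pT (β * (i * P)) ⟩
    H * (D * pT + β * (i * P))
      ≤⟨ *-monoʳ-≤ H bound ⟩
    H * (D * (2 * K * (i * N)) + α * (i * i) + γ * (P * P) + B * i)
      ≡⟨ spread H (D * (2 * K * (i * N))) (α * (i * i)) (γ * (P * P)) (B * i) ⟩
    H * (D * (2 * K * (i * N))) + H * (α * (i * i) + γ * (P * P)) + H * (B * i)
      ≤⟨ +-monoˡ-≤ (H * (B * i)) (+-monoʳ-≤ (H * (D * (2 * K * (i * N)))) (subst₂ (λ i P → H * (α * (i * i) + γ * (P * P)) ≤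
           (L * x + R * y) * (i * i) + H * (β * (i * P))) i≡ P≡ (chord J l L R α β γ x y bern))) ⟩
    H * (D * (2 * K * (i * N))) + ((L * x + R * y) * (i * i) + H * (β * (i * P))) + H * (B * i)
      ≤⟨ linear _ _ 0 small (balance H D K i N (L * x + R * y) (H * (β * (i * P))) B) ⟩
    i * N * (H * (D * (2 * K)) + (L * x + R * y) + H) + H * (β * (i * P)) ∎)
  where
  open ≤-Reasoning
  N P pT : ℕ
  N = pred i
  P = 2 ^ K
  pT = pairTotal i + 6 * (i * N)
  factor : ∀ H D p b → H * D * p + H * b ≡ H * (D * p + b)
  factor = solve-∀
  spread : ∀ H a b c d → H * (a + b + c + d) ≡ H * a + H * (b + c) + H * d
  spread = solve-∀
  small : (L * x + R * y) * (i * i) + H * (B * i) ≤ (L * x + R * y) * (i * N) + H * (i * N)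
  small = begin
    (L * x + R * y) * (i * i) + H * (B * i)
      ≤⟨ +-monoˡ-≤ (H * (B * i)) (*-monoʳ-≤ (L * x + R * y) (*-monoʳ-≤ i (suc-pred-≤ i))) ⟩
    (L * x + R * y) * (i * suc N) + H * (B * i)
      ≡⟨ expand (L * x + R * y) i N (H * (B * i)) ⟩
    (L * x + R * y) * (i * N) + ((L * x + R * y) * i + H * (B * i))
      ≤⟨ +-monoʳ-≤ ((L * x + R * y) * (i * N)) (+-monoˡ-≤ (H * (B * i)) (*-monoˡ-≤ i (+-monoˡ-≤ (R * y) (*-monoˡ-≤ x L≤R)))) ⟩
    (L * x + R * y) * (i * N) + ((R * x + R * y) * i + H * (B * i))
      ≡⟨ cong ((L * x + R * y) * (i * N) +_) (collect R B x y i) ⟩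
    (L * x + R * y) * (i * N) + H * (i * (R + B))
      ≤⟨ +-monoʳ-≤ ((L * x + R * y) * (i * N)) (*-monoʳ-≤ H (*-monoʳ-≤ i large)) ⟩
    (L * x + R * y) * (i * N) + H * (i * N) ∎
    where
    suc-pred-≤ : ∀ n → n ≤ suc (pred n)
    suc-pred-≤ zero    = z≤n
    suc-pred-≤ (suc n) = ≤-refl
    expand : ∀ v i N w → v * (i * suc N) + w ≡ v * (i * N) + (v * i + w)
    expand = solve-∀
    collect : ∀ R B x y i → (R * x + R * y) * i + (x + y) * (B * i) ≡ (x + y) * (i * (R + B))
    collect = solve-∀
  balance : ∀ H D K i N v b B → i * N * (H * (D * (2 * K)) + v + H) + b + (v * (i * i) + H * (B * i)) ≡
    H * (D * (2 * K * (i * N))) + (v * (i * i) + b) + H * (B * i) + (v * (i * N) + H * (i * N)) + 0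
  balance = solve-∀

-- k₀ 2 = l H is the left end of a cell of width H = 2 η.
module Cell (D B J l L R K η k₀ : ℕ) (η≥1 : 1 ≤ η) (k₀≥1 : 1 ≤ k₀) (start : k₀ * 2 ≡ l * (2 * η))
  (P≡ : J * (2 * η) ≡ 2 ^ K) (L≤R : L ≤ R) (R≤η : R ≤ η) (large : R + B ≤ k₀ * 2)
  (classes : ∀ k → l * (2 * η) < k * 2 → k * 2 ≤ suc l * (2 * η) →
             ∃[ c ] Bernstein J l L R c × ClassBound D B c K (k * 2)) where
  private
    H δ : ℕ
    H = 2 * η
    δ = R ∸ L

    R≡ : L + δ ≡ R
    R≡ = m+[n∸m]≡n L≤R

    -- As x = H - 2 σ, the chord value L x + R · 2 σ equals L H + 2 δ σ; its sum over the pairs is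
    -- this quadratic.
    W : ℕ → ℕ → ℕ
    W W₀ σ = H * W₀ + σ * (4 * (H * (D * (2 * K)) + H + L * H)) + 4 * δ * (σ * suc σ)

    next : ∀ k σ x → k * 2 ≡ l * H + 2 * σ → x + 2 * suc σ ≡ H →
      H * (4 * D) * (pairTotal (suc k * 2) + 6 * (suc k * 2 * pred (suc k * 2))) ≤
      suc k * 2 * pred (suc k * 2) * (4 * (H * (D * (2 * K)) + (L * x + R * (2 * suc σ)) + H))
    next k σ x k≡ x≡ = subst₂ _≤_ (left H D pT) (right (i * pred i) V) (*-monoʳ-≤ 4
      (chord-pair D B (proj₁ c) K i J H l L R x (2 * suc σ) x≡ i≡ P≡ (proj₁ (proj₂ c)) L≤R
        (≤-trans large k₀≤) (proj₂ (proj₂ c))))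
      where
      i pT V : ℕ
      i = suc k * 2
      pT = pairTotal i + 6 * (i * pred i)
      V = H * (D * (2 * K)) + (L * x + R * (2 * suc σ)) + H
      left : ∀ H D T → 4 * (H * D * T) ≡ H * (4 * D) * T
      left = solve-∀
      right : ∀ c V → 4 * (c * V) ≡ c * (4 * V)
      right = solve-∀
      i≡lH : i ≡ l * H + 2 * suc σ
      i≡lH = trans (cong (2 +_) k≡) (shape (l * H) σ)
        where
        shape : ∀ a σ → 2 + (a + 2 * σ) ≡ a + 2 * suc σ
        shape = solve-∀
      i≡ : l * x + suc l * (2 * suc σ) ≡ i
      i≡ = trans (shape l x (2 * suc σ)) (trans (cong (λ h → l * h + 2 * suc σ) x≡) (sym i≡lH))
        where
        shape : ∀ l x y → l * x + suc l * y ≡ l * (x + y) + y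
        shape = solve-∀
      k₀≤ : k₀ * 2 ≤ pred i
      k₀≤ = ≤-trans (≤-trans (≤-reflexive start) (≤-trans (m≤m+n _ (2 * σ)) (≤-reflexive (sym k≡)))) (n≤1+n _)
      c = classes (suc k)
        (≤-trans (m<m+n (l * H) (s≤s z≤n)) (≤-reflexive (sym i≡lH)))
        (≤-trans (≤-reflexive i≡lH) (≤-trans (+-monoʳ-≤ (l * H) (≤-trans (m≤n+m _ x) (≤-reflexive x≡)))
          (≤-reflexive (+-comm (l * H) H))))

    index : ∀ σ → (σ + k₀) * 2 ≡ l * H + 2 * σ
    index σ = trans (shape σ k₀) (cong (_+ 2 * σ) start)
      where
      shape : ∀ σ k → (σ + k) * 2 ≡ k * 2 + 2 * σ
      shape = solve-∀

    run : ∀ W₀ → AtMost (4 * D) k₀ W₀ → ∀ σ → 2 * σ ≤ H → AtMost (H * (4 * D)) (σ + k₀) (W W₀ σ)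
    run W₀ at zero    _  = AtMost-weaken (H * (4 * D)) k₀ (≤-trans (m≤m+n (H * W₀) 0) (m≤m+n _ _))
      (AtMost-scale H (4 * D) k₀ W₀ at)
    run W₀ at (suc σ) ≤H = subst (AtMost (H * (4 * D)) (suc σ + k₀)) grow
      (AtMost-step (H * (4 * D)) (σ + k₀) (W W₀ σ) _ (≤-trans k₀≥1 (m≤n+m k₀ σ))
        (next (σ + k₀) σ x (index σ) x≡) (run W₀ at σ (≤-trans (*-monoʳ-≤ 2 (n≤1+n σ)) ≤H)))
      where
      x : ℕ
      x = H ∸ 2 * suc σ
      x≡ : x + 2 * suc σ ≡ H
      x≡ = m∸n+n≡m ≤H
      grow : W W₀ σ + 4 * (H * (D * (2 * K)) + (L * x + R * (2 * suc σ)) + H) ≡ W W₀ (suc σ)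
      grow = subst (λ h → h * W₀ + σ * (4 * (h * DK + h + L * h)) + 4 * δ * (σ * suc σ)
          + 4 * (h * DK + (L * x + R * (2 * suc σ)) + h) ≡
          h * W₀ + suc σ * (4 * (h * DK + h + L * h)) + 4 * δ * (suc σ * suc (suc σ))) x≡
        (subst (λ r → (x + 2 * suc σ) * W₀ + σ * (4 * ((x + 2 * suc σ) * DK + (x + 2 * suc σ) + L * (x + 2 * suc σ)))
          + 4 * δ * (σ * suc σ) + 4 * ((x + 2 * suc σ) * DK + (L * x + r * (2 * suc σ)) + (x + 2 * suc σ)) ≡
          (x + 2 * suc σ) * W₀ + suc σ * (4 * ((x + 2 * suc σ) * DK + (x + 2 * suc σ) + L * (x + 2 * suc σ)))
          + 4 * δ * (suc σ * suc (suc σ))) R≡ (shape W₀ σ x DK L δ))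
        where
        DK : ℕ
        DK = D * (2 * K)
        shape : ∀ W₀ σ x d L δ → 
          (x + 2 * suc σ) * W₀ + σ * (4 * ((x + 2 * suc σ) * d + (x + 2 * suc σ) + L * (x + 2 * suc σ))) + 4 * δ * (σ * suc σ)
          + 4 * ((x + 2 * suc σ) * d + (L * x + (L + δ) * (2 * suc σ)) + (x + 2 * suc σ)) ≡
          (x + 2 * suc σ) * W₀ + suc σ * (4 * ((x + 2 * suc σ) * d + (x + 2 * suc σ) + L * (x + 2 * suc σ)))
          + 4 * δ * (suc σ * suc (suc σ))
        shape = solve-∀

  -- Chord values increase since L ≤ R, so their partial sums are convex in σ and lie below the line
  -- between the ends of the cell. Of the 3, two units pay for the rounding term H of `chord-pair`,
  -- and one, by δ ≤ η, for sampling at right end points.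
  cell-bound : ∀ W₀ → AtMost (4 * D) k₀ W₀ → ∀ σ → 2 * σ ≤ H →
    AtMost (4 * D) (σ + k₀) (W₀ + 2 * σ * (4 * D * K + (L + R + 3)))
  cell-bound W₀ at σ ≤H = AtMost-unscale H {{>-nonZero (≤-trans η≥1 (m≤m+n η _))}} (4 * D) (σ + k₀) _
    (AtMost-weaken (H * (4 * D)) (σ + k₀) below (run W₀ at σ ≤H))
    where
    σ≤η : σ ≤ η
    σ≤η = *-cancelˡ-≤ 2 ≤H
    δ≤η : δ ≤ η
    δ≤η = ≤-trans (m∸n≤m R L) R≤η
    below : W W₀ σ ≤ H * (W₀ + 2 * σ * (4 * D * K + (L + R + 3)))
    below = subst (λ r → W W₀ σ ≤ H * (W₀ + 2 * σ * (4 * D * K + (L + r + 3)))) R≡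
      (linear _ _ 0 (+-mono-≤ (*-monoʳ-≤ (4 * (δ * σ)) σ≤η) (*-monoʳ-≤ (4 * σ) δ≤η)) (balance W₀ σ η D K L δ))
      where
      balance : ∀ W₀ σ η D K L δ → 2 * η * (W₀ + 2 * σ * (4 * D * K + (L + (L + δ) + 3)))
        + (4 * (δ * σ) * σ + 4 * σ * δ) ≡
        2 * η * W₀ + σ * (4 * (2 * η * (D * (2 * K)) + 2 * η + L * (2 * η))) + 4 * δ * (σ * suc σ)
        + (4 * (δ * σ) * η + 4 * σ * η) + 0
      balance = solve-∀

-- The test on p and the choice of a class

≤ᵇ-/ : ∀ a d b e .{{_ : NonZero d}} .{{_ : NonZero e}} →
       (((ℤ.+ a) ℚᵘ./ d) ℚᵘ.≤ᵇ ((ℤ.+ b) ℚᵘ./ e)) ≡ (a * e ≤ᵇ b * d)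
≤ᵇ-/ a (suc d) b (suc e) = cong₂ ℤ._≤ᵇ_ (sym (ℤ.pos-* a (suc e))) (sym (ℤ.pos-* b (suc d)))

merges-≡ : ∀ n → merges n ≡ (5511 * 2 ^ ⌈log₂ n ⌉ ≤ᵇ n * 10000) ∧ (n * 1000 ≤ᵇ 888 * 2 ^ ⌈log₂ n ⌉)
merges-≡ n = cong₂ _∧_ (≤ᵇ-/ 5511 10000 n (2 ^ ⌈log₂ n ⌉) {{_}} {{m^n≢0 2 ⌈log₂ n ⌉}})
                       (≤ᵇ-/ n (2 ^ ⌈log₂ n ⌉) 888 1000 {{m^n≢0 2 ⌈log₂ n ⌉}})

∧-true : ∀ {a b} → a ∧ b ≡ true → a ≡ true × b ≡ true
∧-true {true} {true} _ = refl , refl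

∧-false : ∀ {a b} → a ∧ b ≡ false → a ≡ false ⊎ b ≡ false
∧-false {false}         _ = inj₁ refl
∧-false {true}  {false} _ = inj₂ refl

≤ᵇ-true : ∀ {m n} → (m ≤ᵇ n) ≡ true → m ≤ n
≤ᵇ-true {m} {n} eq = ≤ᵇ⇒≤ m n (subst T (sym eq) tt)

≤⇒≤ᵇ-true : ∀ {m n} → m ≤ n → (m ≤ᵇ n) ≡ true
≤⇒≤ᵇ-true {m} {n} le with m ≤ᵇ n | ≤⇒≤ᵇ le
... | true | _ = refl

≤ᵇ-false : ∀ {m n} → (m ≤ᵇ n) ≡ false → n < m
≤ᵇ-false {m} {n} eq = ≰⇒> λ le → subst T eq (≤⇒≤ᵇ le)

module _ (K n : ℕ) (lo : 2 ^ suc K < 2 * n) (hi : n ≤ 2 ^ suc K) where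
  ⌈log₂⌉-≡ : ⌈log₂ n ⌉ ≡ suc K
  ⌈log₂⌉-≡ = ⌈log₂⌉-unique K (*-cancelˡ-< 2 (2 ^ K) n lo) hi

  merges-test : merges n ≡ (5511 * 2 ^ suc K ≤ᵇ n * 10000) ∧ (n * 1000 ≤ᵇ 888 * 2 ^ suc K)
  merges-test = trans (merges-≡ n) (cong (λ k → (5511 * 2 ^ k ≤ᵇ n * 10000) ∧ (n * 1000 ≤ᵇ 888 * 2 ^ k)) ⌈log₂⌉-≡)

  merges-true : merges n ≡ true → 5511 * 2 ^ suc K ≤ n * 10000 × n * 1000 ≤ 888 * 2 ^ suc K
  merges-true eq = ≤ᵇ-true (proj₁ both) , ≤ᵇ-true (proj₂ both)
    where
    both = ∧-true (trans (sym merges-test) eq)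

  merges-false : merges n ≡ false → n * 10000 < 5511 * 2 ^ suc K ⊎ 888 * 2 ^ suc K < n * 1000
  merges-false eq = [ (λ e → inj₁ (≤ᵇ-false e)) , (λ e → inj₂ (≤ᵇ-false e)) ]′ (∧-false (trans (sym merges-test) eq))

pairTotal-single : ∀ n → merges n ≡ false → pairTotal n ≡ singleTotal n
pairTotal-single n eq = trans (pairTotal-if n) (cong (λ c → if c then mergeTotal n else singleTotal n) eq)

module _ (X r αₙ αₘ αₗ γₙ : ℕ) (2r²≤X² : 2 * (r * r) ≤ X * X)
  (αₙ≡ : αₙ + 96 * r ≡ 100 * X) (αₗ≡ : αₗ + 96 * r ≡ 112 * X) (αₘ≡ : αₘ + 96 * r ≡ 104 * X)
  (γₙ≡ : 64 * γₙ ≡ 336 * X) where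

  open MergeBound X r αₙ αₘ αₗ γₙ 2r²≤X² αₙ≡ αₗ≡ αₘ≡ γₙ≡ using (D; B; merge-bound)

  single narrow mixed wide : Class
  single = class (24 * X + 6 * D) (24 * X) 0
  narrow = class (αₙ + 6 * D) (38 * X) γₙ
  mixed  = class (αₘ + 6 * D) (36 * X + 8 * r) (6 * X)
  wide   = class (αₗ + 6 * D) (52 * X) (9 * X)

  single-bound : ∀ K n → 2 ^ suc K < 2 * n → n ≤ 2 ^ suc K → merges n ≡ false → ClassBound D B single (suc K) n
  single-bound K zero    ()
  single-bound K (suc N) lo hi eq = PairBound⇒ClassBound D B (24 * X) (24 * X) 0 (suc K) (suc N) refl
    (linear _ _ (base-cost * X * suc N + 408 * X * suc N) (+-mono-≤ (*-monoʳ-≤ D bound) (+-mono-≤ (*-monoʳ-≤ (2 * D) (*-monoʳ-≤ (suc N) (n≤1+n N))) (*-monoʳ-≤ D (<⇒≤ lo))))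
      (balance X (pairTotal (suc N)) N K (2 ^ suc K) base-cost))
    where
    bound : pairTotal (suc N) + 2 * (suc N * 2 ^ suc K) ≤ (2 * suc K + 2) * (suc N * N) + 2 ^ suc K
    bound = ≤-trans (≤-reflexive (cong (_+ 2 * (suc N * 2 ^ suc K)) (pairTotal-single (suc N) eq)))
      (singleTotal-bound (suc K) N (*-monoʳ-≤ 2 (≤-pred (*-cancelˡ-< 2 (2 ^ K) (suc N) lo))) hi)
    balance : ∀ X T N K P c →
      12 * X * (2 * suc K * (suc N * N)) + 24 * X * (suc N * suc N) + 0 * (P * P) + (c + 432) * X * suc N +
      (12 * X * (T + 2 * (suc N * P)) + (2 * (12 * X) * (suc N * N) + 12 * X * P)) ≡
      12 * X * T + 24 * X * (suc N * P) +
      (12 * X * ((2 * suc K + 2) * (suc N * N) + P) + (2 * (12 * X) * (suc N * suc N) + 12 * X * (2 * suc N)))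
      + (c * X * suc N + 408 * X * suc N)
    balance = solve-∀

  merge-class : ∀ j n → 10 ≤ 2 ^ j → 2 ^ (4 + j) < 2 * n → n ≤ 2 ^ (4 + j) → merges n ≡ true →
    ∃[ c ] c ∈ narrow ∷ mixed ∷ wide ∷ [] × ClassBound D B c (4 + j) n
  merge-class j n u≥10 lo hi eq =
    [ (λ b → narrow , Any.here refl , PairBound⇒ClassBound D B αₙ (38 * X) γₙ (4 + j) n refl b)
    , [ (λ b → mixed , Any.there (Any.here refl) , PairBound⇒ClassBound D B αₘ (36 * X + 8 * r) (6 * X) (4 + j) n refl b)
      , (λ b → wide , Any.there (Any.there (Any.here refl)) , PairBound⇒ClassBound D B αₗ (52 * X) (9 * X) (4 + j) n refl b) ]′
    ]′ (merge-bound j n n≥1 u≥10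
      (≤-trans (≤-reflexive (shape (2 ^ j))) (≤-trans (proj₁ range) (≤-reflexive (*-comm n 10000))))
      (≤-trans (≤-reflexive (*-comm 1000 n)) (≤-trans (proj₂ range) (≤-reflexive (sym (shape′ (2 ^ j))))))
      eq)
    where
    range : 5511 * 2 ^ (4 + j) ≤ n * 10000 × n * 1000 ≤ 888 * 2 ^ (4 + j)
    range = merges-true (3 + j) n lo hi eq
    n≥1 : 1 ≤ n
    n≥1 = *-cancelˡ-< 2 0 n (≤-trans (s≤s z≤n) lo)
    shape : ∀ u → 88176 * u ≡ 5511 * (2 * (2 * (2 * (2 * u))))
    shape = solve-∀
    shape′ : ∀ u → 14208 * u ≡ 888 * (2 * (2 * (2 * (2 * u))))
    shape′ = solve-∀

-- Logarithms

^-distribʳ-* : ∀ k a b → (a * b) ^ k ≡ a ^ k * b ^ k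
^-distribʳ-* zero    a b = refl
^-distribʳ-* (suc k) a b = trans (cong (a * b *_) (^-distribʳ-* k a b)) (swap a b (a ^ k) (b ^ k))
  where
  swap : ∀ a b c d → a * b * (c * d) ≡ a * c * (b * d)
  swap = solve-∀

-- Bernoulli's inequality 1 + v/n ≤ (1 + 1/n)^v without denominators; `bernoulli⁻` is 1 - u/n ≤ (1 -
-- 1/n)^u. Their right-hand sides nearly cancel in `power-chord`.
bernoulli⁺ : ∀ n v → (n + v) * n ^ v ≤ n * suc n ^ v
bernoulli⁺ n zero    = ≤-reflexive (cong (_* 1) (+-identityʳ n))
bernoulli⁺ n (suc v) = begin
  (n + suc v) * (n * n ^ v)       ≡⟨ *-assoc (n + suc v) n (n ^ v) ⟨
  (n + suc v) * n * n ^ v         ≤⟨ *-monoˡ-≤ (n ^ v) (linear {0} {0} ((n + suc v) * n) (suc n * (n + v)) v ≤-refl (balance n v)) ⟩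
  suc n * (n + v) * n ^ v         ≡⟨ *-assoc (suc n) (n + v) (n ^ v) ⟩
  suc n * ((n + v) * n ^ v)       ≤⟨ *-monoʳ-≤ (suc n) (bernoulli⁺ n v) ⟩
  suc n * (n * suc n ^ v)         ≡⟨ swap (suc n) n (suc n ^ v) ⟩
  n * (suc n * suc n ^ v)         ∎
  where
  open ≤-Reasoning
  balance : ∀ n v → suc n * (n + v) + 0 ≡ (n + suc v) * n + 0 + v
  balance = solve-∀
  swap : ∀ a b c → a * (b * c) ≡ b * (a * c)
  swap = solve-∀

bernoulli⁻ : ∀ m a u → a + u ≡ suc m → a * suc m ^ u ≤ suc m * m ^ u
bernoulli⁻ m a zero    eq = ≤-reflexive (cong (_* 1) (trans (sym (+-identityʳ a)) eq))
bernoulli⁻ m a (suc u) eq = begin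
  a * (suc m * suc m ^ u)     ≡⟨ *-assoc a (suc m) (suc m ^ u) ⟨
  a * suc m * suc m ^ u       ≤⟨ *-monoˡ-≤ (suc m ^ u) (linear _ _ 0 a≤m (balance a m)) ⟩
  suc a * m * suc m ^ u       ≡⟨ swap (suc a) m (suc m ^ u) ⟩
  m * (suc a * suc m ^ u)     ≤⟨ *-monoʳ-≤ m (bernoulli⁻ m (suc a) u (trans (sym (+-suc a u)) eq)) ⟩
  m * (suc m * m ^ u)         ≡⟨ swap′ m (suc m) (m ^ u) ⟩
  suc m * (m * m ^ u)         ∎
  where
  open ≤-Reasoning
  a≤m : a ≤ m
  a≤m = ≤-pred (≤-trans (≤-trans (s≤s (m≤m+n a u)) (≤-reflexive (sym (+-suc a u)))) (≤-reflexive eq))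
  balance : ∀ a m → suc a * m + a ≡ a * suc m + m + 0
  balance = solve-∀
  swap : ∀ a b c → a * b * c ≡ b * (a * c)
  swap = solve-∀
  swap′ : ∀ a b c → a * (b * c) ≡ b * (a * c)
  swap′ = solve-∀

-- Concavity of the logarithm.
power-chord : ∀ m a b u v → a + u ≡ suc m → suc m + v ≡ b → a ^ v * b ^ u ≤ suc m ^ (u + v)
power-chord m a b u v a≡ refl = *-cancelʳ-≤ _ _ (n ^ (u * v) * n ^ (u * v)) {{m*n≢0 _ _ {{m^n≢0 n (u * v)}} {{m^n≢0 n (u * v)}}}} (begin
  a ^ v * (n + v) ^ u * (n ^ (u * v) * n ^ (u * v))
    ≡⟨ cong (λ x → a ^ v * (n + v) ^ u * (n ^ (u * v) * x)) (cong (n ^_) (*-comm u v)) ⟩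
  a ^ v * (n + v) ^ u * (n ^ (u * v) * n ^ (v * u))
    ≡⟨ cong₂ (λ x y → a ^ v * (n + v) ^ u * (x * y)) (sym (^-*-assoc n u v)) (sym (^-*-assoc n v u)) ⟩
  a ^ v * (n + v) ^ u * ((n ^ u) ^ v * (n ^ v) ^ u)
    ≡⟨ regroup (a ^ v) ((n + v) ^ u) ((n ^ u) ^ v) ((n ^ v) ^ u) ⟩
  a ^ v * (n ^ u) ^ v * ((n + v) ^ u * (n ^ v) ^ u)
    ≡⟨ cong₂ _*_ (^-distribʳ-* v a (n ^ u)) (^-distribʳ-* u (n + v) (n ^ v)) ⟨
  (a * n ^ u) ^ v * ((n + v) * n ^ v) ^ u
    ≤⟨ *-mono-≤ (^-monoˡ-≤ v (bernoulli⁻ m a u a≡)) (^-monoˡ-≤ u (bernoulli⁺ n v)) ⟩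
  (n * m ^ u) ^ v * (n * suc n ^ v) ^ u
    ≡⟨ cong₂ _*_ (^-distribʳ-* v n (m ^ u)) (^-distribʳ-* u n (suc n ^ v)) ⟩
  n ^ v * (m ^ u) ^ v * (n ^ u * (suc n ^ v) ^ u)
    ≡⟨ cong₂ (λ x y → n ^ v * x * (n ^ u * y)) (^-*-assoc m u v) (trans (^-*-assoc (suc n) v u) (cong (suc n ^_) (*-comm v u))) ⟩
  n ^ v * m ^ (u * v) * (n ^ u * suc n ^ (u * v))
    ≡⟨ regroup′ (n ^ v) (m ^ (u * v)) (n ^ u) (suc n ^ (u * v)) ⟩
  n ^ u * n ^ v * (m ^ (u * v) * suc n ^ (u * v))
    ≡⟨ cong₂ _*_ (^-distribˡ-+-* n u v) (^-distribʳ-* (u * v) m (suc n)) ⟨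
  n ^ (u + v) * (m * suc n) ^ (u * v)
    -- Both Bernoulli bounds now carry the exponent u v, and (n - 1) (n + 1) ≤ n².
    ≤⟨ *-monoʳ-≤ (n ^ (u + v)) (^-monoˡ-≤ (u * v) (linear {0} {0} (m * suc n) (n * n) 1 ≤-refl (balance m))) ⟩
  n ^ (u + v) * (n * n) ^ (u * v)
    ≡⟨ cong (n ^ (u + v) *_) (^-distribʳ-* (u * v) n n) ⟩
  n ^ (u + v) * (n ^ (u * v) * n ^ (u * v)) ∎)
  where
  open ≤-Reasoning
  n : ℕ
  n = suc m
  regroup : ∀ a b c d → a * b * (c * d) ≡ a * c * (b * d)
  regroup = solve-∀
  regroup′ : ∀ a b c d → a * b * (c * d) ≡ c * a * (b * d)
  regroup′ = solve-∀
  balance : ∀ m → suc m * suc m + 0 ≡ m * suc (suc m) + 0 + 1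
  balance = solve-∀

2^≤^-+ : ∀ a b c d n → 2 ^ a ≤ n ^ b → 2 ^ c ≤ n ^ d → 2 ^ (a + c) ≤ n ^ (b + d)
2^≤^-+ a b c d n p q = subst₂ _≤_ (sym (^-distribˡ-+-* 2 a c)) (sym (^-distribˡ-+-* n b d)) (*-mono-≤ p q)

2^≤^-* : ∀ a b n c → 2 ^ a ≤ n ^ b → 2 ^ (a * c) ≤ n ^ (b * c)
2^≤^-* a b n c p = subst₂ _≤_ (^-*-assoc 2 a c) (^-*-assoc n b c) (^-monoˡ-≤ c p)

2^≤^-cancel : ∀ a b n c .{{_ : NonZero c}} → 2 ^ (a * c) ≤ n ^ (b * c) → 2 ^ a ≤ n ^ b
2^≤^-cancel a b n c p = ≮⇒≥ λ lt → <⇒≱ (^-monoˡ-< c lt)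
  (subst₂ _≤_ (sym (^-*-assoc 2 a c)) (sym (^-*-assoc n b c)) p)

2^≤^-chord : ∀ a b x y E m t̄ t → 2 ^ x ≤ a ^ E → 2 ^ y ≤ b ^ E → a + t ≡ suc m → suc m + t̄ ≡ b →
             2 ^ (x * t̄ + y * t) ≤ suc m ^ (E * (t̄ + t))
2^≤^-chord a b x y E m t̄ t xa yb a≡ b≡ = begin
  2 ^ (x * t̄ + y * t)
    ≡⟨ ^-distribˡ-+-* 2 (x * t̄) (y * t) ⟩
  2 ^ (x * t̄) * 2 ^ (y * t)
    ≤⟨ *-mono-≤ (2^≤^-* x E a t̄ xa) (2^≤^-* y E b t yb) ⟩
  a ^ (E * t̄) * b ^ (E * t)
    ≡⟨ cong₂ _*_ (trans (cong (a ^_) (*-comm E t̄)) (sym (^-*-assoc a t̄ E))) (trans (cong (b ^_) (*-comm E t)) (sym (^-*-assoc b t E))) ⟩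
  (a ^ t̄) ^ E * (b ^ t) ^ E
    ≡⟨ ^-distribʳ-* E (a ^ t̄) (b ^ t) ⟨
  (a ^ t̄ * b ^ t) ^ E
    ≤⟨ ^-monoˡ-≤ E (power-chord m a b t t̄ a≡ b≡) ⟩
  (suc m ^ (t + t̄)) ^ E
    ≡⟨ trans (^-*-assoc (suc m) (t + t̄) E) (cong (suc m ^_) (trans (*-comm (t + t̄) E) (cong (E *_) (+-comm t t̄)))) ⟩
  suc m ^ (E * (t̄ + t)) ∎
  where open ≤-Reasoning

-- The binary digits of the logarithm of m / B, for m ≥ B, by repeated squaring
-- with rounding down.
module LogDigits (B : ℕ) .{{_ : NonZero B}} where
  digits : ℕ → ℕ → ℕ
  digit  : ℕ → ℕ → ℕ
  digits zero    m = 0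
  digits (suc e) m = digit e (m * m / B)
  digit e m = if 2 * B ≤ᵇ m then 2 ^ e + digits e (m / 2) else digits e m

  digits-sound : ∀ e m → B ≤ m → 2 ^ digits e m * B ^ (2 ^ e) ≤ m ^ (2 ^ e)
  digit-sound  : ∀ e m → B ≤ m → 2 ^ digit e m * B ^ (2 ^ e) ≤ m ^ (2 ^ e)

  digits-sound zero    m B≤m = ≤-trans (≤-reflexive (+-identityʳ _)) (*-monoˡ-≤ 1 B≤m)
  digits-sound (suc e) m B≤m = begin
    2 ^ digit e q * B ^ (2 * 2 ^ e)
      ≡⟨ cong (λ x → 2 ^ digit e q * B ^ x) (2*n≡n+n (2 ^ e)) ⟩
    2 ^ digit e q * B ^ (2 ^ e + 2 ^ e)
      ≡⟨ trans (cong (2 ^ digit e q *_) (^-distribˡ-+-* B (2 ^ e) (2 ^ e))) (sym (*-assoc (2 ^ digit e q) _ _)) ⟩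
    2 ^ digit e q * B ^ (2 ^ e) * B ^ (2 ^ e)
      ≤⟨ *-monoˡ-≤ (B ^ (2 ^ e)) (digit-sound e q B≤q) ⟩
    q ^ (2 ^ e) * B ^ (2 ^ e)
      ≡⟨ ^-distribʳ-* (2 ^ e) q B ⟨
    (q * B) ^ (2 ^ e)
      ≤⟨ ^-monoˡ-≤ (2 ^ e) (m/n*n≤m (m * m) B) ⟩
    (m * m) ^ (2 ^ e)
      ≡⟨ trans (^-distribʳ-* (2 ^ e) m m) (sym (^-distribˡ-+-* m (2 ^ e) (2 ^ e))) ⟩
    m ^ (2 ^ e + 2 ^ e)
      ≡⟨ cong (m ^_) (2*n≡n+n (2 ^ e)) ⟨
    m ^ (2 * 2 ^ e) ∎
    where
    open ≤-Reasoning
    q : ℕ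
    q = m * m / B
    B≤q : B ≤ q
    B≤q = ≤-trans (≤-reflexive (sym (m*n/n≡m B B))) (/-monoˡ-≤ B (*-mono-≤ B≤m B≤m))

  digit-sound e m B≤m with 2 * B ≤ᵇ m in test
  ... | false = digits-sound e m B≤m
  ... | true  = begin
    2 ^ (2 ^ e + digits e (m / 2)) * B ^ (2 ^ e)
      ≡⟨ trans (cong (_* B ^ (2 ^ e)) (^-distribˡ-+-* 2 (2 ^ e) (digits e (m / 2)))) (*-assoc (2 ^ (2 ^ e)) _ _) ⟩
    2 ^ (2 ^ e) * (2 ^ digits e (m / 2) * B ^ (2 ^ e))
      ≤⟨ *-monoʳ-≤ (2 ^ (2 ^ e)) (digits-sound e (m / 2) B≤m/2) ⟩
    2 ^ (2 ^ e) * (m / 2) ^ (2 ^ e)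
      ≡⟨ ^-distribʳ-* (2 ^ e) 2 (m / 2) ⟨
    (2 * (m / 2)) ^ (2 ^ e)
      ≤⟨ ^-monoˡ-≤ (2 ^ e) (≤-trans (≤-reflexive (*-comm 2 (m / 2))) (m/n*n≤m m 2)) ⟩
    m ^ (2 ^ e) ∎
    where
    open ≤-Reasoning
    B≤m/2 : B ≤ m / 2
    B≤m/2 = ≤-trans (≤-reflexive (sym (m*n/n≡m B 2))) (/-monoˡ-≤ 2 (≤-trans (≤-reflexive (*-comm B 2)) (≤ᵇ-true test)))

  log-ratio : (e M j : ℕ) .{{_ : NonZero M}} → ℕ
  log-ratio e M j = digits e (j * B / M)

  log-ratio-sound : ∀ e M j .{{_ : NonZero M}} → M ≤ j → 2 ^ log-ratio e M j * M ^ (2 ^ e) ≤ j ^ (2 ^ e)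
  log-ratio-sound e M j M≤j = *-cancelʳ-≤ _ _ (B ^ (2 ^ e)) {{m^n≢0 B (2 ^ e)}} (begin
    2 ^ log-ratio e M j * M ^ (2 ^ e) * B ^ (2 ^ e)
      ≡⟨ swap (2 ^ log-ratio e M j) (M ^ (2 ^ e)) (B ^ (2 ^ e)) ⟩
    2 ^ log-ratio e M j * B ^ (2 ^ e) * M ^ (2 ^ e)
      ≤⟨ *-monoˡ-≤ (M ^ (2 ^ e)) (digits-sound e (j * B / M)
           (≤-trans (≤-reflexive (trans (sym (m*n/n≡m B M)) (cong (_/ M) (*-comm B M)))) (/-monoˡ-≤ M (*-monoˡ-≤ B M≤j)))) ⟩
    (j * B / M) ^ (2 ^ e) * M ^ (2 ^ e)
      ≡⟨ ^-distribʳ-* (2 ^ e) (j * B / M) M ⟨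
    (j * B / M * M) ^ (2 ^ e)
      ≤⟨ ^-monoˡ-≤ (2 ^ e) (m/n*n≤m (j * B) M) ⟩
    (j * B) ^ (2 ^ e)
      ≡⟨ ^-distribʳ-* (2 ^ e) j B ⟩
    j ^ (2 ^ e) * B ^ (2 ^ e) ∎)
    where
    open ≤-Reasoning
    swap : ∀ a b c → a * b * c ≡ a * c * b
    swap = solve-∀

-- complexity + (w / u) n ≤ (n + A) lg n with u n! as the common denominator.
PowerBound : (u w A k : ℕ) → Set
PowerBound u w A k = let n = k * 2 in 2 ^ (u * totalCost k + w * (n * n !)) ≤ n ^ ((n + A) * (u * n !))

-- The shift 3 n is spent in three parts: w/u is claimed, one n covers the step from K to `suc K`,
-- and κ/u is left to the table, so that Φ / (4 D H) has to stay below n / H times lg (n / 2^K) +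
-- κ/u, with μ / (E H) for the logarithm. Since lg n ≥ 1, A is paid by A lg n.
power-bound : ∀ u w κ D E H K k Φ μ A .{{_ : NonZero D}} .{{_ : NonZero (E * H)}} → w + (u + κ) ≤ 3 * u → let n = k * 2 in
  AtMost (4 * D) k (4 * D * (n * suc K) + Φ + 4 * D * A) →
  u * E * H * Φ ≤ 4 * D * (n * (u * μ + κ * E * H)) →
  2 ^ (E * H * K + μ) ≤ n ^ (E * H) → 2 ≤ n → PowerBound u w A k
power-bound u w κ D E H K k Φ μ A u≥ at Φ≤ lg n≥2 = 2^≤^-cancel x ((n + A) * (u * f)) n (E * H) (begin
  2 ^ (x * (E * H))
    ≤⟨ ^-monoʳ-≤ 2 (*-cancelˡ-≤ (4 * D) {{m*n≢0 4 D}} (linear _ _ 0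
         (+-mono-≤ (*-monoʳ-≤ (u * E * H) at) (+-mono-≤ (*-monoʳ-≤ f Φ≤) (*-monoʳ-≤ (4 * D * E * H * n * f) u≥)))
         (balance u w κ D E H K k Φ μ A f (totalCost k)))) ⟩
  2 ^ (((E * H * K + μ) * n + E * H * A) * (u * f))
    ≤⟨ 2^≤^-* ((E * H * K + μ) * n + E * H * A) (E * H * n + E * H * A) n (u * f) (2^≤^-+ ((E * H * K + μ) * n) (E * H * n) (E * H * A) (E * H * A) n
         (2^≤^-* (E * H * K + μ) (E * H) n n lg) (^-monoˡ-≤ (E * H * A) n≥2)) ⟩
  n ^ ((E * H * n + E * H * A) * (u * f))
    ≡⟨ cong (n ^_) (shape (E * H) n A (u * f)) ⟩
  n ^ ((n + A) * (u * f) * (E * H)) ∎)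
  where
  open ≤-Reasoning
  n f x : ℕ
  n = k * 2
  f = n !
  x = u * totalCost k + w * (n * f)
  shape : ∀ c n A v → (c * n + c * A) * v ≡ (n + A) * v * c
  shape = solve-∀
  balance : ∀ u w κ D E H K k Φ μ A f T →
    4 * D * (((E * H * K + μ) * (k * 2) + E * H * A) * (u * f)) +
    (u * E * H * (4 * D * (T + 6 * k * f)) + (f * (u * E * H * Φ) + 4 * D * E * H * (k * 2) * f * (w + (u + κ)))) ≡
    4 * D * ((u * T + w * (k * 2 * f)) * (E * H)) +
    (u * E * H * (f * (4 * D * (k * 2 * suc K) + Φ + 4 * D * A))
      + (f * (4 * D * (k * 2 * (u * μ + κ * E * H))) + 4 * D * E * H * (k * 2) * f * (3 * u))) + 0
  balance = solve-∀

-- u E f ≤ 4 D l (u μ + κ E) at both ends of a cell, and for the mixed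
-- Bernstein coefficient.
log-chord : ∀ u κ D E l j f g μ ν x y →
  u * E * f ≤ 4 * D * (l * (u * μ + κ * E)) →
  u * E * (f + g) ≤ 4 * D * (l * (u * ν + κ * E) + j * (u * μ + κ * E)) →
  u * E * g ≤ 4 * D * (j * (u * ν + κ * E)) →
  u * E * (x + y) * (f * x + g * y) ≤ 4 * D * ((l * x + j * y) * (u * (μ * x + ν * y) + κ * E * (x + y)))
log-chord u κ D E l j f g μ ν x y b₀ b₁ b₂ = ≤-trans (≤-reflexive (left (u * E) f g x y))
  (≤-trans (+-mono-≤ (*-monoʳ-≤ (x * x) b₀) (+-mono-≤ (*-monoʳ-≤ (x * y) b₁) (*-monoʳ-≤ (y * y) b₂)))
    (≤-reflexive (right u κ D E l j μ ν x y)))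
  where
  left : ∀ v f g x y → v * (x + y) * (f * x + g * y) ≡ x * x * (v * f) + (x * y * (v * (f + g)) + y * y * (v * g))
  left = solve-∀
  right : ∀ u κ D E l j μ ν x y →
    x * x * (4 * D * (l * (u * μ + κ * E))) + (x * y * (4 * D * (l * (u * ν + κ * E) + j * (u * μ + κ * E)))
    + y * y * (4 * D * (j * (u * ν + κ * E)))) ≡
    4 * D * ((l * x + j * y) * (u * (μ * x + ν * y) + κ * E * (x + y)))
  right = solve-∀

-- The table

∨-true : ∀ {a b} → a ≡ true ⊎ b ≡ true → a ∨ b ≡ true
∨-true {true}          _           = refl
∨-true {false} {true}  _           = refl
∨-true {false} {false} (inj₁ ())
∨-true {false} {false} (inj₂ ())

∧-intro : ∀ {a b} → a ≡ true → b ≡ true → a ∧ b ≡ true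
∧-intro refl refl = refl

Bool-cases : ∀ b → b ≡ true ⊎ b ≡ false
Bool-cases true  = inj₁ refl
Bool-cases false = inj₂ refl

bernstein? : ∀ J l L R c → Dec (Bernstein J l L R c)
bernstein? J l L R (class α β γ) = _ ≤? _ ×-dec _ ≤? _ ×-dec _ ≤? _ ×-dec _ ≤? _

-- M = 2^s cells between 1/2 and 1, each of width 1 / J.  The entry f of a cell
-- bounds 4 D J times (complexity + 3 n) / 2^K - (n / 2^K) K at its left end.
module Table (s D B Rmax η₀ f₀ E-digits prec u w κ : ℕ) (single : Class) (merging : List Class)
  .{{_ : NonZero D}} .{{_ : NonZero prec}} where

  open LogDigits prec

  M J E : ℕ
  M = 2 ^ s
  J = 2 ^ suc s
  E = 2 ^ E-digits

  M-nonZero : NonZero M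
  M-nonZero = m^n≢0 2 s

  logarithm : ℕ → ℕ
  logarithm j = log-ratio E-digits M j {{M-nonZero}}

  -- Both tests are generous: a cell crossed by an end of the merging range counts for both
  -- insertions.
  single? merging? : ℕ → Bool
  single?  l = (10000 * l <ᵇ 5511 * J) ∨ (888 * J <ᵇ 1000 * suc l)
  merging? l = (5511 * J ≤ᵇ 10000 * suc l) ∧ (1000 * l <ᵇ 888 * J)

  select : Bool → Bool → List Class
  select false _     = merging
  select true  false = single ∷ []
  select true  true  = single ∷ merging

  -- A merging cell must satisfy all three shapes. On the merging range the shape that applies also
  -- has the largest leading bound, so this loses nothing and spares locating the transitions.
  active : ℕ → List Class
  active l = select (single? l) (merging? l)

  -- The values at the ends are rounded up, and raised by a little for the
  -- concavity of the bound.
  value : ℕ → Class → ℕ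
  -- A default that keeps the division total; the cells start at l = M ≥ 1.
  value zero      _             = 0
  value j@(suc _) (class α β γ) = (α * (j * j) + γ * (J * J) ∸ β * (J * j)) / (j * j) + η₀

  maximum : List ℕ → ℕ
  maximum = foldr (λ m n → if m ≤ᵇ n then n else m) 0

  -- The last entry is also the first one of the next scale, where n / 2^K is
  -- halved and K grows by one: hence f ≤ 4 D J + 2 f₀.
  Cells : (fuel l f λₗ : ℕ) → Set
  Cell′ : (fuel l f λₗ λⱼ L R : ℕ) → Set
  Cells zero       l f λₗ = f ≤ 4 * D * J + 2 * f₀
  Cells (suc fuel) l f λₗ = Cell′ fuel l f λₗ (logarithm (suc l))
    (maximum (map (value l) (active l))) (maximum (map (value (suc l)) (active l)))
  Cell′ fuel l f λₗ λⱼ L R = let g = f + (L + R + 3) in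
    All (Bernstein J l L R) (active l) × L ≤ R × R ≤ Rmax ×
    u * E * f ≤ 4 * D * (l * (u * λₗ + κ * E)) ×
    u * E * (f + g) ≤ 4 * D * (l * (u * λⱼ + κ * E) + suc l * (u * λₗ + κ * E)) ×
    u * E * g ≤ 4 * D * (suc l * (u * λⱼ + κ * E)) ×
    Cells fuel (suc l) g λⱼ

  cells? : ∀ fuel l f λₗ → Dec (Cells fuel l f λₗ)
  cell?  : ∀ fuel l f λₗ λⱼ L R → Dec (Cell′ fuel l f λₗ λⱼ L R)
  cells? zero       l f λₗ = _ ≤? _
  cells? (suc fuel) l f λₗ = cell? fuel l f λₗ _ _ _
  cell? fuel l f λₗ λⱼ L R = All.all? (bernstein? J l L R) (active l) ×-dec L ≤? R ×-dec R ≤? Rmax ×-dec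
    _ ≤? _ ×-dec _ ≤? _ ×-dec _ ≤? _ ×-dec cells? fuel (suc l) _ λⱼ

  ∈-select-merging : ∀ a {b c} → b ≡ true → c ∈ merging → c ∈ select a b
  ∈-select-merging false refl c∈ = c∈
  ∈-select-merging true  refl c∈ = Any.there c∈

  ∈-select-single : ∀ {a} b → a ≡ true → single ∈ select a b
  ∈-select-single false refl = Any.here refl
  ∈-select-single true  refl = Any.here refl

  module Sound (j₀ A : ℕ) (u≥ : w + (u + κ) ≤ 3 * u) (large : Rmax + B ≤ 2 ^ j₀)
    (single-bound : ∀ j n → j₀ ≤ j → 2 ^ (suc s + suc j) < 2 * n → n ≤ 2 ^ (suc s + suc j) → merges n ≡ false →
                    ClassBound D B single (suc s + suc j) n)
    (merging-bound : ∀ j n → j₀ ≤ j → 2 ^ (suc s + suc j) < 2 * n → n ≤ 2 ^ (suc s + suc j) → merges n ≡ true →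
                     ∃[ c ] c ∈ merging × ClassBound D B c (suc s + suc j) n) where

    module Scale (j : ℕ) (j₀≤j : j₀ ≤ j) where
      η H K′ K : ℕ
      η = 2 ^ j
      H = 2 * η
      K′ = s + suc j
      K = suc K′

      MH≡ : M * H ≡ 2 ^ K′
      MH≡ = sym (^-distribˡ-+-* 2 s (suc j))

      JH≡ : J * H ≡ 2 ^ K
      JH≡ = trans (*-assoc 2 M H) (cong (2 *_) MH≡)

      instance
        H-nonZero : NonZero H
        H-nonZero = m^n≢0 2 (suc j)

      class-of : ∀ {l n} → M ≤ l → l < J → l * H < n → n ≤ suc l * H → ∃[ c ] c ∈ active l × ClassBound D B c K n
      class-of {l} {n} M≤l l<J lo hi = [ merged , singled ]′ (Bool-cases (merges n))
        where
        lo′ : 2 ^ K < 2 * n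
        lo′ = *-monoʳ-< 2 (≤-<-trans (≤-reflexive (sym MH≡)) (≤-<-trans (*-monoˡ-≤ H M≤l) lo))
        hi′ : n ≤ 2 ^ K
        hi′ = ≤-trans hi (≤-trans (*-monoˡ-≤ H l<J) (≤-reflexive JH≡))
        Result : Set
        Result = ∃[ c ] c ∈ active l × ClassBound D B c K n
        merged : merges n ≡ true → Result
        merged eq = proj₁ found , ∈-select-merging (single? l) (∧-intro (≤⇒≤ᵇ-true lower) (<ᵇ-true upper)) (proj₁ (proj₂ found)) , proj₂ (proj₂ found)
          where
          found = merging-bound j n j₀≤j lo′ hi′ eq
          range : 5511 * 2 ^ K ≤ n * 10000 × n * 1000 ≤ 888 * 2 ^ K
          range = merges-true K′ n lo′ hi′ eq
          lower : 5511 * J ≤ 10000 * suc l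
          lower = *-cancelʳ-≤ _ _ H (≤-trans (≤-reflexive (trans (*-assoc 5511 J H) (cong (5511 *_) JH≡)))
            (≤-trans (proj₁ range) (≤-trans (*-monoˡ-≤ 10000 hi) (≤-reflexive (shape (suc l) H 10000)))))
            where
            shape : ∀ a b c → a * b * c ≡ c * a * b
            shape = solve-∀
          upper : 1000 * l < 888 * J
          upper = *-cancelʳ-< H _ _ (<-≤-trans (≤-<-trans (≤-reflexive (shape 1000 l H)) (*-monoˡ-< 1000 lo))
            (≤-trans (proj₂ range) (≤-reflexive (trans (cong (888 *_) (sym JH≡)) (sym (*-assoc 888 J H))))))
            where
            shape : ∀ a b c → a * b * c ≡ b * c * a
            shape = solve-∀
        singled : merges n ≡ false → Result
        singled eq = single , ∈-select-single (merging? l) (∨-true ([ (λ lt → inj₁ (<ᵇ-true (below lt))) , (λ lt → inj₂ (<ᵇ-true (above lt))) ]′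
            (merges-false K′ n lo′ hi′ eq))) , single-bound j n j₀≤j lo′ hi′ eq
          where
          below : n * 10000 < 5511 * 2 ^ K → 10000 * l < 5511 * J
          below lt = *-cancelʳ-< H _ _ (≤-<-trans (≤-reflexive (shape 10000 l H)) (≤-<-trans (*-monoˡ-≤ 10000 (<⇒≤ lo))
            (<-≤-trans lt (≤-reflexive (trans (cong (5511 *_) (sym JH≡)) (sym (*-assoc 5511 J H)))))))
            where
            shape : ∀ a b c → a * b * c ≡ b * c * a
            shape = solve-∀
          above : 888 * 2 ^ K < n * 1000 → 888 * J < 1000 * suc l
          above lt = *-cancelʳ-< H _ _ (≤-<-trans (≤-reflexive (trans (*-assoc 888 J H) (cong (888 *_) JH≡)))
            (<-≤-trans lt (≤-trans (*-monoˡ-≤ 1000 hi) (≤-reflexive (shape (suc l) H 1000)))))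
            where
            shape : ∀ a b c → a * b * c ≡ c * a * b
            shape = solve-∀

      Invariant : ℕ → ℕ → Set
      Invariant l f = AtMost (4 * D) (l * η) (4 * D * (l * H * K) + H * f + 4 * D * A)

      IsLog : ℕ → ℕ → Set
      IsLog l λₗ = 2 ^ λₗ * M ^ E ≤ l ^ E

      start : ∀ l → l * η * 2 ≡ l * H
      start l = trans (*-assoc l η 2) (cong (l *_) (*-comm η 2))

      lg-end : ∀ l λₗ → IsLog l λₗ → 2 ^ (λₗ + K′ * E) ≤ (l * H) ^ E
      lg-end l λₗ lg = begin
        2 ^ (λₗ + K′ * E)
          ≡⟨ ^-distribˡ-+-* 2 λₗ (K′ * E) ⟩
        2 ^ λₗ * 2 ^ (K′ * E)
          ≡⟨ cong (2 ^ λₗ *_) (trans (sym (^-*-assoc 2 K′ E)) (trans (cong (_^ E) (sym MH≡)) (^-distribʳ-* E M H))) ⟩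
        2 ^ λₗ * (M ^ E * H ^ E)
          ≡⟨ *-assoc (2 ^ λₗ) (M ^ E) (H ^ E) ⟨
        2 ^ λₗ * M ^ E * H ^ E
          ≤⟨ *-monoˡ-≤ (H ^ E) lg ⟩
        l ^ E * H ^ E
          ≡⟨ ^-distribʳ-* E l H ⟨
        (l * H) ^ E ∎
        where open ≤-Reasoning

      module InCell (l f λₗ λⱼ L R : ℕ) (M≤l : M ≤ l) (l<J : l < J) (lgₗ : IsLog l λₗ) (lgⱼ : IsLog (suc l) λⱼ)
        (inv : Invariant l f) (bern : All (Bernstein J l L R) (active l)) (L≤R : L ≤ R) (R≤ : R ≤ Rmax)
        (b₀ : u * E * f ≤ 4 * D * (l * (u * λₗ + κ * E)))
        (b₁ : u * E * (f + (f + (L + R + 3))) ≤ 4 * D * (l * (u * λⱼ + κ * E) + suc l * (u * λₗ + κ * E)))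
        (b₂ : u * E * (f + (L + R + 3)) ≤ 4 * D * (suc l * (u * λⱼ + κ * E))) where

        private
          g : ℕ
          g = f + (L + R + 3)
          l≥1 : 1 ≤ l
          l≥1 = ≤-trans (m^n>0 2 s) M≤l
          η≥1 : 1 ≤ η
          η≥1 = m^n>0 2 j
          η≤lη : η ≤ l * η
          η≤lη = m≤n*m η l {{>-nonZero l≥1}}
          R+B≤η : Rmax + B ≤ η
          R+B≤η = ≤-trans large (^-monoʳ-≤ 2 j₀≤j)
          classes : ∀ k → l * H < k * 2 → k * 2 ≤ suc l * H → ∃[ c ] Bernstein J l L R c × ClassBound D B c K (k * 2)
          classes k lo hi = proj₁ found , All.lookup bern (proj₁ (proj₂ found)) , proj₂ (proj₂ found)
            where
            found = class-of M≤l l<J lo hi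

        open Cell D B J l L R K η (l * η) η≥1 (≤-trans η≥1 η≤lη) (start l) JH≡ L≤R
          (≤-trans R≤ (≤-trans (m≤m+n Rmax B) R+B≤η))
          (≤-trans (+-monoˡ-≤ B R≤) (≤-trans R+B≤η (≤-trans η≤lη (m≤m*n (l * η) 2))))
          classes

        at : ∀ σ → 2 * σ ≤ H →
          AtMost (4 * D) (σ + l * η) (4 * D * (l * H * K) + H * f + 4 * D * A + 2 * σ * (4 * D * K + (L + R + 3)))
        at = cell-bound (4 * D * (l * H * K) + H * f + 4 * D * A) inv

        invariant⁺ : Invariant (suc l) g
        invariant⁺ = AtMost-weaken (4 * D) (suc l * η) (≤-reflexive (balance D l H K f A (L + R + 3))) (at η ≤-refl)
          where
          balance : ∀ D l H K f A G → 4 * D * (l * H * K) + H * f + 4 * D * A + H * (4 * D * K + G) ≡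
            4 * D * (suc l * H * K) + H * (f + G) + 4 * D * A
          balance = solve-∀

        power : ∀ σ x → 2 * σ + x ≡ H → PowerBound u w A (σ + l * η)
        power σ x σ+x≡ = power-bound u w κ D E H K′ k (f * x + g * y) (λₗ * x + λⱼ * y) A {{it}} {{m*n≢0 E H {{m^n≢0 2 E-digits}}}} u≥
          (AtMost-weaken (4 * D) k (≤-reflexive total) (at σ (≤-trans (m≤m+n y x) (≤-reflexive σ+x≡))))
          (subst₂ (λ h m → u * E * h * (f * x + g * y) ≤ 4 * D * (m * (u * (λₗ * x + λⱼ * y) + κ * E * h))) x+y≡ n≡
            (log-chord u κ D E l (suc l) f g λₗ λⱼ x y b₀ b₁ b₂))
          lg n≥2
          where
          y k n : ℕ
          y = 2 * σ
          k = σ + l * η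
          n = k * 2
          x+y≡ : x + y ≡ H
          x+y≡ = trans (+-comm x y) σ+x≡
          n≡lH+y : n ≡ l * H + y
          n≡lH+y = trans (shape σ (l * η)) (cong (_+ y) (start l))
            where
            shape : ∀ σ a → (σ + a) * 2 ≡ a * 2 + 2 * σ
            shape = solve-∀
          n≡ : l * x + suc l * y ≡ n
          n≡ = trans (shape l x y) (trans (cong (λ h → l * h + y) x+y≡) (sym n≡lH+y))
            where
            shape : ∀ l x y → l * x + suc l * y ≡ l * (x + y) + y
            shape = solve-∀
          n≥2 : 2 ≤ n
          n≥2 = *-monoˡ-≤ 2 (≤-trans (≤-trans η≥1 η≤lη) (m≤n+m (l * η) σ))
          total : 4 * D * (l * H * K) + H * f + 4 * D * A + y * (4 * D * K + (L + R + 3)) ≡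
                  4 * D * (n * K) + (f * x + g * y) + 4 * D * A
          total = trans (cong (λ h → 4 * D * (l * H * K) + h * f + 4 * D * A + y * (4 * D * K + (L + R + 3))) (sym x+y≡))
            (trans (shape D (l * H) K f A x y (L + R + 3)) (cong (λ n → 4 * D * (n * K) + (f * x + g * y) + 4 * D * A) (sym n≡lH+y)))
            where
            shape : ∀ D a K f A x y G → 4 * D * (a * K) + (x + y) * f + 4 * D * A + y * (4 * D * K + G) ≡
              4 * D * ((a + y) * K) + (f * x + (f + G) * y) + 4 * D * A
            shape = solve-∀
          n+x≡ : n + x ≡ suc l * H
          n+x≡ = trans (cong (_+ x) n≡lH+y) (trans (+-assoc (l * H) y x) (trans (cong (l * H +_) σ+x≡) (+-comm (l * H) H)))
          lg : 2 ^ (E * H * K′ + (λₗ * x + λⱼ * y)) ≤ n ^ (E * H)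
          lg = subst₂ (λ a b → 2 ^ a ≤ b) exponent (cong₂ _^_ 1+n≡ (cong (E *_) x+y≡))
            (2^≤^-chord (l * H) (suc l * H) (λₗ + K′ * E) (λⱼ + K′ * E) E (pred n) x y
              (lg-end l λₗ lgₗ) (lg-end (suc l) λⱼ lgⱼ) (trans (sym n≡lH+y) (sym 1+n≡)) (trans (cong (_+ x) 1+n≡) n+x≡))
            where
            1+n≡ : suc (pred n) ≡ n
            1+n≡ = suc-pred n {{>-nonZero (≤-trans (s≤s z≤n) n≥2)}}
            shape : ∀ λₗ λⱼ K E x y → (λₗ + K * E) * x + (λⱼ + K * E) * y ≡ E * (x + y) * K + (λₗ * x + λⱼ * y)
            shape = solve-∀
            exponent : (λₗ + K′ * E) * x + (λⱼ + K′ * E) * y ≡ E * H * K′ + (λₗ * x + λⱼ * y)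
            exponent = trans (shape λₗ λⱼ K′ E x y) (cong (λ h → E * h * K′ + (λₗ * x + λⱼ * y)) x+y≡)

      Log-suc : ∀ l → M ≤ l → IsLog l (logarithm l)
      Log-suc l M≤l = log-ratio-sound E-digits M l {{M-nonZero}} M≤l

      run : ∀ fuel l f λₗ → Cells fuel l f λₗ → M ≤ l → l + fuel ≡ J → IsLog l λₗ → Invariant l f →
        (∀ k → l * η ≤ k → k < J * η → PowerBound u w A k) × ∃[ f′ ] f′ ≤ 4 * D * J + 2 * f₀ × Invariant J f′
      run zero l f λₗ end M≤l l≡ lg inv =
        (λ k lo hi → contradiction (<-≤-trans hi (≤-trans (≤-reflexive (cong (_* η) l≡J)) lo)) (<-irrefl refl)) ,
        f , end , subst (λ l → Invariant l f) (sym l≡J) inv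
        where
        l≡J : J ≡ l
        l≡J = trans (sym l≡) (+-identityʳ l)
      run (suc fuel) l f λₗ (bern , L≤R , R≤ , b₀ , b₁ , b₂ , later) M≤l l≡ lg inv =
        (λ k lo hi → [ inside k lo , (λ le → proj₁ next k le hi) ]′ (<-≤-connex k (suc l * η))) , proj₂ next
        where
        lgⱼ = Log-suc (suc l) (m≤n⇒m≤1+n M≤l)
        l<J : l < J
        l<J = ≤-trans (≤-trans (s≤s (m≤m+n l fuel)) (≤-reflexive (sym (+-suc l fuel)))) (≤-reflexive l≡)
        open InCell l f λₗ _ _ _ M≤l l<J lg lgⱼ inv bern L≤R R≤ b₀ b₁ b₂
        next = run fuel (suc l) _ _ later (m≤n⇒m≤1+n M≤l) (trans (sym (+-suc l fuel)) l≡) lgⱼ invariant⁺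
        inside : ∀ k → l * η ≤ k → k < suc l * η → PowerBound u w A k
        inside k lo hi = subst (PowerBound u w A) (m∸n+n≡m lo)
          (power (k ∸ l * η) (H ∸ 2 * (k ∸ l * η)) (m+[n∸m]≡n (*-monoʳ-≤ 2 σ≤η)))
          where
          σ≤η : k ∸ l * η ≤ η
          σ≤η = m≤n+o⇒m∸n≤o k (l * η) (≤-trans (<⇒≤ hi) (≤-reflexive (+-comm η (l * η))))

    module _ (table : Cells M M f₀ 0) where
      private
        log-M : ∀ j (j₀≤j : j₀ ≤ j) → Scale.IsLog j j₀≤j M 0
        log-M j j₀≤j = ≤-reflexive (+-identityʳ _)

        scale : ∀ j (j₀≤j : j₀ ≤ j) → Scale.Invariant j j₀≤j M f₀ →
          (∀ k → M * 2 ^ j ≤ k → k < J * 2 ^ j → PowerBound u w A k) × Scale.Invariant (suc j) (m≤n⇒m≤1+n j₀≤j) M f₀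
        scale j j₀≤j inv = proj₁ result , subst (λ k → AtMost (4 * D) (M * 2 ^ suc j) (4 * D * (M * (2 * H) * suc k) + 2 * H * f₀ + 4 * D * A))
            (sym (+-suc s (suc j))) (AtMost-weaken (4 * D) (M * 2 ^ suc j)
            (linear _ _ 0 (*-monoʳ-≤ H (proj₁ (proj₂ (proj₂ result)))) (balance D M H K (proj₁ (proj₂ result)) f₀ A))
            (subst (λ k → AtMost (4 * D) k (4 * D * (J * H * K) + H * proj₁ (proj₂ result) + 4 * D * A)) (shape M (2 ^ j))
              (proj₂ (proj₂ (proj₂ result)))))
          where
          open Scale j j₀≤j
          result = run M M f₀ 0 table ≤-refl (sym (2*n≡n+n M)) (log-M j j₀≤j) inv
          shape : ∀ m η → 2 * m * η ≡ m * (2 * η)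
          shape = solve-∀
          balance : ∀ D M H K f f₀ A →
            4 * D * (M * (2 * H) * suc K) + 2 * H * f₀ + 4 * D * A + H * f ≡
            4 * D * (2 * M * H * K) + H * f + 4 * D * A + H * (4 * D * (2 * M) + 2 * f₀) + 0
          balance = solve-∀

      all-scales : Scale.Invariant j₀ ≤-refl M f₀ → ∀ d →
        (∀ k → M * 2 ^ j₀ ≤ k → k < M * 2 ^ (d + j₀) → PowerBound u w A k) × Scale.Invariant (d + j₀) (m≤n+m j₀ d) M f₀
      all-scales inv zero    = (λ k lo hi → contradiction (<-≤-trans hi lo) (<-irrefl refl)) , inv
      all-scales inv (suc d) =
        (λ k lo hi → [ proj₁ before k lo , (λ le → proj₁ next k le (<-≤-trans hi (≤-reflexive (shape M (2 ^ (d + j₀)))))) ]′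
                       (<-≤-connex k (M * 2 ^ (d + j₀)))) , proj₂ next
        where
        before = all-scales inv d
        next = scale (d + j₀) (m≤n+m j₀ d) (proj₂ before)
        shape : ∀ m η → m * (2 * η) ≡ 2 * m * η
        shape = solve-∀

-- Small inputs and the constant C

PowerBound-mono : ∀ u w {A C} k → 1 ≤ k → A ≤ C → PowerBound u w A k → PowerBound u w C k
PowerBound-mono u w (suc k) _ A≤C le = ≤-trans le (^-monoʳ-≤ (suc k * 2) (*-monoˡ-≤ (u * (suc k * 2) !) (+-monoʳ-≤ (suc k * 2) A≤C)))

-- As lg n ≥ 1, the term C lg n alone pays the whole cost.
PowerBound-small : ∀ u w C k → w ≤ 2 * u → 1 ≤ k → totalCost k + 2 * (k * 2) ≤ C → PowerBound u w C k
PowerBound-small u w C k w≤2u k≥1 le = ≤-trans (^-monoʳ-≤ 2 exponent) (^-monoˡ-≤ ((n + C) * (u * f)) (*-monoˡ-≤ 2 k≥1))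
  where
  n f : ℕ
  n = k * 2
  f = n !
  exponent : u * totalCost k + w * (n * f) ≤ (n + C) * (u * f)
  exponent = begin
    u * totalCost k + w * (n * f)
      ≤⟨ +-mono-≤ (*-monoʳ-≤ u (m≤m*n (totalCost k) f {{n !≢0}})) (*-monoˡ-≤ (n * f) w≤2u) ⟩
    u * (totalCost k * f) + 2 * u * (n * f)
      ≡⟨ shape u (totalCost k) f n ⟩
    (totalCost k + 2 * n) * (u * f)
      ≤⟨ *-monoˡ-≤ (u * f) (≤-trans le (m≤n+m C n)) ⟩
    (n + C) * (u * f) ∎
    where
    open ≤-Reasoning
    shape : ∀ u t f n → u * (t * f) + 2 * u * (n * f) ≡ (t + 2 * n) * (u * f)
    shape = solve-∀

≤∑ : ∀ n (f : ℕ → ℕ) i → i < n → f i ≤ ∑ n f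
≤∑ (suc n) f i i<n with m≤n⇒m<n∨m≡n (≤-pred i<n)
... | inj₁ i<n′ = ≤-trans (≤∑ n f i i<n′) (m≤m+n _ (f n))
... | inj₂ refl = m≤n+m (f n) (∑ n f)

AtMost-trivial : ∀ s k A W → totalCost k + 6 * k * (k * 2) ! ≤ A → AtMost s k (W + s * A)
AtMost-trivial s k A W le = begin
  s * (totalCost k + 6 * k * (k * 2) !)   ≤⟨ *-monoʳ-≤ s le ⟩
  s * A                                    ≤⟨ m≤n+m (s * A) W ⟩
  W + s * A                                ≤⟨ m≤n*m (W + s * A) ((k * 2) !) {{(k * 2) !≢0}} ⟩
  (k * 2) ! * (W + s * A)                  ∎
  where open ≤-Reasoning

·lg-intro : ∀ q a m x → ℚᵘ.↥ q ≡ ℤ.+ x → 2 ^ x ≤ m ^ (a * ℚᵘ.↧ₙ q) → q ≤ a ·lg m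
·lg-intro (mkℚᵘ .(ℤ.+ x) d) a m x refl le = le

·lg-sum : ∀ S f w u n a m .{{_ : NonZero f}} .{{_ : NonZero u}} → 2 ^ (u * S + w * (n * f)) ≤ m ^ (a * (u * f)) →
  (((ℤ.+ S) ℚᵘ./ f) ℚᵘ.+ ((ℤ.+ w) ℚᵘ./ u) ℚᵘ.* ((ℤ.+ n) ℚᵘ./ 1)) ≤ a ·lg m
·lg-sum S (suc f) w (suc u) n a m le = ·lg-intro _ a m _ numerator
  (subst₂ (λ x y → 2 ^ x ≤ m ^ (a * y)) (shape (suc u) S w n (suc f)) (denominator (suc u) (suc f)) le)
  where
  shape : ∀ u S w n f → u * S + w * (n * f) ≡ S * (u * 1) + w * n * f
  shape = solve-∀
  denominator : ∀ u f → u * f ≡ f * (u * 1)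
  denominator = solve-∀
  numerator : (ℤ.+ S) ℤ.* (ℤ.+ (suc u * 1)) ℤ.+ (ℤ.+ w) ℤ.* (ℤ.+ n) ℤ.* (ℤ.+ suc f) ≡
              ℤ.+ (S * (suc u * 1) + w * n * suc f)
  numerator = trans (cong₂ ℤ._+_ (sym (ℤ.pos-* S (suc u * 1)))
      (trans (cong (ℤ._* (ℤ.+ suc f)) (sym (ℤ.pos-* w n))) (sym (ℤ.pos-* (w * n) (suc f)))))
    (sym (ℤ.pos-+ (S * (suc u * 1)) (w * n * suc f)))

complexity-bound : ∀ u w C k .{{_ : NonZero u}} .{{_ : NonZero k}} → PowerBound u w C k → let n = k * 2 in
  (complexity ([1,2]Insertion k) ℚᵘ.+ ((ℤ.+ w) ℚᵘ./ u) ℚᵘ.* ((ℤ.+ n) ℚᵘ./ 1)) ≤ (n + C) ·lg n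
complexity-bound u w C (suc k) le = ·lg-sum S (n !) w u n (n + C) n {{n !≢0}}
  (≤-trans (^-monoʳ-≤ 2 (+-monoˡ-≤ (w * (n * n !)) (*-monoʳ-≤ u (totalCost-bound k v ascending)))) le)
  where
  n : ℕ
  n = suc k * 2
  v : Vec ℕ n
  v = Vec.tabulate toℕ
  ascending : Ascending v
  ascending = Ascending-tabulate n toℕ id
  S : ℕ
  S = ∑ₚ v (λ S → comparisons ([1,2]Insertion (suc k) S))

module Main (X r αₙ αₘ αₗ γₙ : ℕ) .{{_ : NonZero X}} (2r²≤X² : 2 * (r * r) ≤ X * X)
  (αₙ≡ : αₙ + 96 * r ≡ 100 * X) (αₗ≡ : αₗ + 96 * r ≡ 112 * X) (αₘ≡ : αₘ + 96 * r ≡ 104 * X)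
  (γₙ≡ : 64 * γₙ ≡ 336 * X) (s Rmax η₀ f₀ E-digits prec u w κ j₀ : ℕ) .{{_ : NonZero prec}}
  (w≤2u : w ≤ 2 * u) (u≥ : w + (u + κ) ≤ 3 * u) (j₀≥4 : 4 ≤ j₀)
  (large : Rmax + (base-cost + 432) * X ≤ 2 ^ j₀) where

  private
    D : ℕ
    D = 12 * X
    instance
      D-nonZero : NonZero D
      D-nonZero = m*n≢0 12 X

    classes : List Class
    classes = narrow X r αₙ αₘ αₗ γₙ 2r²≤X² αₙ≡ αₗ≡ αₘ≡ γₙ≡ ∷ mixed X r αₙ αₘ αₗ γₙ 2r²≤X² αₙ≡ αₗ≡ αₘ≡ γₙ≡
            ∷ wide X r αₙ αₘ αₗ γₙ 2r²≤X² αₙ≡ αₗ≡ αₘ≡ γₙ≡ ∷ []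

  open Table (3 + s) D ((base-cost + 432) * X) Rmax η₀ f₀ E-digits prec u w κ
    (single X r αₙ αₘ αₗ γₙ 2r²≤X² αₙ≡ αₗ≡ αₘ≡ γₙ≡) classes public

  -- A contains the entire shifted cost at k₀, which makes the first invariant trivial whatever `f₀`
  -- is; the sum in C covers every smaller k. Neither is ever evaluated: k₀ is 2^63 in `Numbers`.
  k₀ A C : ℕ
  k₀ = M * 2 ^ j₀
  A = totalCost k₀ + 6 * k₀ * (k₀ * 2) !
  C = A + ∑ k₀ (λ k → totalCost k + 2 * (k * 2))

  bound : Cells M M f₀ 0 → ∀ k → 1 ≤ k → PowerBound u w C k
  bound table k k≥1 = [ small , big ]′ (<-≤-connex k k₀)
    where
    open Sound j₀ A u≥ large
      (λ j n _ lo hi eq → single-bound X r αₙ αₘ αₗ γₙ 2r²≤X² αₙ≡ αₗ≡ αₘ≡ γₙ≡ (3 + s + suc j) n lo hi eq)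
      (λ j n j₀≤j lo hi eq → merge-class X r αₙ αₘ αₗ γₙ 2r²≤X² αₙ≡ αₗ≡ αₘ≡ γₙ≡ (s + suc j) n
        (≤-trans (≤ᵇ⇒≤ 10 (2 ^ 4) tt) (^-monoʳ-≤ 2 (≤-trans (≤-trans j₀≥4 j₀≤j) (≤-trans (n≤1+n j) (m≤n+m (suc j) s))))) lo hi eq)
    small : k < k₀ → PowerBound u w C k
    small k<k₀ = PowerBound-small u w C k w≤2u k≥1
      (≤-trans (≤∑ k₀ (λ k → totalCost k + 2 * (k * 2)) k k<k₀) (m≤n+m _ A))
    big : k₀ ≤ k → PowerBound u w C k
    big k₀≤k = PowerBound-mono u w k k≥1 (m≤m+n A _)
      (proj₁ (all-scales table base (suc k)) k k₀≤k (<-≤-trans (n<2^n k)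
        (≤-trans (^-monoʳ-≤ 2 (≤-trans (n≤1+n k) (m≤m+n (suc k) j₀))) (m≤n*m (2 ^ (suc k + j₀)) M {{M-nonZero}}))))
      where
      base : Scale.Invariant j₀ ≤-refl M f₀
      base = AtMost-trivial (4 * D) k₀ A (4 * D * (M * (2 * 2 ^ j₀) * suc (3 + s + suc j₀)) + 2 * 2 ^ j₀ * f₀) ≤-refl

  log-bound : ∀ m → m ≡ M → .{{_ : NonZero u}} → True (cells? m m f₀ 0) → ∃[ C ] (∀ k .{{_ : NonZero k}} → let n = k * 2 in
    (complexity ([1,2]Insertion k) ℚᵘ.+ ((ℤ.+ w) ℚᵘ./ u) ℚᵘ.* ((ℤ.+ n) ℚᵘ./ 1)) ≤ (n + C) ·lg n)
  log-bound m refl table = C , λ k → complexity-bound u w C k (bound (toWitness table) k (>-nonZero⁻¹ k))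

opaque
  unfolding base-cost

  base-cost-≤ : base-cost ≤ 40000
  base-cost-≤ = ≤ᵇ⇒≤ base-cost 40000 tt

-- `base-cost` is 35232; the round bound 40000 leads to the same exponent 52 for `j₀`.
base-cost-large : ∀ a x b → a + (40000 + 432) * x ≤ b → a + (base-cost + 432) * x ≤ b
base-cost-large a x b = ≤-trans (+-monoʳ-≤ a (*-monoˡ-≤ x (+-monoˡ-≤ 432 base-cost-≤)))

-- r / X is a lower bound of 1/√2, and j₀ is so large that the rounding errors
-- of one insertion are below the resolution of the table.  The slack η₀ and the
-- first entry f₀ were found by iterating the table numerically.
module Numbers = Main 100000000000 70710678118 3211774900672 3611774900672 4411774900672 525000000000
  (≤ᵇ⇒≤ (2 * (70710678118 * 70710678118)) (100000000000 * 100000000000) tt) refl refl refl refl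
  8 10000000000000 429155 5866527460750678 30 (2 ^ 64) 100000 140118 59882 52
  {{m^n≢0 2 64}} (≤ᵇ⇒≤ 140118 200000 tt) (≤ᵇ⇒≤ 300000 300000 tt) (≤ᵇ⇒≤ 4 52 tt)
  (base-cost-large 10000000000000 100000000000 (2 ^ 52)
    (≤ᵇ⇒≤ (10000000000000 + (40000 + 432) * 100000000000) (2 ^ 52) tt))

theorem1 : ∃[ C ] (∀ k .{{_ : NonZero k}} → let n = k * 2 in
    (complexity ([1,2]Insertion k) ℚᵘ.+ (ℤ.+ 140118 ℚᵘ./ 100000) ℚᵘ.* (ℤ.+ n ℚᵘ./ 1)) ≤ (n + C) ·lg n)
theorem1 = Numbers.log-bound 2048 refl tt
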